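{- In a model where a quantum algorithm can be halted as soon as its number of input queries exceeds a predefined threshold, computing the number $z$ of factors in the LZ77 factorization of a text $T[1..n]$ requires $\Omega(\sqrt{zn})$ input queries. In particular, for any function $t=t(n)$ and any constant $\varepsilon>0$, there is no quantum algorithm computing $z$ that uses $o(\sqrt{zn})$ queries for all texts with $z\in[t^{1-\varepsilon},t]$.
   Context: Model: the text $T[1..n]$ (over an integer alphabet) is accessible only through a quantum oracle which on query $i$ returns $T[i]$; query complexity is the number of oracle calls; an algorithm solves the problem if it outputs the correct answer with probability at least $\frac{2}{3}$. LZ77 factorization (greedy): start with $i=1$; while $i\le n$: if $T[i]$ is the first occurrence of its symbol, $T[i]$ is the next factor and $i\gets i+1$; otherwise take the largest $j\ge i$ such that $T[i..j]$ occurs in $T$ starting at some position $i'<i$, make $T[i..j]$ the next factor and set $i\gets j+1$. $z$ is the number of factors.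
   Formalization: The function t is required to satisfy 2 ≤ t(n) ≤ n for n ≥ 2; for arbitrary t the claim fails (t = 1 leaves no texts in the range, and t = n^{1/(1-ε)} leaves only z = n, decidable with O(n^{2/3}) queries). -}

module Defs where

open import Algebra.Bundles using (RawMonoid)
import Algebra.Definitions.RawMonoid as RawMonoidDefs
open import Data.Bool using (if_then_else_)
import Data.Fin as Fin
open Fin using (Fin; toℕ)
open import Data.Fin.Properties using (nonZeroIndex) renaming (_≟_ to _≟ᶠ_)
import Data.Integer as ℤ
open import Data.Maybe using (Maybe; just; nothing)
open import Data.Maybe.Properties using () renaming (≡-dec to maybe-≡-dec)
import Data.Nat as ℕ
open ℕ using (ℕ; zero; suc)
import Data.Nat.DivMod as ℕ
import Data.Nat.Properties as ℕ
open import Data.Product using (Σ; Σ-syntax; _×_; _,_; proj₁; proj₂)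
open import Data.Product.Properties using () renaming (≡-dec to ×-≡-dec)
open import Data.Rational
open import Data.Rational.Properties
open import Data.Rational.Solver using (module +-*-Solver)
open import Level using (0ℓ)
open import Relation.Binary.Definitions using (DecidableEquality)
open import Relation.Binary.PropositionalEquality
  using (_≡_; _≢_; refl; sym; trans; cong; cong₂; subst)
open import Relation.Nullary using (does)

fromℕ : ℕ → ℚ
fromℕ n = ℤ.+ n / 1

------------------------------------------------------------------------
-- Real numbers: Cauchy sequences of rationals with setoid equality

IsCauchy : (ℕ → ℚ) → Set
IsCauchy x = ∀ ε → 0ℚ < ε → Σ[ N ∈ ℕ ] ∀ m n → N ℕ.≤ m → N ℕ.≤ n → ∣ x m - x n ∣ ≤ ε

record ℝ : Set where
  constructor mkℝ
  field
    seq    : ℕ → ℚ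
    cauchy : IsCauchy seq

open ℝ public

-- Equality and order look only at the sequences, so moduli need not unfold.
abstract
  half-pos : ∀ {ε} → 0ℚ < ε → 0ℚ < ½ * ε
  half-pos {ε} 0<ε = subst (_< ½ * ε) (*-zeroʳ ½) (*-monoʳ-<-pos ½ 0<ε)

  halves : ∀ ε → ½ * ε + ½ * ε ≡ ε
  halves ε = trans (sym (*-distribʳ-+ ε ½ ½)) (*-identityˡ ε)

  const-cauchy : ∀ p → IsCauchy (λ _ → p)
  const-cauchy p ε 0<ε = 0 , λ _ _ _ _ →
    subst (λ q → ∣ q ∣ ≤ ε) (sym (+-inverseʳ p)) (<⇒≤ 0<ε)

  +-cauchy : ∀ {x y} → IsCauchy x → IsCauchy y → IsCauchy (λ k → x k + y k)
  +-cauchy {x} {y} cx cy ε 0<ε = N₁ ℕ.⊔ N₂ , bound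
    where
    N₁ N₂ : ℕ
    N₁ = proj₁ (cx (½ * ε) (half-pos 0<ε))
    N₂ = proj₁ (cy (½ * ε) (half-pos 0<ε))
    open ≤-Reasoning
    open +-*-Solver
    bound : ∀ m n → N₁ ℕ.⊔ N₂ ℕ.≤ m → N₁ ℕ.⊔ N₂ ℕ.≤ n → ∣ (x m + y m) - (x n + y n) ∣ ≤ ε
    bound m n N≤m N≤n = begin
      ∣ (x m + y m) - (x n + y n) ∣
        ≡⟨ cong ∣_∣ (solve 4 (λ a b c d → (a :+ b) :- (c :+ d) := (a :- c) :+ (b :- d))
                           refl (x m) (y m) (x n) (y n)) ⟩
      ∣ (x m - x n) + (y m - y n) ∣
        ≤⟨ ∣p+q∣≤∣p∣+∣q∣ (x m - x n) (y m - y n) ⟩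
      ∣ x m - x n ∣ + ∣ y m - y n ∣
        ≤⟨ +-mono-≤
             (proj₂ (cx (½ * ε) (half-pos 0<ε)) m n
               (ℕ.m⊔n≤o⇒m≤o N₁ N₂ N≤m) (ℕ.m⊔n≤o⇒m≤o N₁ N₂ N≤n))
             (proj₂ (cy (½ * ε) (half-pos 0<ε)) m n
               (ℕ.m⊔n≤o⇒n≤o N₁ N₂ N≤m) (ℕ.m⊔n≤o⇒n≤o N₁ N₂ N≤n)) ⟩
      ½ * ε + ½ * ε
        ≡⟨ halves ε ⟩
      ε ∎

  neg-cauchy : ∀ {x} → IsCauchy x → IsCauchy (λ k → - x k)
  neg-cauchy {x} cx ε 0<ε = proj₁ (cx ε 0<ε) , λ m n N≤m N≤n →
    subst (_≤ ε)
      (trans (sym (∣-p∣≡∣p∣ (x m - x n)))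
             (cong ∣_∣ (solve 2 (λ a b → :- (a :- b) := (:- a) :- (:- b)) refl (x m) (x n))))
      (proj₂ (cx ε 0<ε) m n N≤m N≤n)
    where open +-*-Solver

  0<1 : 0ℚ < 1ℚ
  0<1 = positive⁻¹ 1ℚ

  eventually-bounded : ∀ {x} → IsCauchy x →
    Σ[ B ∈ ℚ ] 0ℚ < B × (Σ[ N ∈ ℕ ] ∀ m → N ℕ.≤ m → ∣ x m ∣ ≤ B)
  eventually-bounded {x} cx = 1ℚ + ∣ x N ∣ , 0<B , N , bound
    where
    N : ℕ
    N = proj₁ (cx 1ℚ 0<1)
    0<B : 0ℚ < 1ℚ + ∣ x N ∣
    0<B = subst (_< 1ℚ + ∣ x N ∣) (+-identityʳ 0ℚ) (+-mono-<-≤ 0<1 (0≤∣p∣ (x N)))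
    open ≤-Reasoning
    open +-*-Solver
    bound : ∀ m → N ℕ.≤ m → ∣ x m ∣ ≤ 1ℚ + ∣ x N ∣
    bound m N≤m = begin
      ∣ x m ∣
        ≡⟨ cong ∣_∣ (solve 2 (λ a b → a := (a :- b) :+ b) refl (x m) (x N)) ⟩
      ∣ (x m - x N) + x N ∣
        ≤⟨ ∣p+q∣≤∣p∣+∣q∣ (x m - x N) (x N) ⟩
      ∣ x m - x N ∣ + ∣ x N ∣
        ≤⟨ +-monoˡ-≤ ∣ x N ∣ (proj₂ (cx 1ℚ 0<1) m N N≤m ℕ.≤-refl) ⟩
      1ℚ + ∣ x N ∣ ∎

  quotient : ∀ {ε B} → 0ℚ < ε → 0ℚ < B → Σ[ η ∈ ℚ ] 0ℚ < η × η * B ≡ ε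
  quotient {ε} {B} 0<ε 0<B = ε * B⁻¹ , 0<εB⁻¹ , εB⁻¹B≡ε
    where
    B≢0 : NonZero B
    B≢0 = pos⇒nonZero B {{positive 0<B}}
    B⁻¹ : ℚ
    B⁻¹ = (1/ B) {{B≢0}}
    0<εB⁻¹ : 0ℚ < ε * B⁻¹
    0<εB⁻¹ = subst (_< ε * B⁻¹) (*-zeroˡ B⁻¹)
      (*-monoˡ-<-pos B⁻¹ {{1/pos⇒pos B {{positive 0<B}}}} 0<ε)
    εB⁻¹B≡ε : ε * B⁻¹ * B ≡ ε
    εB⁻¹B≡ε = trans (*-assoc ε B⁻¹ B) (trans (cong (ε *_) (*-inverseˡ B {{B≢0}})) (*-identityʳ ε))

  *-mono-≤ : ∀ {p q r s} → 0ℚ ≤ q → 0ℚ ≤ r → p ≤ q → r ≤ s → p * r ≤ q * s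
  *-mono-≤ {p} {q} {r} {s} 0≤q 0≤r p≤q r≤s =
    ≤-trans (*-monoʳ-≤-nonNeg r {{nonNegative 0≤r}} p≤q) (*-monoˡ-≤-nonNeg q {{nonNegative 0≤q}} r≤s)

  ∣ab-cd∣≤ : ∀ a b c d {B C η} → 0ℚ ≤ B → 0ℚ ≤ η → ∣ a ∣ ≤ B → ∣ d ∣ ≤ C →
    ∣ a - c ∣ ≤ η → ∣ b - d ∣ ≤ η → ∣ a * b - c * d ∣ ≤ η * (B + C)
  ∣ab-cd∣≤ a b c d {B} {C} {η} 0≤B 0≤η ∣a∣≤B ∣d∣≤C ∣a-c∣≤η ∣b-d∣≤η = begin
    ∣ a * b - c * d ∣
      ≡⟨ cong ∣_∣ (solve 4 (λ a b c d → (a :* b) :- (c :* d) := (a :* (b :- d)) :+ ((a :- c) :* d))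
                         refl a b c d) ⟩
    ∣ a * (b - d) + (a - c) * d ∣
      ≤⟨ ∣p+q∣≤∣p∣+∣q∣ (a * (b - d)) ((a - c) * d) ⟩
    ∣ a * (b - d) ∣ + ∣ (a - c) * d ∣
      ≡⟨ cong₂ _+_ (∣p*q∣≡∣p∣*∣q∣ a (b - d)) (∣p*q∣≡∣p∣*∣q∣ (a - c) d) ⟩
    ∣ a ∣ * ∣ b - d ∣ + ∣ a - c ∣ * ∣ d ∣
      ≤⟨ +-mono-≤ (*-mono-≤ 0≤B (0≤∣p∣ (b - d)) ∣a∣≤B ∣b-d∣≤η)
                  (*-mono-≤ 0≤η (0≤∣p∣ d) ∣a-c∣≤η ∣d∣≤C) ⟩
    B * η + η * C
      ≡⟨ solve 3 (λ B C η → (B :* η) :+ (η :* C) := η :* (B :+ C)) refl B C η ⟩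
    η * (B + C) ∎
    where
    open ≤-Reasoning
    open +-*-Solver

  *-cauchy : ∀ {x y} → IsCauchy x → IsCauchy y → IsCauchy (λ k → x k * y k)
  *-cauchy {x} {y} cx cy ε 0<ε = combine (eventually-bounded {x} cx) (eventually-bounded {y} cy)
    where
    module _ {B C η} (0<B : 0ℚ < B) (0<η : 0ℚ < η) (η[B+C]≡ε : η * (B + C) ≡ ε) where
      close : (Σ[ N ∈ ℕ ] ∀ m → N ℕ.≤ m → ∣ x m ∣ ≤ B) → (Σ[ N ∈ ℕ ] ∀ m → N ℕ.≤ m → ∣ y m ∣ ≤ C) →
              (Σ[ N ∈ ℕ ] ∀ m n → N ℕ.≤ m → N ℕ.≤ n → ∣ x m - x n ∣ ≤ η) →
              (Σ[ N ∈ ℕ ] ∀ m n → N ℕ.≤ m → N ℕ.≤ n → ∣ y m - y n ∣ ≤ η) →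
              Σ[ N ∈ ℕ ] ∀ m n → N ℕ.≤ m → N ℕ.≤ n → ∣ x m * y m - x n * y n ∣ ≤ ε
      close (N₁ , ∣x∣≤B) (N₂ , ∣y∣≤C) (N₃ , x-close) (N₄ , y-close) = N , λ m n N≤m N≤n →
        subst (∣ x m * y m - x n * y n ∣ ≤_) η[B+C]≡ε
          (∣ab-cd∣≤ (x m) (y m) (x n) (y n) (<⇒≤ 0<B) (<⇒≤ 0<η)
            (∣x∣≤B m (≤₁ N≤m)) (∣y∣≤C n (≤₂ N≤n))
            (x-close m n (≤₃ N≤m) (≤₃ N≤n)) (y-close m n (≤₄ N≤m) (≤₄ N≤n)))
        where
        N : ℕ
        N = (N₁ ℕ.⊔ N₂) ℕ.⊔ (N₃ ℕ.⊔ N₄)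
        ≤₁₂ : ∀ {k} → N ℕ.≤ k → N₁ ℕ.⊔ N₂ ℕ.≤ k
        ≤₁₂ = ℕ.m⊔n≤o⇒m≤o (N₁ ℕ.⊔ N₂) (N₃ ℕ.⊔ N₄)
        ≤₃₄ : ∀ {k} → N ℕ.≤ k → N₃ ℕ.⊔ N₄ ℕ.≤ k
        ≤₃₄ = ℕ.m⊔n≤o⇒n≤o (N₁ ℕ.⊔ N₂) (N₃ ℕ.⊔ N₄)
        ≤₁ : ∀ {k} → N ℕ.≤ k → N₁ ℕ.≤ k
        ≤₁ N≤k = ℕ.m⊔n≤o⇒m≤o N₁ N₂ (≤₁₂ N≤k)
        ≤₂ : ∀ {k} → N ℕ.≤ k → N₂ ℕ.≤ k
        ≤₂ N≤k = ℕ.m⊔n≤o⇒n≤o N₁ N₂ (≤₁₂ N≤k)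
        ≤₃ : ∀ {k} → N ℕ.≤ k → N₃ ℕ.≤ k
        ≤₃ N≤k = ℕ.m⊔n≤o⇒m≤o N₃ N₄ (≤₃₄ N≤k)
        ≤₄ : ∀ {k} → N ℕ.≤ k → N₄ ℕ.≤ k
        ≤₄ N≤k = ℕ.m⊔n≤o⇒n≤o N₃ N₄ (≤₃₄ N≤k)
    combine : (Σ[ B ∈ ℚ ] 0ℚ < B × (Σ[ N ∈ ℕ ] ∀ m → N ℕ.≤ m → ∣ x m ∣ ≤ B)) →
              (Σ[ C ∈ ℚ ] 0ℚ < C × (Σ[ N ∈ ℕ ] ∀ m → N ℕ.≤ m → ∣ y m ∣ ≤ C)) →
              Σ[ N ∈ ℕ ] ∀ m n → N ℕ.≤ m → N ℕ.≤ n → ∣ x m * y m - x n * y n ∣ ≤ ε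
    combine (B , 0<B , bx) (C , 0<C , by)
      using η , 0<η , η[B+C]≡ε ← quotient 0<ε
              (subst (_< B + C) (+-identityʳ 0ℚ) (+-mono-< 0<B 0<C))
      = close 0<B 0<η η[B+C]≡ε bx by (cx η 0<η) (cy η 0<η)

infix  4 _≈ᴿ_ _≤ᴿ_
infixl 6 _+ᴿ_
infixl 7 _*ᴿ_
infix  8 -ᴿ_

fromℚ : ℚ → ℝ
fromℚ p = mkℝ (λ _ → p) (const-cauchy p)

0ᴿ 1ᴿ : ℝ
0ᴿ = fromℚ 0ℚ
1ᴿ = fromℚ 1ℚ

_+ᴿ_ _*ᴿ_ : ℝ → ℝ → ℝ
x +ᴿ y = mkℝ (λ k → seq x k + seq y k) (+-cauchy {seq x} {seq y} (cauchy x) (cauchy y))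
x *ᴿ y = mkℝ (λ k → seq x k * seq y k) (*-cauchy {seq x} {seq y} (cauchy x) (cauchy y))

-ᴿ_ : ℝ → ℝ
-ᴿ x = mkℝ (λ k → - seq x k) (neg-cauchy {seq x} (cauchy x))

_≈ᴿ_ _≤ᴿ_ : ℝ → ℝ → Set
x ≈ᴿ y = ∀ ε → 0ℚ < ε → Σ[ N ∈ ℕ ] ∀ m → N ℕ.≤ m → ∣ seq x m - seq y m ∣ ≤ ε
x ≤ᴿ y = ∀ ε → 0ℚ < ε → Σ[ N ∈ ℕ ] ∀ m → N ℕ.≤ m → seq x m ≤ seq y m + ε

Positiveᴿ : ℝ → Set
Positiveᴿ x = Σ[ δ ∈ ℚ ] 0ℚ < δ × (Σ[ N ∈ ℕ ] ∀ m → N ℕ.≤ m → δ ≤ seq x m)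

------------------------------------------------------------------------
-- Complex numbers

infix  4 _≈ᶜ_
infixl 6 _+ᶜ_
infixl 7 _*ᶜ_

record ℂ : Set where
  constructor _+i_
  field
    re im : ℝ

open ℂ public

0ᶜ 1ᶜ : ℂ
0ᶜ = 0ᴿ +i 0ᴿ
1ᶜ = 1ᴿ +i 0ᴿ

_+ᶜ_ _*ᶜ_ : ℂ → ℂ → ℂ
(a +i b) +ᶜ (c +i d) = (a +ᴿ c) +i (b +ᴿ d)
(a +i b) *ᶜ (c +i d) = (a *ᴿ c +ᴿ -ᴿ (b *ᴿ d)) +i (a *ᴿ d +ᴿ b *ᴿ c)

conj : ℂ → ℂ
conj (a +i b) = a +i (-ᴿ b)

∣_∣² : ℂ → ℝ
∣ a +i b ∣² = a *ᴿ a +ᴿ b *ᴿ b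

_≈ᶜ_ : ℂ → ℂ → Set
x ≈ᶜ y = re x ≈ᴿ re y × im x ≈ᴿ im y

+ᴿ-rawMonoid +ᶜ-rawMonoid : RawMonoid 0ℓ 0ℓ
+ᴿ-rawMonoid = record { Carrier = ℝ ; _≈_ = _≈ᴿ_ ; _∙_ = _+ᴿ_ ; ε = 0ᴿ }
+ᶜ-rawMonoid = record { Carrier = ℂ ; _≈_ = _≈ᶜ_ ; _∙_ = _+ᶜ_ ; ε = 0ᶜ }

------------------------------------------------------------------------
-- Texts and the LZ77 factorization (positions are 0-based)

Text : ℕ → ℕ → Set
Text n σ = Fin n → Fin σ

module _ {n σ : ℕ} (T : Text n σ) where

  FirstOccurrence : Fin n → Set
  FirstOccurrence i = ∀ i′ → i′ Fin.< i → T i′ ≢ T i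

  -- T[i..j] occurs in T starting at some i′ < i (overlap is allowed):
  -- T[x] = T[y] whenever i ≤ x ≤ j and x - i = y - i′.
  OccursEarlier : Fin n → Fin n → Set
  OccursEarlier i j =
    Σ[ i′ ∈ Fin n ] i′ Fin.< i ×
      (∀ x y → i Fin.≤ x → x Fin.≤ j → toℕ x ℕ.+ toℕ i′ ≡ toℕ y ℕ.+ toℕ i → T x ≡ T y)

  -- Factors i k: started at position i, the greedy procedure produces k
  -- further factors.
  data Factors : ℕ → ℕ → Set where
    done : Factors n 0
    new  : ∀ {k} i → FirstOccurrence i →
           Factors (suc (toℕ i)) k → Factors (toℕ i) (suc k)
    copy : ∀ {k} i j → i Fin.≤ j → OccursEarlier i j →
           (∀ j′ → i Fin.≤ j′ → OccursEarlier i j′ → j′ Fin.≤ j) →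
           Factors (suc (toℕ j)) k → Factors (toℕ i) (suc k)

  LZ77-size : ℕ → Set
  LZ77-size z = Factors 0 z

------------------------------------------------------------------------
-- Quantum query algorithms

-- Computational basis |i, b, w⟩: query index, answer register, workspace.
Basis : ℕ → ℕ → ℕ → Set
Basis n σ d = Fin n × Fin σ × Fin d

module _ {n σ d : ℕ} where

  _≟ᴮ_ : DecidableEquality (Basis n σ d)
  _≟ᴮ_ = ×-≡-dec _≟ᶠ_ (×-≡-dec _≟ᶠ_ _≟ᶠ_)

  State Operator : Set
  State    = Basis n σ d → ℂ
  Operator = Basis n σ d → Basis n σ d → ℂ

  ∑ᴮ : (M : RawMonoid 0ℓ 0ℓ) → (Basis n σ d → RawMonoid.Carrier M) → RawMonoid.Carrier M
  ∑ᴮ M f = sum λ i → sum λ b → sum λ w → f (i , b , w)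
    where open RawMonoidDefs M using (sum)

  ∣_⟩ : Basis n σ d → State
  ∣ x ⟩ y = if does (x ≟ᴮ y) then 1ᶜ else 0ᶜ

  infixr 7 _·_
  _·_ : Operator → State → State
  (U · ψ) x = ∑ᴮ +ᶜ-rawMonoid λ y → U x y *ᶜ ψ y

  Unitary : Operator → Set
  Unitary U = ∀ x y →
    (∑ᴮ +ᶜ-rawMonoid (λ k → conj (U k x) *ᶜ U k y) ≈ᶜ ∣ x ⟩ y) ×
    (∑ᴮ +ᶜ-rawMonoid (λ k → U x k *ᶜ conj (U y k)) ≈ᶜ ∣ x ⟩ y)

_⊖_ : ∀ {σ} → Fin σ → Fin σ → Fin σ
_⊖_ {σ} b a = (toℕ b ℕ.+ (σ ℕ.∸ toℕ a)) ℕ.mod σ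
  where instance _ = nonZeroIndex b

-- |i, b, w⟩ ↦ |i, b + T[i] mod σ, w⟩, acting on amplitudes
oracle : ∀ {n σ d} → Text n σ → State {n} {σ} {d} → State {n} {σ} {d}
oracle T ψ (i , b , w) = ψ (i , b ⊖ T i , w)

-- An algorithm for texts in [0..σ)^n alternates unitaries with queries.
-- After each unitary it measures the observable `result`: the outcome
-- `just v` halts the run with output v, while on `nothing` it makes its next
-- query.  Hence the number of queries made is a classical quantity, which may
-- depend on the text and on which the run can be cut off.
record Algorithm (n σ : ℕ) : Set where
  field
    d             : ℕ
    start         : Basis n σ d
    step          : ℕ → Operator {n} {σ} {d}
    step-unitary  : ∀ k → Unitary (step k)
    result        : Basis n σ d → Maybe ℕ

module _ {n σ : ℕ} (A : Algorithm n σ) (T : Text n σ) where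
  open Algorithm A

  project : Maybe ℕ → State {n} {σ} {d} → State {n} {σ} {d}
  project o ψ x = if does (maybe-≡-dec ℕ._≟_ (result x) o) then ψ x else 0ᶜ

  -- Unnormalised state just before the measurement following the k-th query,
  -- so that squared norms are unconditional probabilities.
  stateAt : ℕ → State {n} {σ} {d}
  stateAt zero    = step 0 · ∣ start ⟩
  stateAt (suc k) = step (suc k) · oracle T (project nothing (stateAt k))

  -- probability of halting after exactly k queries with output v
  haltProb : ℕ → ℕ → ℝ
  haltProb v k = ∑ᴮ +ᴿ-rawMonoid λ x → ∣ project (just v) (stateAt k) x ∣²

  -- probability of halting after at most k queries with output v
  outputProb : ℕ → ℕ → ℝ
  outputProb v zero    = haltProb v zero
  outputProb v (suc k) = outputProb v k +ᴿ haltProb v (suc k)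

  -- lim_k outputProb v k ≥ 2/3; the partial sums are nondecreasing in k.
  Outputs : ℕ → Set
  Outputs v = ∀ δ → 0ℚ < δ → Σ[ k ∈ ℕ ] fromℚ (ℤ.+ 2 / 3 - δ) ≤ᴿ outputProb v k

  UsesAtMost : ℕ → Set
  UsesAtMost q = ∀ x → project nothing (stateAt q) x ≈ᶜ 0ᶜ

  -- at most c√m queries (c > 0), with the inequality squared
  UsesAtMost-sqrt : ℚ → ℕ → Set
  UsesAtMost-sqrt c m =
    Σ[ q ∈ ℕ ] UsesAtMost q × fromℕ q * fromℕ q ≤ c * c * fromℕ m

ComputesLZ77-size : ∀ {n σ} → Algorithm n σ → Set
ComputesLZ77-size A = ∀ T z → LZ77-size T z → Outputs A T z

------------------------------------------------------------------------
-- The interval [t^(1-ε), t]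

-- For t ≥ 1 the real power t^(1-ε) is the supremum of t^(1-p/q) over the
-- rationals p/q ≥ ε, and t^(1-p/q) ≤ z is t^(q-p) ≤ z^q.  Truncated
-- subtraction is harmless: if p ≥ q then t^(1-p/q) ≤ 1 ≤ z.
_^[1-_]≤_ : ℕ → ℝ → ℕ → Set
t ^[1- ε ]≤ z =
  1 ℕ.≤ z ×
  (∀ p q .{{_ : ℕ.NonZero q}} → ε ≤ᴿ fromℚ (ℤ.+ p / q) → t ℕ.^ (q ℕ.∸ p) ℕ.≤ z ℕ.^ q)

SizeInRange : ℕ → ℝ → ℕ → Set
SizeInRange t ε z = t ^[1- ε ]≤ z × z ℕ.≤ t

-- A uses at most c√(zn) queries on every text whose factorization size z lies
-- in [t^(1-ε), t].
CheapOnRange : ∀ {n σ} → Algorithm n σ → ℚ → ℕ → ℝ → Set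
CheapOnRange {n} A c t ε =
  ∀ T z → LZ77-size T z → SizeInRange t ε z → UsesAtMost-sqrt A T c (z ℕ.* n)

{-# OPTIONS --safe #-}

-- Consider the texts that are constant on their first half and in which each of M ~ n/8 later
-- blocks of length two may start with a letter of its own; those with k such marks have
-- z = 2k + 2 factors (2k + 3 with one more mark at the very end).  An algorithm that is cheap on
-- the texts with k marks must separate each of them from the texts with one mark added.
--
-- This is Ambainis' adversary argument, with the halting measurements included: the real inner
-- product of the runs on two such texts S ⊂ T, together with that of the branches already halted,
-- starts at 1, ends bounded away from 1, and in each query loses at most
-- l ‖P ψ_S‖² + m ‖P ψ_T‖², where l m = 1 and P projects onto the one position where S and T differ.
-- Summed over all pairs S ⊂ T, the Q queries yield a constant ≤ l Q / (M - k) + m Q / (k + 1), so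
-- Q² is at least of order (M - k)(k + 1) ~ z n.

module Submission where

open import Defs
open import Algebra.Bundles using (CommutativeRing)
import Algebra.Properties.Semiring.Sum as SemiringSum
open import Data.Bool as Bool using (Bool; true; false; if_then_else_)
import Data.Fin as Fin
open Fin using (Fin; zero; suc; toℕ; fromℕ<)
open import Data.Fin.Permutation using (Permutation′; permutation)
import Data.Fin.Properties as Fin
open import Data.Fin.Subset using (Subset; ∁) renaming (∣_∣ to card)
import Data.Fin.Subset.Properties as Subset
import Data.Integer as ℤ
import Data.Integer.Properties as ℤ
open import Data.List using (List; []; _∷_; _++_; length; replicate)
import Data.List.Properties as List
open import Data.Maybe using (Maybe; just; nothing)
open import Data.Maybe.Properties using (just-injective) renaming (≡-dec to maybe-≡-dec)
import Data.Nat as ℕ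
open ℕ using (ℕ; zero; suc; NonZero; _≤_)
import Data.Nat.DivMod as ℕ
import Data.Nat.Properties as ℕ
open import Data.Nat.Solver using () renaming (module +-*-Solver to ℕ-Solver)
open import Data.Product using (Σ-syntax; _×_; _,_; proj₁; proj₂)
import Data.Rational as ℚ
open ℚ using (ℚ; 0ℚ; 1ℚ; ½; ∣_∣; _<_) renaming (_+_ to _+ℚ_; _*_ to _*ℚ_; _-_ to _-ℚ_; -_ to -ℚ_; _≤_ to _≤ℚ_)
import Data.Rational.Properties as ℚ
open import Data.Rational.Solver using (module +-*-Solver)
import Data.Rational.Unnormalised as ℚᵘ
import Data.Rational.Unnormalised.Properties as ℚᵘ
open import Data.Sum using (_⊎_; inj₁; inj₂)
open import Data.Vec using ([]; _∷_; lookup; _[_]≔_)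
open import Function using (_∘_; const)
open import Level using (0ℓ)
open import Relation.Binary.Definitions using (tri<; tri≈; tri>)
open import Relation.Binary.PropositionalEquality as ≡ using (_≡_; _≢_)
import Relation.Binary.Reasoning.Setoid as SetoidReasoning
open import Relation.Nullary using (¬_; contradiction; does; yes; no)
open import Relation.Nullary.Decidable using (dec-true; dec-false)

-- Real and complex numbers as ordered and commutative rings

-- The query bound is assumed only for texts whose size lies in the range. If z = t, the larger text
-- of a pair has size z + 2 and falls outside, so nothing limits its run: after Q queries part of it
-- may still be live, and only the correctness of its eventual output is known. Its query weight is
-- therefore cut off after Q queries, and the comparison of the two runs must tolerate live
-- amplitude. It does so with an unequal AM-GM: 12 u·v is at most 4|u|² + 9|v|² on branches halted
-- with the smaller text's answer and at most 9|u|² + 4|v|² on all others, live ones included. The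
-- ratio 3/2 between the two lengths stands in for √2, the best one for error 1/3, and keeps all
-- weights integral. A mark must alter a single letter and yet change z by the same amount wherever
-- it stands. Hence the unmarked letter after every mark, and the constant first half, a source long
-- enough for every later run.

infix 4 _≃_ _≼_

-- Wrapping the setoid relations in records lets Agda infer their endpoints.
record _≃_ (x y : ℝ) : Set where
  constructor mk≃
  field un≃ : x ≈ᴿ y

record _≼_ (x y : ℝ) : Set where
  constructor mk≼
  field un≼ : x ≤ᴿ y

open _≃_

≃-pointwise : ∀ {x y} → (∀ k → seq x k ≡ seq y k) → x ≃ y
≃-pointwise {x} {y} eq = mk≃ λ ε 0<ε → 0 , λ m _ →
  ≡.subst (λ q → ∣ q ∣ ≤ℚ ε)
    (≡.sym (≡.trans (≡.cong (_-ℚ seq y m) (eq m)) (ℚ.+-inverseʳ (seq y m)))) (ℚ.<⇒≤ 0<ε)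

≼-pointwise : ∀ {x y} → (∀ k → seq x k ≤ℚ seq y k) → x ≼ y
≼-pointwise {x} {y} le = mk≼ λ ε 0<ε → 0 , λ m _ → ℚ.≤-trans (le m)
  (≡.subst (_≤ℚ seq y m +ℚ ε) (ℚ.+-identityʳ (seq y m)) (ℚ.+-monoʳ-≤ (seq y m) (ℚ.<⇒≤ 0<ε)))

private
  combine : ∀ {p} {P Q : ℕ → Set p} →
            Σ[ N ∈ ℕ ] (∀ m → N ℕ.≤ m → P m) → Σ[ N ∈ ℕ ] (∀ m → N ℕ.≤ m → Q m) →
            Σ[ N ∈ ℕ ] (∀ m → N ℕ.≤ m → P m × Q m)
  combine (N₁ , p) (N₂ , q) = N₁ ℕ.⊔ N₂ , λ m N≤m →
    p m (ℕ.m⊔n≤o⇒m≤o N₁ N₂ N≤m) , q m (ℕ.m⊔n≤o⇒n≤o N₁ N₂ N≤m)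

  weaken : ∀ {p} {P Q : ℕ → Set p} → (∀ m → P m → Q m) →
           Σ[ N ∈ ℕ ] (∀ m → N ℕ.≤ m → P m) → Σ[ N ∈ ℕ ] (∀ m → N ℕ.≤ m → Q m)
  weaken f (N , p) = N , λ m N≤m → f m (p m N≤m)

module _ where
  open ℚ.≤-Reasoning
  open +-*-Solver

  ≼-trans : ∀ {x y z} → x ≼ y → y ≼ z → x ≼ z
  ≼-trans {x} {y} {z} (mk≼ p) (mk≼ q) = mk≼ λ ε 0<ε →
    weaken (λ m (x≤y , y≤z) → begin
      seq x m                               ≤⟨ x≤y ⟩
      seq y m +ℚ ½ *ℚ ε                     ≤⟨ ℚ.+-monoˡ-≤ (½ *ℚ ε) y≤z ⟩
      seq z m +ℚ ½ *ℚ ε +ℚ ½ *ℚ ε           ≡⟨ ℚ.+-assoc (seq z m) (½ *ℚ ε) (½ *ℚ ε) ⟩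
      seq z m +ℚ (½ *ℚ ε +ℚ ½ *ℚ ε)         ≡⟨ ≡.cong (seq z m +ℚ_) (halves ε) ⟩
      seq z m +ℚ ε                          ∎)
    (combine (p (½ *ℚ ε) (half-pos 0<ε)) (q (½ *ℚ ε) (half-pos 0<ε)))

  ≃⇒≼ : ∀ {x y} → x ≃ y → x ≼ y
  ≃⇒≼ {x} {y} (mk≃ p) = mk≼ λ ε 0<ε → weaken (λ m close → begin
      seq x m                          ≡⟨ solve 2 (λ a b → a := b :+ (a :- b)) ≡.refl (seq x m) (seq y m) ⟩
      seq y m +ℚ (seq x m -ℚ seq y m)  ≤⟨ ℚ.+-monoʳ-≤ (seq y m) (p≤∣p∣ (seq x m -ℚ seq y m)) ⟩
      seq y m +ℚ ∣ seq x m -ℚ seq y m ∣ ≤⟨ ℚ.+-monoʳ-≤ (seq y m) close ⟩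
      seq y m +ℚ ε                     ∎) (p ε 0<ε)
    where
    p≤∣p∣ : ∀ p → p ≤ℚ ∣ p ∣
    p≤∣p∣ p with ℚ.≤-total 0ℚ p
    ... | inj₁ 0≤p = ℚ.≤-reflexive (≡.sym (ℚ.0≤p⇒∣p∣≡p 0≤p))
    ... | inj₂ p≤0 = ℚ.≤-trans p≤0 (ℚ.0≤∣p∣ p)

  ≃-refl : ∀ {x} → x ≃ x
  ≃-refl = ≃-pointwise λ _ → ≡.refl

  ≃-sym : ∀ {x y} → x ≃ y → y ≃ x
  ≃-sym {x} {y} (mk≃ p) = mk≃ λ ε 0<ε → weaken (λ m close → ≡.subst (_≤ℚ ε)
    (≡.trans (≡.sym (ℚ.∣-p∣≡∣p∣ (seq x m -ℚ seq y m))) (≡.cong ∣_∣ (swap (seq x m) (seq y m))))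
    close) (p ε 0<ε)
    where
    swap : ∀ a b → -ℚ (a -ℚ b) ≡ b -ℚ a
    swap = solve 2 (λ a b → :- (a :- b) := b :- a) ≡.refl

  +-cong : ∀ {x x′ y y′} → x ≃ x′ → y ≃ y′ → x +ᴿ y ≃ x′ +ᴿ y′
  +-cong {x} {x′} {y} {y′} (mk≃ p) (mk≃ q) = mk≃ λ ε 0<ε → weaken (λ m (close , close′) → begin
      ∣ (seq x m +ℚ seq y m) -ℚ (seq x′ m +ℚ seq y′ m) ∣
        ≡⟨ ≡.cong ∣_∣ (solve 4 (λ a b c d → (a :+ b) :- (c :+ d) := (a :- c) :+ (b :- d)) ≡.refl
                        (seq x m) (seq y m) (seq x′ m) (seq y′ m)) ⟩
      ∣ (seq x m -ℚ seq x′ m) +ℚ (seq y m -ℚ seq y′ m) ∣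
        ≤⟨ ℚ.∣p+q∣≤∣p∣+∣q∣ (seq x m -ℚ seq x′ m) (seq y m -ℚ seq y′ m) ⟩
      ∣ seq x m -ℚ seq x′ m ∣ +ℚ ∣ seq y m -ℚ seq y′ m ∣
        ≤⟨ ℚ.+-mono-≤ close close′ ⟩
      ½ *ℚ ε +ℚ ½ *ℚ ε ≡⟨ halves ε ⟩
      ε ∎)
    (combine (p (½ *ℚ ε) (half-pos 0<ε)) (q (½ *ℚ ε) (half-pos 0<ε)))

  ≃-trans : ∀ {x y z} → x ≃ y → y ≃ z → x ≃ z
  ≃-trans {x} {y} {z} p q = mk≃ λ ε 0<ε → weaken (λ m → ≡.subst (λ w → ∣ w ∣ ≤ℚ ε)
    (telescope (seq x m) (seq y m) (seq z m))) (un≃ (+-cong p q) ε 0<ε)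
    where
    telescope : ∀ a b c → (a +ℚ b) -ℚ (b +ℚ c) ≡ a -ℚ c
    telescope = solve 3 (λ a b c → (a :+ b) :- (b :+ c) := a :- c) ≡.refl

  -‿cong : ∀ {x y} → x ≃ y → -ᴿ x ≃ -ᴿ y
  -‿cong {x} {y} p = mk≃ λ ε 0<ε → weaken (λ m → ≡.subst (λ w → ∣ w ∣ ≤ℚ ε)
    (swap (seq x m) (seq y m))) (un≃ (≃-sym p) ε 0<ε)
    where
    swap : ∀ a b → b -ℚ a ≡ (-ℚ a) -ℚ (-ℚ b)
    swap = solve 2 (λ a b → b :- a := (:- a) :- (:- b)) ≡.refl

  *-cong : ∀ {x x′ y y′} → x ≃ x′ → y ≃ y′ → x *ᴿ y ≃ x′ *ᴿ y′
  *-cong {x} {x′} {y} {y′} (mk≃ p) (mk≃ q) = mk≃ λ ε 0<ε →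
    let B , 0<B , bx = eventually-bounded {seq x} (cauchy x)
        C , 0<C , by = eventually-bounded {seq y′} (cauchy y′)
        η , 0<η , η[B+C]≡ε = quotient 0<ε
          (≡.subst (_< B +ℚ C) (ℚ.+-identityʳ 0ℚ) (ℚ.+-mono-< 0<B 0<C))
    in weaken (λ m ((∣x∣≤B , ∣y′∣≤C) , (x-close , y-close)) →
         ≡.subst (∣ seq x m *ℚ seq y m -ℚ seq x′ m *ℚ seq y′ m ∣ ≤ℚ_) η[B+C]≡ε
           (∣ab-cd∣≤ (seq x m) (seq y m) (seq x′ m) (seq y′ m) (ℚ.<⇒≤ 0<B) (ℚ.<⇒≤ 0<η)
             ∣x∣≤B ∣y′∣≤C x-close y-close))
       (combine (combine bx by) (combine (p η 0<η) (q η 0<η)))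

  +-mono-≼ : ∀ {x x′ y y′} → x ≼ x′ → y ≼ y′ → x +ᴿ y ≼ x′ +ᴿ y′
  +-mono-≼ {x} {x′} {y} {y′} (mk≼ p) (mk≼ q) = mk≼ λ ε 0<ε → weaken (λ m (le , le′) → begin
      seq x m +ℚ seq y m
        ≤⟨ ℚ.+-mono-≤ le le′ ⟩
      (seq x′ m +ℚ ½ *ℚ ε) +ℚ (seq y′ m +ℚ ½ *ℚ ε)
        ≡⟨ solve 3 (λ a b c → (a :+ c) :+ (b :+ c) := a :+ b :+ (c :+ c)) ≡.refl
             (seq x′ m) (seq y′ m) (½ *ℚ ε) ⟩
      seq x′ m +ℚ seq y′ m +ℚ (½ *ℚ ε +ℚ ½ *ℚ ε)
        ≡⟨ ≡.cong (seq x′ m +ℚ seq y′ m +ℚ_) (halves ε) ⟩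
      seq x′ m +ℚ seq y′ m +ℚ ε ∎)
    (combine (p (½ *ℚ ε) (half-pos 0<ε)) (q (½ *ℚ ε) (half-pos 0<ε)))

  -- Linear inequalities are reduced to identities between rational sequences.
  ≼-by : ∀ {a b x y} → a ≼ b → (∀ k → seq y k -ℚ seq x k ≡ seq b k -ℚ seq a k) → x ≼ y
  ≼-by {a} {b} {x} {y} (mk≼ p) eq = mk≼ λ ε 0<ε → weaken (λ m le → begin
      seq x m
        ≡⟨ solve 4 (λ x y a b → x := (y :- (y :- x)) :+ (a :- a)) ≡.refl (seq x m) (seq y m) (seq a m) (seq b m) ⟩
      (seq y m -ℚ (seq y m -ℚ seq x m)) +ℚ (seq a m -ℚ seq a m)
        ≡⟨ ≡.cong (λ d → (seq y m -ℚ d) +ℚ (seq a m -ℚ seq a m)) (eq m) ⟩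
      (seq y m -ℚ (seq b m -ℚ seq a m)) +ℚ (seq a m -ℚ seq a m)
        ≡⟨ solve 3 (λ y a b → (y :- (b :- a)) :+ (a :- a) := a :+ (y :- b)) ≡.refl (seq y m) (seq a m) (seq b m) ⟩
      seq a m +ℚ (seq y m -ℚ seq b m)
        ≤⟨ ℚ.+-monoˡ-≤ (seq y m -ℚ seq b m) le ⟩
      (seq b m +ℚ ε) +ℚ (seq y m -ℚ seq b m)
        ≡⟨ solve 3 (λ b e y → (b :+ e) :+ (y :- b) := y :+ e) ≡.refl (seq b m) ε (seq y m) ⟩
      seq y m +ℚ ε ∎) (p ε 0<ε)

  infixr 7 _•_
  _•_ : ℚ → ℝ → ℝ
  p • x = fromℚ p *ᴿ x

  •-mono-≼ : ∀ {p x y} → 0ℚ ≤ℚ p → x ≼ y → p • x ≼ p • y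
  •-mono-≼ {p} {x} {y} 0≤p (mk≼ q) = mk≼ λ ε 0<ε →
    -- As `p` may be 0, the tolerance is divided by p + 1 and not by p.
    let 0<p+1 = ≡.subst (_< p +ℚ 1ℚ) (ℚ.+-identityʳ 0ℚ) (ℚ.+-mono-≤-< 0≤p 0<1)
        η , 0<η , η[p+1]≡ε = quotient 0<ε 0<p+1
    in weaken (λ m le → begin
         p *ℚ seq x m
           ≤⟨ ℚ.*-monoˡ-≤-nonNeg p {{ℚ.nonNegative 0≤p}} le ⟩
         p *ℚ (seq y m +ℚ η)
           ≡⟨ solve 3 (λ p y η → p :* (y :+ η) := (p :* y :+ p :* η) :+ con 0ℚ) ≡.refl p (seq y m) η ⟩
         (p *ℚ seq y m +ℚ p *ℚ η) +ℚ 0ℚ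
           ≤⟨ ℚ.+-monoʳ-≤ (p *ℚ seq y m +ℚ p *ℚ η) (ℚ.<⇒≤ 0<η) ⟩
         (p *ℚ seq y m +ℚ p *ℚ η) +ℚ η
           ≡⟨ solve 3 (λ p y η → (p :* y :+ p :* η) :+ η := p :* y :+ η :* (p :+ con 1ℚ)) ≡.refl p (seq y m) η ⟩
         p *ℚ seq y m +ℚ η *ℚ (p +ℚ 1ℚ)
           ≡⟨ ≡.cong (p *ℚ seq y m +ℚ_) η[p+1]≡ε ⟩
         p *ℚ seq y m +ℚ ε ∎) (q η 0<η)

  fromℚ-mono-≼ : ∀ {p q} → p ≤ℚ q → fromℚ p ≼ fromℚ q
  fromℚ-mono-≼ p≤q = ≼-pointwise λ _ → p≤q

  fromℚ-reflects-≼ : ∀ {p q} → fromℚ p ≼ fromℚ q → p ≤ℚ q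
  fromℚ-reflects-≼ {p} {q} (mk≼ le) with ℚ.<-cmp q p
  ... | tri≈ _ q≡p _ = ℚ.≤-reflexive (≡.sym q≡p)
  ... | tri< q<p _ _ = contradiction p<p (ℚ.<-irrefl ≡.refl)
    where
    0<p-q : 0ℚ < p -ℚ q
    0<p-q = ≡.subst (_< p -ℚ q) (ℚ.+-inverseʳ q) (ℚ.+-monoˡ-< (-ℚ q) q<p)
    -- With half the gap as tolerance, p ≤ q + η < q + 2η = p.
    η : ℚ
    η = ½ *ℚ (p -ℚ q)
    bound : Σ[ N ∈ ℕ ] (∀ m → N ℕ.≤ m → p ≤ℚ q +ℚ η)
    bound = le η (half-pos 0<p-q)
    p<p : p < p
    p<p = begin-strict
      p                    ≤⟨ proj₂ bound (proj₁ bound) ℕ.≤-refl ⟩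
      q +ℚ η               ≡⟨ ℚ.+-identityʳ (q +ℚ η) ⟨
      q +ℚ η +ℚ 0ℚ         <⟨ ℚ.+-monoʳ-< (q +ℚ η) (half-pos 0<p-q) ⟩
      q +ℚ η +ℚ η          ≡⟨ ℚ.+-assoc q η η ⟩
      q +ℚ (η +ℚ η)        ≡⟨ ≡.cong (q +ℚ_) (halves (p -ℚ q)) ⟩
      q +ℚ (p -ℚ q)        ≡⟨ solve 2 (λ p q → q :+ (p :- q) := p) ≡.refl p q ⟩
      p                    ∎
  ... | tri> _ _ p<q = ℚ.<⇒≤ p<q

≼-refl : ∀ {x} → x ≼ x
≼-refl = ≃⇒≼ ≃-refl

≃⇒≽ : ∀ {x y} → x ≃ y → y ≼ x
≃⇒≽ p = ≃⇒≼ (≃-sym p)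

-- Operations act termwise on sequences, so the ring laws hold termwise in ℚ; only the congruences
-- need estimates. The bundle opens the generic theory of finite sums.
ℝ-commutativeRing : CommutativeRing 0ℓ 0ℓ
ℝ-commutativeRing = record
  { Carrier = ℝ ; _≈_ = _≃_ ; _+_ = _+ᴿ_ ; _*_ = _*ᴿ_ ; -_ = -ᴿ_ ; 0# = 0ᴿ ; 1# = 1ᴿ
  ; isCommutativeRing = record
    { isRing = record
      { +-isAbelianGroup = record
        { isGroup = record
          { isMonoid = record
            { isSemigroup = record
              { isMagma = record
                { isEquivalence = record { refl = ≃-refl ; sym = ≃-sym ; trans = ≃-trans }
                ; ∙-cong = +-cong }
              ; assoc = λ x y z → ≃-pointwise λ k → ℚ.+-assoc (seq x k) (seq y k) (seq z k) }
            ; identity = (λ x → ≃-pointwise λ k → ℚ.+-identityˡ (seq x k))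
                       , (λ x → ≃-pointwise λ k → ℚ.+-identityʳ (seq x k)) }
          ; inverse = (λ x → ≃-pointwise λ k → ℚ.+-inverseˡ (seq x k))
                    , (λ x → ≃-pointwise λ k → ℚ.+-inverseʳ (seq x k))
          ; ⁻¹-cong = -‿cong }
        ; comm = λ x y → ≃-pointwise λ k → ℚ.+-comm (seq x k) (seq y k) }
      ; *-cong = *-cong
      ; *-assoc = λ x y z → ≃-pointwise λ k → ℚ.*-assoc (seq x k) (seq y k) (seq z k)
      ; *-identity = (λ x → ≃-pointwise λ k → ℚ.*-identityˡ (seq x k))
                   , (λ x → ≃-pointwise λ k → ℚ.*-identityʳ (seq x k))
      ; distrib = (λ x y z → ≃-pointwise λ k → ℚ.*-distribˡ-+ (seq x k) (seq y k) (seq z k))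
                , (λ x y z → ≃-pointwise λ k → ℚ.*-distribʳ-+ (seq x k) (seq y k) (seq z k)) }
    ; *-comm = λ x y → ≃-pointwise λ k → ℚ.*-comm (seq x k) (seq y k) } }

record _≃ᶜ_ (x y : ℂ) : Set where
  constructor mk≃ᶜ
  field
    re-≃ : re x ≃ re y
    im-≃ : im x ≃ im y

open _≃ᶜ_

module _ where
  open +-*-Solver

  *ᶜ-assoc : ∀ x y z → ((x *ᶜ y) *ᶜ z) ≃ᶜ (x *ᶜ (y *ᶜ z))
  *ᶜ-assoc (a +i b) (c +i d) (e +i f) = mk≃ᶜ
    (≃-pointwise λ k → solve 6 (λ a b c d e f →
       (a :* c :+ :- (b :* d)) :* e :+ :- ((a :* d :+ b :* c) :* f)
         := a :* (c :* e :+ :- (d :* f)) :+ :- (b :* (c :* f :+ d :* e))) ≡.refl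
       (seq a k) (seq b k) (seq c k) (seq d k) (seq e k) (seq f k))
    (≃-pointwise λ k → solve 6 (λ a b c d e f →
       (a :* c :+ :- (b :* d)) :* f :+ (a :* d :+ b :* c) :* e
         := a :* (c :* f :+ d :* e) :+ b :* (c :* e :+ :- (d :* f))) ≡.refl
       (seq a k) (seq b k) (seq c k) (seq d k) (seq e k) (seq f k))

  *ᶜ-comm : ∀ x y → (x *ᶜ y) ≃ᶜ (y *ᶜ x)
  *ᶜ-comm (a +i b) (c +i d) = mk≃ᶜ
    (≃-pointwise λ k → solve 4 (λ a b c d →
       a :* c :+ :- (b :* d) := c :* a :+ :- (d :* b)) ≡.refl (seq a k) (seq b k) (seq c k) (seq d k))
    (≃-pointwise λ k → solve 4 (λ a b c d →
       a :* d :+ b :* c := c :* b :+ d :* a) ≡.refl (seq a k) (seq b k) (seq c k) (seq d k))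

  *ᶜ-identityˡ : ∀ x → (1ᶜ *ᶜ x) ≃ᶜ x
  *ᶜ-identityˡ (a +i b) = mk≃ᶜ
    (≃-pointwise λ k → solve 2 (λ a b → con 1ℚ :* a :+ :- (con 0ℚ :* b) := a) ≡.refl (seq a k) (seq b k))
    (≃-pointwise λ k → solve 2 (λ a b → con 1ℚ :* b :+ con 0ℚ :* a := b) ≡.refl (seq a k) (seq b k))

  *ᶜ-distribˡ : ∀ x y z → (x *ᶜ (y +ᶜ z)) ≃ᶜ ((x *ᶜ y) +ᶜ (x *ᶜ z))
  *ᶜ-distribˡ (a +i b) (c +i d) (e +i f) = mk≃ᶜ
    (≃-pointwise λ k → solve 6 (λ a b c d e f →
       a :* (c :+ e) :+ :- (b :* (d :+ f)) := (a :* c :+ :- (b :* d)) :+ (a :* e :+ :- (b :* f))) ≡.refl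
       (seq a k) (seq b k) (seq c k) (seq d k) (seq e k) (seq f k))
    (≃-pointwise λ k → solve 6 (λ a b c d e f →
       a :* (d :+ f) :+ b :* (c :+ e) := (a :* d :+ b :* c) :+ (a :* f :+ b :* e)) ≡.refl
       (seq a k) (seq b k) (seq c k) (seq d k) (seq e k) (seq f k))

  conj-* : ∀ x y → conj (x *ᶜ y) ≃ᶜ (conj x *ᶜ conj y)
  conj-* (a +i b) (c +i d) = mk≃ᶜ
    (≃-pointwise λ k → solve 4 (λ a b c d →
       a :* c :+ :- (b :* d) := a :* c :+ :- (:- b :* :- d)) ≡.refl (seq a k) (seq b k) (seq c k) (seq d k))
    (≃-pointwise λ k → solve 4 (λ a b c d →
       :- (a :* d :+ b :* c) := a :* :- d :+ :- b :* c) ≡.refl (seq a k) (seq b k) (seq c k) (seq d k))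

  conj-+ : ∀ x y → conj (x +ᶜ y) ≃ᶜ (conj x +ᶜ conj y)
  conj-+ (a +i b) (c +i d) = mk≃ᶜ ≃-refl
    (≃-pointwise λ k → ℚ.neg-distrib-+ (seq b k) (seq d k))

ℂ-commutativeRing : CommutativeRing 0ℓ 0ℓ
ℂ-commutativeRing = record
  { Carrier = ℂ ; _≈_ = _≃ᶜ_ ; _+_ = _+ᶜ_ ; _*_ = _*ᶜ_ ; 0# = 0ᶜ ; 1# = 1ᶜ
  ; -_ = λ x → (-ᴿ re x) +i (-ᴿ im x)
  ; isCommutativeRing = record
    { isRing = record
      { +-isAbelianGroup = record
        { isGroup = record
          { isMonoid = record
            { isSemigroup = record
              { isMagma = record
                { isEquivalence = record
                  { refl = mk≃ᶜ ≃-refl ≃-refl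
                  ; sym = λ p → mk≃ᶜ (≃-sym (re-≃ p)) (≃-sym (im-≃ p))
                  ; trans = ≃ᶜ-trans }
                ; ∙-cong = λ p q → mk≃ᶜ (+-cong (re-≃ p) (re-≃ q)) (+-cong (im-≃ p) (im-≃ q)) }
              ; assoc = λ x y z → mk≃ᶜ (R.+-assoc (re x) (re y) (re z)) (R.+-assoc (im x) (im y) (im z)) }
            ; identity = (λ x → mk≃ᶜ (R.+-identityˡ (re x)) (R.+-identityˡ (im x)))
                       , (λ x → mk≃ᶜ (R.+-identityʳ (re x)) (R.+-identityʳ (im x))) }
          ; inverse = (λ x → mk≃ᶜ (R.-‿inverseˡ (re x)) (R.-‿inverseˡ (im x)))
                    , (λ x → mk≃ᶜ (R.-‿inverseʳ (re x)) (R.-‿inverseʳ (im x)))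
          ; ⁻¹-cong = λ p → mk≃ᶜ (-‿cong (re-≃ p)) (-‿cong (im-≃ p)) }
        ; comm = λ x y → mk≃ᶜ (R.+-comm (re x) (re y)) (R.+-comm (im x) (im y)) }
      ; *-cong = *ᶜ-cong
      ; *-assoc = *ᶜ-assoc
      ; *-identity = *ᶜ-identityˡ , λ x → ≃ᶜ-trans (*ᶜ-comm x 1ᶜ) (*ᶜ-identityˡ x)
      ; distrib = *ᶜ-distribˡ , λ x y z → ≃ᶜ-trans (*ᶜ-comm (y +ᶜ z) x) (≃ᶜ-trans (*ᶜ-distribˡ x y z)
                    (mk≃ᶜ (+-cong (re-≃ (*ᶜ-comm x y)) (re-≃ (*ᶜ-comm x z)))
                          (+-cong (im-≃ (*ᶜ-comm x y)) (im-≃ (*ᶜ-comm x z))))) }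
    ; *-comm = *ᶜ-comm } }
  where
  module R = CommutativeRing ℝ-commutativeRing
  ≃ᶜ-trans : ∀ {x y z} → x ≃ᶜ y → y ≃ᶜ z → x ≃ᶜ z
  ≃ᶜ-trans p q = mk≃ᶜ (≃-trans (re-≃ p) (re-≃ q)) (≃-trans (im-≃ p) (im-≃ q))
  *ᶜ-cong : ∀ {x x′ y y′} → x ≃ᶜ x′ → y ≃ᶜ y′ → (x *ᶜ y) ≃ᶜ (x′ *ᶜ y′)
  *ᶜ-cong p q = mk≃ᶜ
    (+-cong (*-cong (re-≃ p) (re-≃ q)) (-‿cong (*-cong (im-≃ p) (im-≃ q))))
    (+-cong (*-cong (re-≃ p) (im-≃ q)) (*-cong (im-≃ p) (re-≃ q)))

-- Finite sums and unitary operators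

-- Used over ℂ for unitarity and over ℝ for squared norms and probabilities.
module BasisSum (R : CommutativeRing 0ℓ 0ℓ) where
  open CommutativeRing R hiding (zero)
  open SemiringSum semiring public
    using (sum; sum-cong-≋; sum-remove; ∑-distrib-+; *-distribˡ-sum; sum-replicate-zero; sum-permute)
  open SetoidReasoning setoid

  sum-zero : ∀ {n} (t : Fin n → Carrier) → (∀ i → t i ≈ 0#) → sum t ≈ 0#
  sum-zero {n} t t≈0 = trans (sum-cong-≋ t≈0) (sum-replicate-zero n)

  sum-single : ∀ {n} (t : Fin n → Carrier) i → (∀ j → j ≢ i → t j ≈ 0#) → sum t ≈ t i
  sum-single {suc n} t i others = begin
    sum t                                ≈⟨ sum-remove {i = i} t ⟩
    t i + sum (λ j → t (Fin.punchIn i j)) ≈⟨ +-congˡ (sum-zero _ λ j → others _ (Fin.punchInᵢ≢i i j)) ⟩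
    t i + 0#                             ≈⟨ +-identityʳ (t i) ⟩
    t i                                  ∎

  module _ {n σ d : ℕ} where
    private
      B : Set
      B = Basis n σ d

    ∑ : (B → Carrier) → Carrier
    ∑ = ∑ᴮ +-rawMonoid

    ∑-cong : ∀ {f g : B → Carrier} → (∀ x → f x ≈ g x) → ∑ f ≈ ∑ g
    ∑-cong f≈g = sum-cong-≋ λ i → sum-cong-≋ λ b → sum-cong-≋ λ w → f≈g (i , b , w)

    ∑-zero : ∑ (λ _ → 0#) ≈ 0#
    ∑-zero = sum-zero {n} _ λ i → sum-zero {σ} _ λ b → sum-zero {d} _ λ w → refl

    ∑-+ : ∀ (f g : B → Carrier) → ∑ (λ x → f x + g x) ≈ ∑ f + ∑ g
    ∑-+ f g =
      trans (sum-cong-≋ λ i → trans (sum-cong-≋ λ b → ∑-distrib-+ (λ w → f (i , b , w)) (λ w → g (i , b , w)))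
                                    (∑-distrib-+ (λ b → sum λ w → f (i , b , w)) (λ b → sum λ w → g (i , b , w))))
            (∑-distrib-+ (λ i → sum λ b → sum λ w → f (i , b , w)) (λ i → sum λ b → sum λ w → g (i , b , w)))

    ∑-*ˡ : ∀ c (f : B → Carrier) → c * ∑ f ≈ ∑ (λ x → c * f x)
    ∑-*ˡ c f =
      trans (*-distribˡ-sum c (λ i → sum λ b → sum λ w → f (i , b , w)))
            (sum-cong-≋ λ i → trans (*-distribˡ-sum c (λ b → sum λ w → f (i , b , w)))
                                    (sum-cong-≋ λ b → *-distribˡ-sum c (λ w → f (i , b , w))))

    ∑-*ʳ : ∀ c (f : B → Carrier) → ∑ f * c ≈ ∑ (λ x → f x * c)
    ∑-*ʳ c f = trans (*-comm (∑ f) c) (trans (∑-*ˡ c f) (∑-cong λ x → *-comm c (f x)))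

    sum-∑-comm : ∀ {m} (f : Fin m → B → Carrier) → sum (λ i → ∑ (f i)) ≈ ∑ (λ x → sum λ i → f i x)
    sum-∑-comm {zero}  f = sym ∑-zero
    sum-∑-comm {suc m} f = trans (+-congˡ (sum-∑-comm (f ∘ suc))) (sym (∑-+ (f zero) _))

    ∑-comm : ∀ (f : B → B → Carrier) → ∑ (λ x → ∑ (f x)) ≈ ∑ (λ y → ∑ (λ x → f x y))
    ∑-comm f =
      trans (sum-cong-≋ λ i → trans (sum-cong-≋ λ b → sum-∑-comm (λ w → f (i , b , w)))
                                    (sum-∑-comm (λ b y → sum λ w → f (i , b , w) y)))
            (sum-∑-comm (λ i y → sum λ b → sum λ w → f (i , b , w) y))

    ∑-single : ∀ (f : B → Carrier) x → (∀ y → y ≢ x → f y ≈ 0#) → ∑ f ≈ f x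
    ∑-single f (i , b , w) others =
      trans (sum-single _ i λ j j≢i → sum-zero _ λ c → sum-zero _ λ v → others (j , c , v) λ { ≡.refl → j≢i ≡.refl })
      (trans (sum-single _ b λ c c≢b → sum-zero _ λ v → others (i , c , v) λ { ≡.refl → c≢b ≡.refl })
             (sum-single _ w λ v v≢w → others (i , b , v) λ { ≡.refl → v≢w ≡.refl }))

module R = CommutativeRing ℝ-commutativeRing
module C = CommutativeRing ℂ-commutativeRing
module Rs = BasisSum ℝ-commutativeRing
module Cs = BasisSum ℂ-commutativeRing

sumᴿ : ∀ {n} → (Fin n → ℝ) → ℝ
sumᴿ = Rs.sum

∑ᴿ : ∀ {n σ d} → (Basis n σ d → ℝ) → ℝ
∑ᴿ = ∑ᴮ +ᴿ-rawMonoid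

sum-mono : ∀ {n} {f g : Fin n → ℝ} → (∀ i → f i ≼ g i) → sumᴿ f ≼ sumᴿ g
sum-mono {zero}  f≼g = ≼-refl
sum-mono {suc n} f≼g = +-mono-≼ (f≼g zero) (sum-mono (f≼g ∘ suc))

sum-nonNeg : ∀ {n} {f : Fin n → ℝ} → (∀ i → 0ᴿ ≼ f i) → 0ᴿ ≼ sumᴿ f
sum-nonNeg {n} 0≼f = ≼-trans (≃⇒≽ (Rs.sum-replicate-zero n)) (sum-mono 0≼f)

-- Deletes the value at `p zero` from the codomain with `punchOut` and recurses. It bounds the query
-- weight on the positions that can carry a mark by the weight on all positions.
sum-injective : ∀ {m n} (p : Fin m → Fin n) → (∀ {i j} → p i ≡ p j → i ≡ j) →
                (f : Fin n → ℝ) → (∀ j → 0ᴿ ≼ f j) → sumᴿ (f ∘ p) ≼ sumᴿ f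
sum-injective {zero}  p inj f 0≼f = sum-nonNeg 0≼f
sum-injective {suc m} {zero} p inj f 0≼f with () ← p zero
sum-injective {suc m} {suc n} p inj f 0≼f =
  ≼-trans (+-mono-≼ ≼-refl
    (≼-trans (≃⇒≼ (Rs.sum-cong-≋ λ i → R.reflexive (≡.cong f (≡.sym (Fin.punchIn-punchOut (p0≢ i))))))
             (sum-injective p′ p′-inj (f ∘ Fin.punchIn (p zero)) (0≼f ∘ Fin.punchIn (p zero)))))
    (≃⇒≽ (Rs.sum-remove {i = p zero} f))
  where
  p0≢ : ∀ i → p zero ≢ p (suc i)
  p0≢ i eq with () ← inj eq
  p′ : Fin m → Fin n
  p′ i = Fin.punchOut (p0≢ i)
  p′-inj : ∀ {i j} → p′ i ≡ p′ j → i ≡ j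
  p′-inj {i} {j} eq = Fin.suc-injective (inj (Fin.punchOut-injective (p0≢ i) (p0≢ j) eq))

module _ {n σ d : ℕ} where
  private
    B : Set
    B = Basis n σ d

  ∑-mono : ∀ {f g : B → ℝ} → (∀ x → f x ≼ g x) → ∑ᴿ f ≼ ∑ᴿ g
  ∑-mono f≼g = sum-mono λ i → sum-mono λ b → sum-mono λ w → f≼g (i , b , w)

  sum-re : ∀ {m} (t : Fin m → ℂ) → re (Cs.sum t) ≡ sumᴿ (re ∘ t)
  sum-re {zero}  t = ≡.refl
  sum-re {suc m} t = ≡.cong (re (t zero) +ᴿ_) (sum-re (t ∘ suc))

  ∑-re : ∀ (f : B → ℂ) → re (∑ᴮ +ᶜ-rawMonoid f) ≃ ∑ᴿ (re ∘ f)
  ∑-re f = ≃-trans (R.reflexive (sum-re (λ i → Cs.sum λ b → Cs.sum λ w → f (i , b , w))))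
    (Rs.sum-cong-≋ λ i → ≃-trans (R.reflexive (sum-re (λ b → Cs.sum λ w → f (i , b , w))))
      (Rs.sum-cong-≋ λ b → R.reflexive (sum-re (λ w → f (i , b , w)))))

  sum-conj : ∀ {m} (t : Fin m → ℂ) → conj (Cs.sum t) C.≈ Cs.sum (conj ∘ t)
  sum-conj {zero}  t = mk≃ᶜ ≃-refl (≃-pointwise λ _ → ≡.refl)
  sum-conj {suc m} t = C.trans (conj-+ (t zero) (Cs.sum (t ∘ suc))) (C.+-congˡ (sum-conj (t ∘ suc)))

  ∑-conj : ∀ (f : B → ℂ) → conj (Cs.∑ f) C.≈ Cs.∑ (conj ∘ f)
  ∑-conj f = C.trans (sum-conj (λ i → Cs.sum λ b → Cs.sum λ w → f (i , b , w)))
    (Cs.sum-cong-≋ λ i → C.trans (sum-conj (λ b → Cs.sum λ w → f (i , b , w)))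
      (Cs.sum-cong-≋ λ b → sum-conj (λ w → f (i , b , w))))

-- The real inner product and its invariance under unitaries

infixl 7 _⊙_

-- The real part of conj x *ᶜ y: the standard inner product of ℂ = ℝ².
_⊙_ : ℂ → ℂ → ℝ
x ⊙ y = re x *ᴿ re y +ᴿ im x *ᴿ im y

module _ {n σ d : ℕ} where
  ⟪_,_⟫ : State {n} {σ} {d} → State {n} {σ} {d} → ℝ
  ⟪ ψ , φ ⟫ = ∑ᴿ λ x → ψ x ⊙ φ x

  -- Unitarity is a statement over ℂ, while the adversary argument works with real parts; this
  -- complex product links the two.
  hermitian : State {n} {σ} {d} → State {n} {σ} {d} → ℂ
  hermitian ψ φ = Cs.∑ λ x → conj (ψ x) *ᶜ φ x

  re-hermitian : ∀ ψ φ → re (hermitian ψ φ) ≃ ⟪ ψ , φ ⟫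
  re-hermitian ψ φ = ≃-trans (∑-re (λ x → conj (ψ x) *ᶜ φ x))
    (Rs.∑-cong λ x → ≃-pointwise λ k → product (seq (re (ψ x)) k) (seq (im (ψ x)) k) (seq (re (φ x)) k) (seq (im (φ x)) k))
    where
    open +-*-Solver
    product : ∀ a b c e → a *ℚ c +ℚ -ℚ (-ℚ b *ℚ e) ≡ a *ℚ c +ℚ b *ℚ e
    product = solve 4 (λ a b c e → a :* c :+ :- (:- b :* e) := a :* c :+ b :* e) ≡.refl

  -- Once both matrix products are expanded, the sum over the output index `k` is moved innermost,
  -- where it is the (x, y) entry of U†U and collapses the double sum to x = y.
  hermitian-unitary : ∀ {U : Operator {n} {σ} {d}} → Unitary U → ∀ ψ φ → hermitian (U · ψ) (U · φ) C.≈ hermitian ψ φ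
  hermitian-unitary {U} unitary ψ φ = begin
    Cs.∑ (λ k → conj (Cs.∑ λ x → U k x *ᶜ ψ x) *ᶜ (Cs.∑ λ y → U k y *ᶜ φ y))
      ≈⟨ Cs.∑-cong (λ k → C.*-congʳ (∑-conj (λ x → U k x *ᶜ ψ x))) ⟩
    Cs.∑ (λ k → Cs.∑ (λ x → conj (U k x *ᶜ ψ x)) *ᶜ (Cs.∑ λ y → U k y *ᶜ φ y))
      ≈⟨ Cs.∑-cong (λ k → Cs.∑-*ʳ (Cs.∑ λ y → U k y *ᶜ φ y) (λ x → conj (U k x *ᶜ ψ x))) ⟩
    Cs.∑ (λ k → Cs.∑ λ x → conj (U k x *ᶜ ψ x) *ᶜ (Cs.∑ λ y → U k y *ᶜ φ y))
      ≈⟨ Cs.∑-cong (λ k → Cs.∑-cong λ x → Cs.∑-*ˡ (conj (U k x *ᶜ ψ x)) (λ y → U k y *ᶜ φ y)) ⟩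
    Cs.∑ (λ k → Cs.∑ λ x → Cs.∑ λ y → conj (U k x *ᶜ ψ x) *ᶜ (U k y *ᶜ φ y))
      ≈⟨ Cs.∑-comm (λ k x → Cs.∑ λ y → conj (U k x *ᶜ ψ x) *ᶜ (U k y *ᶜ φ y)) ⟩
    Cs.∑ (λ x → Cs.∑ λ k → Cs.∑ λ y → conj (U k x *ᶜ ψ x) *ᶜ (U k y *ᶜ φ y))
      ≈⟨ Cs.∑-cong (λ x → Cs.∑-comm (λ k y → conj (U k x *ᶜ ψ x) *ᶜ (U k y *ᶜ φ y))) ⟩
    Cs.∑ (λ x → Cs.∑ λ y → Cs.∑ λ k → conj (U k x *ᶜ ψ x) *ᶜ (U k y *ᶜ φ y))
      ≈⟨ Cs.∑-cong (λ x → Cs.∑-cong λ y → Cs.∑-cong λ k → rearrange (U k x) (ψ x) (U k y) (φ y)) ⟩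
    Cs.∑ (λ x → Cs.∑ λ y → Cs.∑ λ k → (conj (ψ x) *ᶜ φ y) *ᶜ (conj (U k x) *ᶜ U k y))
      ≈⟨ Cs.∑-cong (λ x → Cs.∑-cong λ y → Cs.∑-*ˡ (conj (ψ x) *ᶜ φ y) (λ k → conj (U k x) *ᶜ U k y)) ⟨
    Cs.∑ (λ x → Cs.∑ λ y → (conj (ψ x) *ᶜ φ y) *ᶜ Cs.∑ (λ k → conj (U k x) *ᶜ U k y))
      ≈⟨ Cs.∑-cong (λ x → Cs.∑-cong λ y → C.*-congˡ (δ x y)) ⟩
    Cs.∑ (λ x → Cs.∑ λ y → (conj (ψ x) *ᶜ φ y) *ᶜ ∣ x ⟩ y)
      ≈⟨ Cs.∑-cong (λ x → Cs.∑-single (λ y → (conj (ψ x) *ᶜ φ y) *ᶜ ∣ x ⟩ y) x (off-diagonal x)) ⟩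
    Cs.∑ (λ x → (conj (ψ x) *ᶜ φ x) *ᶜ ∣ x ⟩ x)
      ≈⟨ Cs.∑-cong diagonal ⟩
    Cs.∑ (λ x → conj (ψ x) *ᶜ φ x) ∎
    where
    open SetoidReasoning C.setoid
    δ : ∀ x y → Cs.∑ (λ k → conj (U k x) *ᶜ U k y) C.≈ ∣ x ⟩ y
    δ x y with (p , q) , _ ← unitary x y = mk≃ᶜ (mk≃ p) (mk≃ q)
    off-diagonal : ∀ x y → y ≢ x → ((conj (ψ x) *ᶜ φ y) *ᶜ ∣ x ⟩ y) C.≈ 0ᶜ
    off-diagonal x y y≢x rewrite dec-false (x ≟ᴮ y) (y≢x ∘ ≡.sym) = C.zeroʳ (conj (ψ x) *ᶜ φ y)
    diagonal : ∀ x → ((conj (ψ x) *ᶜ φ x) *ᶜ ∣ x ⟩ x) C.≈ (conj (ψ x) *ᶜ φ x)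
    diagonal x rewrite dec-true (x ≟ᴮ x) ≡.refl = C.*-identityʳ (conj (ψ x) *ᶜ φ x)
    rearrange : ∀ u a v b → (conj (u *ᶜ a) *ᶜ (v *ᶜ b)) C.≈ ((conj a *ᶜ b) *ᶜ (conj u *ᶜ v))
    rearrange u a v b = begin
      conj (u *ᶜ a) *ᶜ (v *ᶜ b)            ≈⟨ C.*-cong (C.trans (conj-* u a) (C.*-comm (conj u) (conj a))) (C.*-comm v b) ⟩
      (conj a *ᶜ conj u) *ᶜ (b *ᶜ v)       ≈⟨ C.*-assoc (conj a) (conj u) (b *ᶜ v) ⟩
      conj a *ᶜ (conj u *ᶜ (b *ᶜ v))       ≈⟨ C.*-congˡ (C.*-assoc (conj u) b v) ⟨
      conj a *ᶜ ((conj u *ᶜ b) *ᶜ v)       ≈⟨ C.*-congˡ (C.*-congʳ (C.*-comm (conj u) b)) ⟩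
      conj a *ᶜ ((b *ᶜ conj u) *ᶜ v)       ≈⟨ C.*-congˡ (C.*-assoc b (conj u) v) ⟩
      conj a *ᶜ (b *ᶜ (conj u *ᶜ v))       ≈⟨ C.*-assoc (conj a) b (conj u *ᶜ v) ⟨
      (conj a *ᶜ b) *ᶜ (conj u *ᶜ v)       ∎

  unitary-⟪⟫ : ∀ {U : Operator {n} {σ} {d}} → Unitary U → ∀ ψ φ → ⟪ U · ψ , U · φ ⟫ ≃ ⟪ ψ , φ ⟫
  unitary-⟪⟫ {U} unitary ψ φ = ≃-trans (≃-sym (re-hermitian (U · ψ) (U · φ)))
    (≃-trans (_≃ᶜ_.re-≃ (hermitian-unitary unitary ψ φ)) (re-hermitian ψ φ))

  basis-norm : ∀ x → ⟪ ∣ x ⟩ , ∣ x ⟩ ⟫ ≃ 1ᴿ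
  basis-norm x = ≃-trans (Rs.∑-single (λ y → ∣ x ⟩ y ⊙ ∣ x ⟩ y) x off-diagonal) diagonal
    where
    off-diagonal : ∀ y → y ≢ x → ∣ x ⟩ y ⊙ ∣ x ⟩ y ≃ 0ᴿ
    off-diagonal y y≢x rewrite dec-false (x ≟ᴮ y) (y≢x ∘ ≡.sym) = ≃-pointwise λ _ → ≡.refl
    diagonal : ∣ x ⟩ x ⊙ ∣ x ⟩ x ≃ 1ᴿ
    diagonal rewrite dec-true (x ≟ᴮ x) ≡.refl = ≃-pointwise λ _ → ≡.refl

-- Oracle queries and halting measurements

0≤p² : ∀ p → 0ℚ ≤ℚ p *ℚ p
0≤p² p with ℚ.≤-total 0ℚ p
... | inj₁ 0≤p = ≡.subst (_≤ℚ p *ℚ p) (ℚ.*-zeroʳ p) (ℚ.*-monoˡ-≤-nonNeg p {{ℚ.nonNegative 0≤p}} 0≤p)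
... | inj₂ p≤0 = ≡.subst (_≤ℚ p *ℚ p) (ℚ.*-zeroʳ p) (ℚ.*-monoˡ-≤-nonPos p {{ℚ.nonPositive p≤0}} p≤0)

0≤p+q : ∀ {p q} → 0ℚ ≤ℚ p → 0ℚ ≤ℚ q → 0ℚ ≤ℚ p +ℚ q
0≤p+q {p} {q} 0≤p 0≤q = ≡.subst (_≤ℚ p +ℚ q) (ℚ.+-identityʳ 0ℚ) (ℚ.+-mono-≤ 0≤p 0≤q)

0≤p*q : ∀ {p q} → 0ℚ ≤ℚ p → 0ℚ ≤ℚ q → 0ℚ ≤ℚ p *ℚ q
0≤p*q {p} {q} 0≤p 0≤q = ≡.subst (_≤ℚ p *ℚ q) (ℚ.*-zeroʳ p) (ℚ.*-monoˡ-≤-nonNeg p {{ℚ.nonNegative 0≤p}} 0≤q)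

≤-offset : ∀ {p q r} → 0ℚ ≤ℚ r → q ≡ p +ℚ r → p ≤ℚ q
≤-offset {p} {q} {r} 0≤r q≡p+r =
  ≡.subst₂ _≤ℚ_ (ℚ.+-identityʳ p) (≡.sym q≡p+r) (ℚ.+-monoʳ-≤ p 0≤r)

⊙-nonNeg : ∀ u → 0ᴿ ≼ u ⊙ u
⊙-nonNeg u = ≼-pointwise λ k → 0≤p+q (0≤p² (seq (re u) k)) (0≤p² (seq (im u) k))

module _ {n σ d : ℕ} where
  ⟪⟫-nonNeg : ∀ (ψ : State {n} {σ} {d}) → 0ᴿ ≼ ⟪ ψ , ψ ⟫
  ⟪⟫-nonNeg ψ = ≼-trans (≃⇒≽ (Rs.∑-zero {n} {σ} {d})) (∑-mono λ x → ⊙-nonNeg (ψ x))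

  rowSum : Fin n → (Basis n σ d → ℝ) → ℝ
  rowSum p f = sumᴿ λ b → sumᴿ λ w → f (p , b , w)

  -- `row p ψ ψ` is the ‖P ψ‖² of the overview: the squared norm of the part of ψ whose query index
  -- is `p`.
  row : Fin n → State {n} {σ} {d} → State {n} {σ} {d} → ℝ
  row p ψ φ = rowSum p λ x → ψ x ⊙ φ x

  row-nonNeg : ∀ p ψ → 0ᴿ ≼ row p ψ ψ
  row-nonNeg p ψ = sum-nonNeg λ b → sum-nonNeg λ w → ⊙-nonNeg (ψ (p , b , w))

  rowSum-mono : ∀ p {f g : Basis n σ d → ℝ} → (∀ x → f x ≼ g x) → rowSum p f ≼ rowSum p g
  rowSum-mono p f≼g = sum-mono λ b → sum-mono λ w → f≼g (p , b , w)

  rowSum-+ : ∀ p (f g : Basis n σ d → ℝ) → rowSum p (λ x → f x +ᴿ g x) ≃ rowSum p f +ᴿ rowSum p g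
  rowSum-+ p f g = ≃-trans
    (Rs.sum-cong-≋ λ b → Rs.∑-distrib-+ (λ w → f (p , b , w)) (λ w → g (p , b , w)))
    (Rs.∑-distrib-+ (λ b → sumᴿ λ w → f (p , b , w)) (λ b → sumᴿ λ w → g (p , b , w)))

  rowSum-• : ∀ p c (f : Basis n σ d → ℝ) → c • rowSum p f ≃ rowSum p (λ x → c • f x)
  rowSum-• p c f = ≃-trans (Rs.*-distribˡ-sum (fromℚ c) (λ b → sumᴿ λ w → f (p , b , w)))
    (Rs.sum-cong-≋ λ b → Rs.*-distribˡ-sum (fromℚ c) (λ w → f (p , b , w)))

module AMGM {l m : ℚ} (0≤m : 0ℚ ≤ℚ m) (lm≡1 : l *ℚ m ≡ 1ℚ) where
  open +-*-Solver

  -- The difference of the two sides is m((l a - c)² + (l b - e)²). The ring solver cannot use l m =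
  -- 1, so its identity carries a multiple of 1 - l m that the next steps remove.
  rational : ∀ a b c e → (1ℚ +ℚ 1ℚ) *ℚ (a *ℚ c +ℚ b *ℚ e) ≤ℚ l *ℚ (a *ℚ a +ℚ b *ℚ b) +ℚ m *ℚ (c *ℚ c +ℚ e *ℚ e)
  rational a b c e = ≤-offset (0≤p*q 0≤m (0≤p+q (0≤p² (l *ℚ a -ℚ c)) (0≤p² (l *ℚ b -ℚ e)))) (begin
      l *ℚ (a *ℚ a +ℚ b *ℚ b) +ℚ m *ℚ (c *ℚ c +ℚ e *ℚ e)
        ≡⟨ solve 6 (λ l m a b c e →
             l :* (a :* a :+ b :* b) :+ m :* (c :* c :+ e :* e)
               := (con 1ℚ :+ con 1ℚ) :* (a :* c :+ b :* e)
                  :+ m :* ((l :* a :- c) :* (l :* a :- c) :+ (l :* b :- e) :* (l :* b :- e))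
                  :+ (con 1ℚ :- l :* m) :* (l :* (a :* a :+ b :* b) :- (con 1ℚ :+ con 1ℚ) :* (a :* c :+ b :* e)))
             ≡.refl l m a b c e ⟩
      S +ℚ (1ℚ -ℚ l *ℚ m) *ℚ X
        ≡⟨ ≡.cong (λ t → S +ℚ (1ℚ -ℚ t) *ℚ X) lm≡1 ⟩
      S +ℚ (1ℚ -ℚ 1ℚ) *ℚ X
        ≡⟨ solve 2 (λ S X → S :+ (con 1ℚ :- con 1ℚ) :* X := S) ≡.refl S X ⟩
      S ∎)
    where
    open ≡.≡-Reasoning
    S X : ℚ
    S = (1ℚ +ℚ 1ℚ) *ℚ (a *ℚ c +ℚ b *ℚ e)
          +ℚ m *ℚ ((l *ℚ a -ℚ c) *ℚ (l *ℚ a -ℚ c) +ℚ (l *ℚ b -ℚ e) *ℚ (l *ℚ b -ℚ e))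
    X = l *ℚ (a *ℚ a +ℚ b *ℚ b) -ℚ (1ℚ +ℚ 1ℚ) *ℚ (a *ℚ c +ℚ b *ℚ e)

  2ℚ : ℚ
  2ℚ = 1ℚ +ℚ 1ℚ

  positive : ∀ u v → 2ℚ • (u ⊙ v) ≼ l • (u ⊙ u) +ᴿ m • (v ⊙ v)
  positive (a +i b) (c +i e) = ≼-pointwise λ k → rational (seq a k) (seq b k) (seq c k) (seq e k)

  -- `positive` with -v for `v`. A query can turn the contribution of a row negative, so the row
  -- after the query needs a lower bound.
  negative : ∀ u v → (-ℚ 2ℚ) • (u ⊙ v) ≼ l • (u ⊙ u) +ᴿ m • (v ⊙ v)
  negative (a +i b) (c +i e) = ≼-pointwise λ k →
    ≡.subst₂ _≤ℚ_
      (solve 4 (λ a b c e → (con 1ℚ :+ con 1ℚ) :* (a :* :- c :+ b :* :- e) := :- (con 1ℚ :+ con 1ℚ) :* (a :* c :+ b :* e))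
         ≡.refl (seq a k) (seq b k) (seq c k) (seq e k))
      (solve 6 (λ l m a b c e → l :* (a :* a :+ b :* b) :+ m :* (:- c :* :- c :+ :- e :* :- e)
                                  := l :* (a :* a :+ b :* b) :+ m :* (c :* c :+ e :* e))
         ≡.refl l m (seq a k) (seq b k) (seq c k) (seq e k))
      (rational (seq a k) (seq b k) (-ℚ seq c k) (-ℚ seq e k))

  row-bound : ∀ {n σ d} {s} → (∀ u v → s • (u ⊙ v) ≼ l • (u ⊙ u) +ᴿ m • (v ⊙ v)) →
              ∀ p (ψ φ : State {n} {σ} {d}) → s • row p ψ φ ≼ l • row p ψ ψ +ᴿ m • row p φ φ
  row-bound {s = s} bound p ψ φ =
    ≼-trans (≃⇒≼ (rowSum-• p s λ x → ψ x ⊙ φ x))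
    (≼-trans (rowSum-mono p λ x → bound (ψ x) (φ x))
    (≃⇒≼ (≃-trans (rowSum-+ p (λ x → l • (ψ x ⊙ ψ x)) (λ x → m • (φ x ⊙ φ x)))
                  (+-cong (≃-sym (rowSum-• p l λ x → ψ x ⊙ ψ x)) (≃-sym (rowSum-• p m λ x → φ x ⊙ φ x))))))

-- Queries as cyclic shifts of the answer register

module _ {σ : ℕ} (a : Fin σ) where
  private instance
    σ≢0 : ℕ.NonZero σ
    σ≢0 = Fin.nonZeroIndex a

  _⊕ₐ : Fin σ → Fin σ
  c ⊕ₐ = (toℕ c ℕ.+ toℕ a) ℕ.mod σ

  private
    [m%σ+n]%σ : ∀ m n → (m ℕ.% σ ℕ.+ n) ℕ.% σ ≡ (m ℕ.+ n) ℕ.% σ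
    [m%σ+n]%σ m n = ≡.trans (ℕ.%-distribˡ-+ (m ℕ.% σ) n σ)
      (≡.trans (≡.cong (λ t → (t ℕ.+ n ℕ.% σ) ℕ.% σ) (ℕ.m%n%n≡m%n m σ))
               (≡.sym (ℕ.%-distribˡ-+ m n σ)))

    [m+σ]%σ : ∀ (c : Fin σ) m n → m ℕ.+ n ≡ σ → (toℕ c ℕ.+ m ℕ.+ n) ℕ.% σ ≡ toℕ c
    [m+σ]%σ c m n m+n≡σ = ≡.trans
      (ℕ.%-congˡ (≡.trans (ℕ.+-assoc (toℕ c) m n) (≡.cong (toℕ c ℕ.+_) m+n≡σ)))
      (≡.trans (ℕ.[m+n]%n≡m%n (toℕ c) σ) (ℕ.m<n⇒m%n≡m (Fin.toℕ<n c)))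

    toℕ-mod : ∀ m → toℕ (m ℕ.mod σ) ≡ m ℕ.% σ
    toℕ-mod m = Fin.toℕ-fromℕ< (ℕ.m%n<n m σ)

    a≤σ : toℕ a ℕ.≤ σ
    a≤σ = ℕ.<⇒≤ (Fin.toℕ<n a)

  -- Adding `a` undoes subtracting it modulo σ. Being a permutation, the shift can be removed from
  -- sums over the answer register.
  ⊖-permutation : Permutation′ σ
  ⊖-permutation = permutation (_⊖ a) _⊕ₐ
    (λ c → Fin.toℕ-injective (≡.trans (toℕ-mod _) (≡.trans
       (≡.cong (λ t → (t ℕ.+ (σ ℕ.∸ toℕ a)) ℕ.% σ) (toℕ-mod (toℕ c ℕ.+ toℕ a)))
       (≡.trans ([m%σ+n]%σ (toℕ c ℕ.+ toℕ a) (σ ℕ.∸ toℕ a))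
                ([m+σ]%σ c (toℕ a) (σ ℕ.∸ toℕ a) (ℕ.m+[n∸m]≡n a≤σ))))))
    (λ c → Fin.toℕ-injective (≡.trans (toℕ-mod _) (≡.trans
       (≡.cong (λ t → (t ℕ.+ toℕ a) ℕ.% σ) (toℕ-mod (toℕ c ℕ.+ (σ ℕ.∸ toℕ a))))
       (≡.trans ([m%σ+n]%σ (toℕ c ℕ.+ (σ ℕ.∸ toℕ a)) (toℕ a))
                ([m+σ]%σ c (σ ℕ.∸ toℕ a) (toℕ a) (ℕ.m∸n+n≡m a≤σ))))))

module _ {n σ d : ℕ} where
  -- Both registers are shifted by the same amount, so shifting the summation index restores the
  -- row.
  oracle-row : ∀ {S T : Text n σ} {p} → S p ≡ T p → ∀ (ψ φ : State {n} {σ} {d}) →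
               row p (oracle S ψ) (oracle T φ) ≃ row p ψ φ
  oracle-row {S} {T} {p} Sp≡Tp ψ φ = ≃-sym (≃-trans
    (Rs.sum-permute (λ b → sumᴿ λ w → ψ (p , b , w) ⊙ φ (p , b , w)) (⊖-permutation (S p)))
    (R.reflexive (≡.cong (λ a → sumᴿ λ b → sumᴿ λ w → ψ (p , b ⊖ S p , w) ⊙ φ (p , b ⊖ a , w)) Sp≡Tp)))

  oracle-⟪⟫ : ∀ (T : Text n σ) (ψ φ : State {n} {σ} {d}) → ⟪ oracle T ψ , oracle T φ ⟫ ≃ ⟪ ψ , φ ⟫
  oracle-⟪⟫ T ψ φ = Rs.sum-cong-≋ λ p → oracle-row {T} {T} {p} ≡.refl ψ φ

-- Only row `p` can change. With X for the last summand, that row contributes at most X/2 before the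
-- query and at least -X/2 after it, since the query preserves the norm of each row; so at most X is
-- lost.
query-step : ∀ {n σ d l m} → 0ℚ ≤ℚ m → l *ℚ m ≡ 1ℚ → ∀ {S T : Text n σ} p → (∀ i → i ≢ p → S i ≡ T i) →
             ∀ (ψ φ : State {n} {σ} {d}) →
             ⟪ ψ , φ ⟫ ≼ ⟪ oracle S ψ , oracle T φ ⟫ +ᴿ (l • row p ψ ψ +ᴿ m • row p φ φ)
query-step {suc n} {σ} {d} {l} {m} 0≤m lm≡1 {S} {T} p agree ψ φ =
  ≼-trans (≃⇒≼ (≃-trans (Rs.sum-remove {i = p} λ i → row i ψ φ) (+-cong ≃-refl (≃-sym rest))))
  (≼-trans (≼-by (•-mono-≼ 0≤½ (+-mono-≼ before after))
                 λ k → halve (seq a k) (seq a′ k) (seq r k) (seq X k))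
           (+-mono-≼ (≃⇒≽ (Rs.sum-remove {i = p} λ i → row i (oracle S ψ) (oracle T φ))) ≼-refl))
  where
  open AMGM {l} {m} 0≤m lm≡1
  open +-*-Solver
  a a′ r X : ℝ
  a = row p ψ φ
  a′ = row p (oracle S ψ) (oracle T φ)
  r = sumᴿ λ i → row (Fin.punchIn p i) (oracle S ψ) (oracle T φ)
  X = l • row p ψ ψ +ᴿ m • row p φ φ
  rest : r ≃ sumᴿ (λ i → row (Fin.punchIn p i) ψ φ)
  rest = Rs.sum-cong-≋ λ i → oracle-row {S = S} {T = T} {p = Fin.punchIn p i} (agree _ (Fin.punchInᵢ≢i p i)) ψ φ
  before : 2ℚ • a ≼ X
  before = row-bound positive p ψ φ
  after : (-ℚ 2ℚ) • a′ ≼ X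
  after = ≼-trans (row-bound negative p (oracle S ψ) (oracle T φ))
    (≃⇒≼ (+-cong (*-cong ≃-refl (oracle-row {S = S} {T = S} {p = p} ≡.refl ψ ψ))
                 (*-cong ≃-refl (oracle-row {S = T} {T = T} {p = p} ≡.refl φ φ))))
  0≤½ : 0ℚ ≤ℚ ½
  0≤½ = ℚ.nonNegative⁻¹ ½
  halve : ∀ a a′ r X → (a′ +ℚ r +ℚ X) -ℚ (a +ℚ r)
                         ≡ ½ *ℚ (X +ℚ X) -ℚ ½ *ℚ (2ℚ *ℚ a +ℚ (-ℚ 2ℚ) *ℚ a′)
  halve = solve 4 (λ a a′ r X → (a′ :+ r :+ X) :- (a :+ r)
                         := con ½ :* (X :+ X) :- con ½ :* (con 2ℚ :* a :+ (:- con 2ℚ) :* a′)) ≡.refl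

∑-combination : ∀ {n σ d} a b c e (f g h i : Basis n σ d → ℝ) →
  ∑ᴿ (λ x → a • f x +ᴿ (b • g x +ᴿ (c • h x +ᴿ e • i x))) ≃ a • ∑ᴿ f +ᴿ (b • ∑ᴿ g +ᴿ (c • ∑ᴿ h +ᴿ e • ∑ᴿ i))
∑-combination a b c e f g h i =
  ≃-trans (Rs.∑-+ (λ x → a • f x) _) (+-cong (≃-sym (Rs.∑-*ˡ (fromℚ a) f))
  (≃-trans (Rs.∑-+ (λ x → b • g x) _) (+-cong (≃-sym (Rs.∑-*ˡ (fromℚ b) g))
  (≃-trans (Rs.∑-+ (λ x → c • h x) _) (+-cong (≃-sym (Rs.∑-*ˡ (fromℚ c) h)) (≃-sym (Rs.∑-*ˡ (fromℚ e) i)))))))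

-- Measurement inequalities at a single basis state

select : Bool → ℂ → ℂ
select b u = if b then u else 0ᶜ

-- The weights come from the squares (2u - 3v)² and (3u - 2v)². The 5 is 9 - 4: on a branch that
-- halts with the first text's answer, weight 5 moves from the first run to the second.
4ℚ 5ℚ 9ℚ 12ℚ : ℚ
4ℚ = fromℕ 4
5ℚ = fromℕ 5
9ℚ = fromℕ 9
12ℚ = fromℕ 12

-- Here b says that the run goes on and c that it halts with the answer to the first of the two
-- texts.  The weights make AM-GM favour the first text in the latter case and the second one when
-- the run halts with a different answer.
interference : ∀ b c → ¬ (b ≡ true × c ≡ true) → ∀ u v →
  12ℚ • (u ⊙ v) +ᴿ (9ℚ • (select b u ⊙ select b u) +ᴿ (4ℚ • (select b v ⊙ select b v) +ᴿ 5ℚ • (select c u ⊙ select c u)))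
    ≼ 12ℚ • (select b u ⊙ select b v) +ᴿ (9ℚ • (u ⊙ u) +ᴿ (4ℚ • (v ⊙ v) +ᴿ 5ℚ • (select c v ⊙ select c v)))
interference true true ¬both _ _ = contradiction (≡.refl , ≡.refl) ¬both
interference true false _ u v = ≼-refl
interference false true _ (a +i b) (c +i e) = ≼-pointwise λ k →
  bound (seq a k) (seq b k) (seq c k) (seq e k)
  where
  open +-*-Solver
  z : ℚ
  z = 0ℚ *ℚ 0ℚ +ℚ 0ℚ *ℚ 0ℚ
  2ℚ 3ℚ : ℚ
  2ℚ = fromℕ 2
  3ℚ = fromℕ 3
  bound : ∀ a b c e → 12ℚ *ℚ (a *ℚ c +ℚ b *ℚ e) +ℚ (9ℚ *ℚ z +ℚ (4ℚ *ℚ z +ℚ 5ℚ *ℚ (a *ℚ a +ℚ b *ℚ b)))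
    ≤ℚ 12ℚ *ℚ z +ℚ (9ℚ *ℚ (a *ℚ a +ℚ b *ℚ b) +ℚ (4ℚ *ℚ (c *ℚ c +ℚ e *ℚ e) +ℚ 5ℚ *ℚ (c *ℚ c +ℚ e *ℚ e)))
  bound a b c e = ≤-offset (0≤p+q (0≤p² (2ℚ *ℚ a -ℚ 3ℚ *ℚ c)) (0≤p² (2ℚ *ℚ b -ℚ 3ℚ *ℚ e)))
    (solve 4 (λ a b c e → let z = con 0ℚ :* con 0ℚ :+ con 0ℚ :* con 0ℚ in
      con 12ℚ :* z :+ (con 9ℚ :* (a :* a :+ b :* b) :+ (con 4ℚ :* (c :* c :+ e :* e) :+ con 5ℚ :* (c :* c :+ e :* e)))
        := con 12ℚ :* (a :* c :+ b :* e) :+ (con 9ℚ :* z :+ (con 4ℚ :* z :+ con 5ℚ :* (a :* a :+ b :* b)))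
           :+ ((con 2ℚ :* a :- con 3ℚ :* c) :* (con 2ℚ :* a :- con 3ℚ :* c)
               :+ (con 2ℚ :* b :- con 3ℚ :* e) :* (con 2ℚ :* b :- con 3ℚ :* e))) ≡.refl a b c e)
interference false false _ (a +i b) (c +i e) = ≼-pointwise λ k →
  bound (seq a k) (seq b k) (seq c k) (seq e k)
  where
  open +-*-Solver
  z : ℚ
  z = 0ℚ *ℚ 0ℚ +ℚ 0ℚ *ℚ 0ℚ
  2ℚ 3ℚ : ℚ
  2ℚ = fromℕ 2
  3ℚ = fromℕ 3
  bound : ∀ a b c e → 12ℚ *ℚ (a *ℚ c +ℚ b *ℚ e) +ℚ (9ℚ *ℚ z +ℚ (4ℚ *ℚ z +ℚ 5ℚ *ℚ z))
    ≤ℚ 12ℚ *ℚ z +ℚ (9ℚ *ℚ (a *ℚ a +ℚ b *ℚ b) +ℚ (4ℚ *ℚ (c *ℚ c +ℚ e *ℚ e) +ℚ 5ℚ *ℚ z))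
  bound a b c e = ≤-offset (0≤p+q (0≤p² (3ℚ *ℚ a -ℚ 2ℚ *ℚ c)) (0≤p² (3ℚ *ℚ b -ℚ 2ℚ *ℚ e)))
    (solve 4 (λ a b c e → let z = con 0ℚ :* con 0ℚ :+ con 0ℚ :* con 0ℚ in
      con 12ℚ :* z :+ (con 9ℚ :* (a :* a :+ b :* b) :+ (con 4ℚ :* (c :* c :+ e :* e) :+ con 5ℚ :* z))
        := con 12ℚ :* (a :* c :+ b :* e) :+ (con 9ℚ :* z :+ (con 4ℚ :* z :+ con 5ℚ :* z))
           :+ ((con 3ℚ :* a :- con 2ℚ :* c) :* (con 3ℚ :* a :- con 2ℚ :* c)
               :+ (con 3ℚ :* b :- con 2ℚ :* e) :* (con 3ℚ :* b :- con 2ℚ :* e))) ≡.refl a b c e)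

select-≼ : ∀ b u → select b u ⊙ select b u ≼ u ⊙ u
select-≼ true  u = ≼-refl
select-≼ false u = ≼-trans (≃⇒≼ (≃-pointwise λ _ → ≡.refl)) (⊙-nonNeg u)

exclusive : ∀ b c e → ¬ (b ≡ true × c ≡ true) → ¬ (b ≡ true × e ≡ true) → ¬ (c ≡ true × e ≡ true) → ∀ u →
  select b u ⊙ select b u +ᴿ (select c u ⊙ select c u +ᴿ select e u ⊙ select e u) ≼ u ⊙ u
exclusive true true e ¬bc ¬be ¬ce u = contradiction (≡.refl , ≡.refl) ¬bc
exclusive true false true ¬bc ¬be ¬ce u = contradiction (≡.refl , ≡.refl) ¬be
exclusive true false false ¬bc ¬be ¬ce u = ≃⇒≼ (≃-pointwise λ k → ℚ.+-identityʳ (seq (u ⊙ u) k))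
exclusive false true true ¬bc ¬be ¬ce u = contradiction (≡.refl , ≡.refl) ¬ce
exclusive false true false ¬bc ¬be ¬ce u = ≃⇒≼ (≃-pointwise λ k → ≡.trans (ℚ.+-identityˡ _) (ℚ.+-identityʳ (seq (u ⊙ u) k)))
exclusive false false e ¬bc ¬be ¬ce u =
  ≼-trans (≃⇒≼ (≃-pointwise λ k → ≡.trans (ℚ.+-identityˡ _) (ℚ.+-identityˡ _))) (select-≼ e u)

-- Halting probabilities and query weights of a run

toℚᵘ-fromℕ : ∀ m → ℚ.toℚᵘ (fromℕ m) ℚᵘ.≃ ℚᵘ.mkℚᵘ (ℤ.+ m) 0
toℚᵘ-fromℕ m = ℚ.toℚᵘ-fromℚᵘ (ℚᵘ.mkℚᵘ (ℤ.+ m) 0)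

fromℕ-+ : ∀ m n → fromℕ (m ℕ.+ n) ≡ fromℕ m +ℚ fromℕ n
fromℕ-+ m n = ℚ.toℚᵘ-injective (begin
  ℚ.toℚᵘ (fromℕ (m ℕ.+ n))                       ≈⟨ toℚᵘ-fromℕ (m ℕ.+ n) ⟩
  ℚᵘ.mkℚᵘ (ℤ.+ (m ℕ.+ n)) 0                      ≈⟨ ℚᵘ.*≡* (≡.cong (ℤ._* ℤ.+ 1) (≡.sym (≡.cong₂ ℤ._+_ (ℤ.*-identityʳ (ℤ.+ m)) (ℤ.*-identityʳ (ℤ.+ n))))) ⟩
  ℚᵘ.mkℚᵘ (ℤ.+ m) 0 ℚᵘ.+ ℚᵘ.mkℚᵘ (ℤ.+ n) 0       ≈⟨ ℚᵘ.+-cong (toℚᵘ-fromℕ m) (toℚᵘ-fromℕ n) ⟨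
  ℚ.toℚᵘ (fromℕ m) ℚᵘ.+ ℚ.toℚᵘ (fromℕ n)         ≈⟨ ℚ.toℚᵘ-homo-+ (fromℕ m) (fromℕ n) ⟨
  ℚ.toℚᵘ (fromℕ m +ℚ fromℕ n)                    ∎)
  where open ℚᵘ.≃-Reasoning

fromℕ-* : ∀ m n → fromℕ (m ℕ.* n) ≡ fromℕ m *ℚ fromℕ n
fromℕ-* m n = ℚ.toℚᵘ-injective (begin
  ℚ.toℚᵘ (fromℕ (m ℕ.* n))                       ≈⟨ toℚᵘ-fromℕ (m ℕ.* n) ⟩
  ℚᵘ.mkℚᵘ (ℤ.+ (m ℕ.* n)) 0                      ≈⟨ ℚᵘ.*≡* (≡.cong (ℤ._* ℤ.+ 1) (ℤ.pos-* m n)) ⟩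
  ℚᵘ.mkℚᵘ (ℤ.+ m) 0 ℚᵘ.* ℚᵘ.mkℚᵘ (ℤ.+ n) 0       ≈⟨ ℚᵘ.*-cong (toℚᵘ-fromℕ m) (toℚᵘ-fromℕ n) ⟨
  ℚ.toℚᵘ (fromℕ m) ℚᵘ.* ℚ.toℚᵘ (fromℕ n)         ≈⟨ ℚ.toℚᵘ-homo-* (fromℕ m) (fromℕ n) ⟨
  ℚ.toℚᵘ (fromℕ m *ℚ fromℕ n)                    ∎)
  where open ℚᵘ.≃-Reasoning

fromℕ-suc : ∀ m → fromℕ (suc m) ≡ 1ℚ +ℚ fromℕ m
fromℕ-suc m = fromℕ-+ 1 m

fromℕ-mono-≤ : ∀ {m n} → m ℕ.≤ n → fromℕ m ≤ℚ fromℕ n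
fromℕ-mono-≤ {m} {n} m≤n = ℚ.toℚᵘ-cancel-≤ (begin
  ℚ.toℚᵘ (fromℕ m)     ≃⟨ toℚᵘ-fromℕ m ⟩
  ℚᵘ.mkℚᵘ (ℤ.+ m) 0    ≤⟨ ℚᵘ.*≤* (ℤ.*-monoʳ-≤-nonNeg (ℤ.+ 1) (ℤ.+≤+ m≤n)) ⟩
  ℚᵘ.mkℚᵘ (ℤ.+ n) 0    ≃⟨ toℚᵘ-fromℕ n ⟨
  ℚ.toℚᵘ (fromℕ n)     ∎)
  where open ℚᵘ.≤-Reasoning

fromℕ-cancel-≤ : ∀ {m n} → fromℕ m ≤ℚ fromℕ n → m ℕ.≤ n
fromℕ-cancel-≤ {m} {n} le with ℕ.≤-total m n
... | inj₁ m≤n = m≤n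
... | inj₂ n≤m with ℚ.≤-antisym le (fromℕ-mono-≤ n≤m)
...   | eq with ℚᵘ.≃-trans (ℚᵘ.≃-sym (toℚᵘ-fromℕ m)) (ℚᵘ.≃-trans (ℚ.toℚᵘ-cong eq) (toℚᵘ-fromℕ n))
...     | ℚᵘ.*≡* e = ℕ.≤-reflexive (ℤ.+-injective (ℤ.*-cancelʳ-≡ (ℤ.+ m) (ℤ.+ n) (ℤ.+ 1) e))

module Run {n σ : ℕ} (A : Algorithm n σ) where
  open Algorithm A

  halts : Maybe ℕ → Basis n σ d → Bool
  halts o x = does (maybe-≡-dec ℕ._≟_ (result x) o)

  halts-exclusive : ∀ {o o′} → o ≢ o′ → ∀ x → ¬ (halts o x ≡ true × halts o′ x ≡ true)
  halts-exclusive {o} {o′} o≢o′ x with maybe-≡-dec ℕ._≟_ (result x) o | maybe-≡-dec ℕ._≟_ (result x) o′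
  ... | yes p | yes q = λ _ → o≢o′ (≡.trans (≡.sym p) q)
  ... | yes p | no ¬q = λ ()
  ... | no ¬p | _     = λ ()

  module Probabilities (T : Text n σ) where
    ψ φ : ℕ → State {n} {σ} {d}
    ψ k = stateAt A T k
    φ k = project A T nothing (ψ k)

    live : ℕ → ℝ
    live k = ⟪ φ k , φ k ⟫

    live-nonNeg : ∀ k → 0ᴿ ≼ live k
    live-nonNeg k = ⟪⟫-nonNeg (φ k)

    norm-zero : ⟪ ψ 0 , ψ 0 ⟫ ≃ 1ᴿ
    norm-zero = ≃-trans (unitary-⟪⟫ (step-unitary 0) ∣ start ⟩ ∣ start ⟩) (basis-norm start)

    norm-suc : ∀ k → ⟪ ψ (suc k) , ψ (suc k) ⟫ ≃ live k
    norm-suc k = ≃-trans (unitary-⟪⟫ (step-unitary (suc k)) (oracle T (φ k)) (oracle T (φ k)))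
                         (oracle-⟪⟫ T (φ k) (φ k))

    -- The three outcomes live on disjoint sets of basis states; what other outputs receive is
    -- dropped.
    measurement : ∀ {v v′} → v ≢ v′ → ∀ k →
      live k +ᴿ (haltProb A T v k +ᴿ haltProb A T v′ k) ≼ ⟪ ψ k , ψ k ⟫
    measurement {v} {v′} v≢v′ k = ≼-trans
      (≃⇒≽ (≃-trans (Rs.∑-+ (λ x → norm nothing x) (λ x → norm (just v) x +ᴿ norm (just v′) x))
                    (+-cong ≃-refl (Rs.∑-+ (norm (just v)) (norm (just v′))))))
      (∑-mono λ x → exclusive (halts nothing x) (halts (just v) x) (halts (just v′) x)
        (halts-exclusive (λ ()) x) (halts-exclusive (λ ()) x)
        (halts-exclusive (v≢v′ ∘ just-injective) x) (ψ k x))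
      where
      norm : Maybe ℕ → Basis n σ d → ℝ
      norm o x = project A T o (ψ k) x ⊙ project A T o (ψ k) x

    haltProb-nonNeg : ∀ v k → 0ᴿ ≼ haltProb A T v k
    haltProb-nonNeg v k = ⟪⟫-nonNeg (project A T (just v) (ψ k))

    outputProb-mono : ∀ v {k l} → k ℕ.≤′ l → outputProb A T v k ≼ outputProb A T v l
    outputProb-mono v ℕ.≤′-refl = ≼-refl
    outputProb-mono v {k} {suc l} (ℕ.≤′-step k≤l) = ≼-trans (outputProb-mono v k≤l)
      (≼-by (haltProb-nonNeg v (suc l)) λ i → cancel (seq (outputProb A T v l) i) (seq (haltProb A T v (suc l)) i))
      where
      open +-*-Solver
      cancel : ∀ p h → (p +ℚ h) -ℚ p ≡ h -ℚ 0ℚ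
      cancel = solve 2 (λ p h → (p :+ h) :- p := h :- con 0ℚ) ≡.refl

    -- Output `v` that arrives after the `k`-th query can only come from amplitude that was live
    -- then.
    outputProb+live-anti : ∀ v {k l} → k ℕ.≤′ l →
      outputProb A T v l +ᴿ live l ≼ outputProb A T v k +ᴿ live k
    outputProb+live-anti v ℕ.≤′-refl = ≼-refl
    outputProb+live-anti v {k} {suc l} (ℕ.≤′-step k≤l) = ≼-trans
      -- `measurement` wants a second output; any other than `v` will do, and its probability is
      -- discarded.
      (≼-by (+-mono-≼ (≼-trans (measurement (ℕ.<⇒≢ (ℕ.n<1+n v)) (suc l)) (≃⇒≼ (norm-suc l)))
                      (haltProb-nonNeg (suc v) (suc l)))
        λ i → cancel (seq (outputProb A T v l) i) (seq (haltProb A T v (suc l)) i)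
                     (seq (live (suc l)) i) (seq (live l) i) (seq (haltProb A T (suc v) (suc l)) i))
      (outputProb+live-anti v k≤l)
      where
      open +-*-Solver
      cancel : ∀ p h n m g → (p +ℚ m) -ℚ (p +ℚ h +ℚ n) ≡ (m +ℚ g) -ℚ ((n +ℚ (h +ℚ g)) +ℚ 0ℚ)
      cancel = solve 5 (λ p h n m g → (p :+ m) :- (p :+ h :+ n) := (m :+ g) :- ((n :+ (h :+ g)) :+ con 0ℚ)) ≡.refl

    total : ∀ {v v′} → v ≢ v′ → ∀ k → live k +ᴿ (outputProb A T v k +ᴿ outputProb A T v′ k) ≼ 1ᴿ
    total v≢v′ zero = ≼-trans (measurement v≢v′ 0) (≃⇒≼ norm-zero)
    total {v} {v′} v≢v′ (suc k) = ≼-by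
      (+-mono-≼ (≼-trans (measurement v≢v′ (suc k)) (≃⇒≼ (norm-suc k))) (total v≢v′ k))
      λ i → cancel (seq (live (suc k)) i) (seq (live k) i)
        (seq (outputProb A T v k) i) (seq (haltProb A T v (suc k)) i)
        (seq (outputProb A T v′ k) i) (seq (haltProb A T v′ (suc k)) i)
      where
      open +-*-Solver
      cancel : ∀ n m p h q g → 1ℚ -ℚ (n +ℚ ((p +ℚ h) +ℚ (q +ℚ g)))
                 ≡ (m +ℚ 1ℚ) -ℚ ((n +ℚ (h +ℚ g)) +ℚ (m +ℚ (p +ℚ q)))
      cancel = solve 6 (λ n m p h q g → con 1ℚ :- (n :+ ((p :+ h) :+ (q :+ g)))
                 := (m :+ con 1ℚ) :- ((n :+ (h :+ g)) :+ (m :+ (p :+ q)))) ≡.refl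

    live≤1 : ∀ k → live k ≼ 1ᴿ
    live≤1 k = ≼-by (+-mono-≼ (total {0} {1} (λ ()) k) (+-mono-≼ (P-nonNeg 0) (P-nonNeg 1)))
      λ i → cancel (seq (live k) i) (seq (outputProb A T 0 k) i) (seq (outputProb A T 1 k) i)
      where
      open +-*-Solver
      P-nonNeg : ∀ v → 0ᴿ ≼ outputProb A T v k
      P-nonNeg v = ≼-trans (haltProb-nonNeg v 0) (outputProb-mono v (ℕ.≤⇒≤′ (ℕ.z≤n {k})))
      cancel : ∀ n p q → 1ℚ -ℚ n ≡ (1ℚ +ℚ (p +ℚ q)) -ℚ ((n +ℚ (p +ℚ q)) +ℚ (0ℚ +ℚ 0ℚ))
      cancel = solve 3 (λ n p q → con 1ℚ :- n := (con 1ℚ :+ (p :+ q)) :- ((n :+ (p :+ q)) :+ (con 0ℚ :+ con 0ℚ))) ≡.refl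

    UsesAtMost⇒dead : ∀ {q} → UsesAtMost A T q → live q ≃ 0ᴿ
    UsesAtMost⇒dead {q} halted = ≃-trans {y = Rs.∑ {n} {σ} {d} λ _ → 0ᴿ} (Rs.∑-cong zero-at) (Rs.∑-zero {n} {σ} {d})
      where
      zero-at : ∀ x → φ q x ⊙ φ q x ≃ 0ᴿ
      zero-at x = ≃-trans {y = 0ᶜ ⊙ 0ᶜ} (+-cong (*-cong (mk≃ (proj₁ (halted x))) (mk≃ (proj₁ (halted x))))
                                  (*-cong (mk≃ (proj₂ (halted x))) (mk≃ (proj₂ (halted x)))))
                          (≃-pointwise λ _ → ≡.refl)

    -- `Outputs` reaches 2/3 - δ only at some unknown time `k`. If `k` lies beyond `q`, nothing is
    -- live at `q`, and so nothing is gained between `q` and `k`.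
    output-lower : ∀ {v q Q δ} → Outputs A T v → UsesAtMost A T q → q ℕ.≤ Q → 0ℚ < δ →
      fromℚ (ℤ.+ 2 ℚ./ 3 -ℚ δ) ≼ outputProb A T v Q
    output-lower {v} {q} {Q} {δ} out halted q≤Q 0<δ with out δ 0<δ
    ... | k , le = ≼-trans (mk≼ {x = fromℚ (ℤ.+ 2 ℚ./ 3 -ℚ δ)} {y = outputProb A T v k} le) (≼-trans (within-q k) (outputProb-mono v (ℕ.≤⇒≤′ q≤Q)))
      where
      open +-*-Solver
      cancel : ∀ p q n → q -ℚ p ≡ (q +ℚ 0ℚ +ℚ n) -ℚ (p +ℚ n +ℚ 0ℚ)
      cancel = solve 3 (λ p q n → q :- p := (q :+ con 0ℚ :+ n) :- (p :+ n :+ con 0ℚ)) ≡.refl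
      within-q : ∀ k → outputProb A T v k ≼ outputProb A T v q
      within-q k with ℕ.≤-total k q
      ... | inj₁ k≤q = outputProb-mono v (ℕ.≤⇒≤′ k≤q)
      ... | inj₂ q≤k = ≼-by (+-mono-≼ (≼-trans (outputProb+live-anti v (ℕ.≤⇒≤′ q≤k))
                                              (+-mono-≼ ≼-refl (≃⇒≼ (UsesAtMost⇒dead {q} halted))))
                                      (live-nonNeg k))
        λ i → cancel (seq (outputProb A T v k) i) (seq (outputProb A T v q) i) (seq (live k) i)

    -- At time Q + k the output v′ has probability at least 2/3 - δ, and `v` and v′ together have at
    -- most 1. This is what correctness alone says about the larger text.
    output-upper : ∀ {v v′ δ} → v ≢ v′ → Outputs A T v′ → 0ℚ < δ → ∀ Q →
      outputProb A T v Q ≼ fromℚ (1ℚ -ℚ (ℤ.+ 2 ℚ./ 3 -ℚ δ))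
    output-upper {v} {v′} {δ} v≢v′ out 0<δ Q with out δ 0<δ
    ... | k , le = ≼-by
      (+-mono-≼ (+-mono-≼ (total v≢v′ (Q ℕ.+ k)) (live-nonNeg (Q ℕ.+ k)))
        (+-mono-≼ (outputProb-mono v (ℕ.≤⇒≤′ (ℕ.m≤m+n Q k)))
                  (≼-trans (mk≼ {x = fromℚ (ℤ.+ 2 ℚ./ 3 -ℚ δ)} {y = outputProb A T v′ k} le) (outputProb-mono v′ (ℕ.≤⇒≤′ (ℕ.m≤n+m k Q))))))
      λ i → cancel (seq (outputProb A T v Q) i) (seq (live (Q ℕ.+ k)) i) (ℤ.+ 2 ℚ./ 3 -ℚ δ)
              (seq (outputProb A T v (Q ℕ.+ k)) i) (seq (outputProb A T v′ (Q ℕ.+ k)) i)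
      where
      open +-*-Solver
      cancel : ∀ x n s p q → (1ℚ -ℚ s) -ℚ x ≡ (1ℚ +ℚ n +ℚ (p +ℚ q)) -ℚ ((n +ℚ (p +ℚ q)) +ℚ 0ℚ +ℚ (x +ℚ s))
      cancel = solve 5 (λ x n s p q → (con 1ℚ :- s) :- x := (con 1ℚ :+ n :+ (p :+ q)) :- ((n :+ (p :+ q)) :+ con 0ℚ :+ (x :+ s))) ≡.refl

    -- The expected number of queries, among the first `k`, that ask for position `p`.
    queryWeight : Fin n → ℕ → ℝ
    queryWeight p zero    = 0ᴿ
    queryWeight p (suc k) = queryWeight p k +ᴿ row p (φ k) (φ k)

    queryWeight-nonNeg : ∀ p k → 0ᴿ ≼ queryWeight p k
    queryWeight-nonNeg p zero    = ≼-refl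
    queryWeight-nonNeg p (suc k) = ≼-trans (≃⇒≽ (R.+-identityˡ 0ᴿ)) (+-mono-≼ (queryWeight-nonNeg p k) (row-nonNeg p (φ k)))

    -- Over all positions the rows of one query add up to the live mass, which is at most 1.
    queryWeight-total : ∀ k → sumᴿ (λ p → queryWeight p k) ≼ fromℚ (fromℕ k)
    queryWeight-total zero = ≃⇒≼ (Rs.sum-replicate-zero n)
    queryWeight-total (suc k) = ≼-trans (≃⇒≼ (Rs.∑-distrib-+ (λ p → queryWeight p k) (λ p → row p (φ k) (φ k))))
      (≼-trans (+-mono-≼ (queryWeight-total k) (live≤1 k))
               (≃⇒≼ (≃-pointwise λ _ → ≡.trans (ℚ.+-comm (fromℕ k) 1ℚ) (≡.sym (fromℕ-suc k)))))

-- Runs on two texts differing in one position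

module Comparison {n σ : ℕ} (A : Algorithm n σ) {l m : ℚ} (0≤m : 0ℚ ≤ℚ m) (lm≡1 : l *ℚ m ≡ 1ℚ)
                  {S T : Text n σ} (p : Fin n) (agree : ∀ i → i ≢ p → S i ≡ T i) where
  open Algorithm A
  open Run A
  module S = Probabilities S
  module T = Probabilities T
  open +-*-Solver

  inner-live : ∀ k → ⟪ S.φ k , T.φ k ⟫ ≼ ⟪ S.ψ (suc k) , T.ψ (suc k) ⟫ +ᴿ (l • row p (S.φ k) (S.φ k) +ᴿ m • row p (T.φ k) (T.φ k))
  inner-live k = ≼-trans (query-step 0≤m lm≡1 {S} {T} p agree (S.φ k) (T.φ k))
    (+-mono-≼ (≃⇒≽ (unitary-⟪⟫ (step-unitary (suc k)) (oracle S (S.φ k)) (oracle T (T.φ k)))) ≼-refl)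

  measure : ∀ v k →
    12ℚ • ⟪ S.ψ k , T.ψ k ⟫ +ᴿ (9ℚ • S.live k +ᴿ (4ℚ • T.live k +ᴿ 5ℚ • haltProb A S v k))
      ≼ 12ℚ • ⟪ S.φ k , T.φ k ⟫ +ᴿ (9ℚ • ⟪ S.ψ k , S.ψ k ⟫ +ᴿ (4ℚ • ⟪ T.ψ k , T.ψ k ⟫ +ᴿ 5ℚ • haltProb A T v k))
  measure v k = ≼-trans (≃⇒≽ (∑-combination 12ℚ 9ℚ 4ℚ 5ℚ
      (λ x → S.ψ k x ⊙ T.ψ k x) (λ x → S.φ k x ⊙ S.φ k x) (λ x → T.φ k x ⊙ T.φ k x) (λ x → hS x ⊙ hS x)))
    (≼-trans (∑-mono λ x → interference (halts nothing x) (halts (just v) x) (halts-exclusive (λ ()) x) (S.ψ k x) (T.ψ k x))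
    (≃⇒≼ (∑-combination 12ℚ 9ℚ 4ℚ 5ℚ
      (λ x → S.φ k x ⊙ T.φ k x) (λ x → S.ψ k x ⊙ S.ψ k x) (λ x → T.ψ k x ⊙ T.ψ k x) (λ x → hT x ⊙ hT x))))
    where
    hS hT : State {n} {σ} {d}
    hS = project A S (just v) (S.ψ k)
    hT = project A T (just v) (T.ψ k)

  13ℚ : ℚ
  13ℚ = fromℕ 13

  progress : ℕ → ℝ
  progress k = l • S.queryWeight p k +ᴿ m • T.queryWeight p k

  -- Telescopes `measure` and `inner-live`. Initially the inner product is 1, whence the 12, and
  -- both norms are 1, whence 13 = 9 + 4. Each later norm is the preceding live mass, so these
  -- cancel.
  invariant : ∀ v k →
    fromℚ 12ℚ +ᴿ (9ℚ • S.live k +ᴿ (4ℚ • T.live k +ᴿ 5ℚ • outputProb A S v k))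
      ≼ 12ℚ • ⟪ S.φ k , T.φ k ⟫ +ᴿ (fromℚ 13ℚ +ᴿ (5ℚ • outputProb A T v k +ᴿ 12ℚ • progress k))
  invariant v zero = ≼-trans
    (+-mono-≼ (≼-trans (≃⇒≼ (≃-pointwise λ _ → ≡.sym (ℚ.*-identityʳ 12ℚ)))
                       (≃⇒≽ (*-cong (≃-refl {fromℚ 12ℚ}) inner-zero))) ≼-refl)
    (≼-trans (measure v 0) (≼-trans
      (+-mono-≼ ≼-refl (+-mono-≼ (≃⇒≼ (*-cong (≃-refl {fromℚ 9ℚ}) S.norm-zero)) (+-mono-≼ (≃⇒≼ (*-cong (≃-refl {fromℚ 4ℚ}) T.norm-zero)) ≼-refl)))
      (≃⇒≼ (≃-pointwise λ i → constants (seq ⟪ S.φ 0 , T.φ 0 ⟫ i) (seq (outputProb A T v 0) i) l m))))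
    where
    inner-zero : ⟪ S.ψ 0 , T.ψ 0 ⟫ ≃ 1ᴿ
    inner-zero = ≃-trans (unitary-⟪⟫ (step-unitary 0) ∣ start ⟩ ∣ start ⟩) (basis-norm start)
    constants : ∀ x h l m → 12ℚ *ℚ x +ℚ (9ℚ *ℚ 1ℚ +ℚ (4ℚ *ℚ 1ℚ +ℚ 5ℚ *ℚ h))
                              ≡ 12ℚ *ℚ x +ℚ (13ℚ +ℚ (5ℚ *ℚ h +ℚ 12ℚ *ℚ (l *ℚ 0ℚ +ℚ m *ℚ 0ℚ)))
    constants = solve 4 (λ x h l m → con 12ℚ :* x :+ (con 9ℚ :* con 1ℚ :+ (con 4ℚ :* con 1ℚ :+ con 5ℚ :* h))
      := con 12ℚ :* x :+ (con 13ℚ :+ (con 5ℚ :* h :+ con 12ℚ :* (l :* con 0ℚ :+ m :* con 0ℚ)))) ≡.refl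
  invariant v (suc k) = ≼-by
    (+-mono-≼ (+-mono-≼ (invariant v k) (•-mono-≼ (ℚ.nonNegative⁻¹ 12ℚ) (inner-live k)))
      (≼-trans (measure v (suc k))
        (+-mono-≼ ≼-refl (+-mono-≼ (≃⇒≼ (*-cong (≃-refl {fromℚ 9ℚ}) (S.norm-suc k)))
                          (+-mono-≼ (≃⇒≼ (*-cong (≃-refl {fromℚ 4ℚ}) (T.norm-suc k))) ≼-refl)))))
    λ i → telescope (seq ⟪ S.ψ (suc k) , T.ψ (suc k) ⟫ i) (seq ⟪ S.φ k , T.φ k ⟫ i) (seq ⟪ S.φ (suc k) , T.φ (suc k) ⟫ i)
      (seq (S.live k) i) (seq (S.live (suc k)) i) (seq (T.live k) i) (seq (T.live (suc k)) i)
      (seq (outputProb A S v k) i) (seq (haltProb A S v (suc k)) i) (seq (outputProb A T v k) i) (seq (haltProb A T v (suc k)) i)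
      l m (seq (S.queryWeight p k) i) (seq (T.queryWeight p k) i) (seq (row p (S.φ k) (S.φ k)) i) (seq (row p (T.φ k) (T.φ k)) i)
    where
    telescope : ∀ x y z a a′ b b′ P h Q g l m s t s′ t′ →
      (12ℚ *ℚ z +ℚ (13ℚ +ℚ (5ℚ *ℚ (Q +ℚ g) +ℚ 12ℚ *ℚ (l *ℚ (s +ℚ s′) +ℚ m *ℚ (t +ℚ t′)))))
        -ℚ (12ℚ +ℚ (9ℚ *ℚ a′ +ℚ (4ℚ *ℚ b′ +ℚ 5ℚ *ℚ (P +ℚ h))))
      ≡ ((12ℚ *ℚ y +ℚ (13ℚ +ℚ (5ℚ *ℚ Q +ℚ 12ℚ *ℚ (l *ℚ s +ℚ m *ℚ t)))) +ℚ 12ℚ *ℚ (x +ℚ (l *ℚ s′ +ℚ m *ℚ t′))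
          +ℚ (12ℚ *ℚ z +ℚ (9ℚ *ℚ a +ℚ (4ℚ *ℚ b +ℚ 5ℚ *ℚ g))))
        -ℚ ((12ℚ +ℚ (9ℚ *ℚ a +ℚ (4ℚ *ℚ b +ℚ 5ℚ *ℚ P))) +ℚ 12ℚ *ℚ y
          +ℚ (12ℚ *ℚ x +ℚ (9ℚ *ℚ a′ +ℚ (4ℚ *ℚ b′ +ℚ 5ℚ *ℚ h))))
    telescope = solve 17 (λ x y z a a′ b b′ P h Q g l m s t s′ t′ →
      (con 12ℚ :* z :+ (con 13ℚ :+ (con 5ℚ :* (Q :+ g) :+ con 12ℚ :* (l :* (s :+ s′) :+ m :* (t :+ t′)))))
        :- (con 12ℚ :+ (con 9ℚ :* a′ :+ (con 4ℚ :* b′ :+ con 5ℚ :* (P :+ h))))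
      := ((con 12ℚ :* y :+ (con 13ℚ :+ (con 5ℚ :* Q :+ con 12ℚ :* (l :* s :+ m :* t)))) :+ con 12ℚ :* (x :+ (l :* s′ :+ m :* t′))
          :+ (con 12ℚ :* z :+ (con 9ℚ :* a :+ (con 4ℚ :* b :+ con 5ℚ :* g))))
        :- ((con 12ℚ :+ (con 9ℚ :* a :+ (con 4ℚ :* b :+ con 5ℚ :* P))) :+ con 12ℚ :* y
          :+ (con 12ℚ :* x :+ (con 9ℚ :* a′ :+ (con 4ℚ :* b′ :+ con 5ℚ :* h))))) ≡.refl

  -- Amplitude that is still live is charged like a branch with a wrong answer, so the live terms of
  -- `invariant` cancel even while the run on `T` goes on.
  inner≤live : ∀ k → 12ℚ • ⟪ S.φ k , T.φ k ⟫ ≼ 9ℚ • S.live k +ᴿ 4ℚ • T.live k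
  inner≤live k = ≼-trans (≃⇒≼ (Rs.∑-*ˡ (fromℚ 12ℚ) λ x → S.φ k x ⊙ T.φ k x))
    (≼-trans (∑-mono λ x → pointwise (S.φ k x) (T.φ k x))
    (≃⇒≼ (≃-trans (Rs.∑-+ (λ x → 9ℚ • (S.φ k x ⊙ S.φ k x)) (λ x → 4ℚ • (T.φ k x ⊙ T.φ k x)))
      (+-cong (≃-sym (Rs.∑-*ˡ (fromℚ 9ℚ) λ x → S.φ k x ⊙ S.φ k x))
              (≃-sym (Rs.∑-*ˡ (fromℚ 4ℚ) λ x → T.φ k x ⊙ T.φ k x))))))
    where
    cancel : ∀ x y z → let o = 0ℚ *ℚ 0ℚ +ℚ 0ℚ *ℚ 0ℚ in
      (9ℚ *ℚ y +ℚ 4ℚ *ℚ z) -ℚ 12ℚ *ℚ x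
        ≡ (12ℚ *ℚ o +ℚ (9ℚ *ℚ y +ℚ (4ℚ *ℚ z +ℚ 5ℚ *ℚ o))) -ℚ (12ℚ *ℚ x +ℚ (9ℚ *ℚ o +ℚ (4ℚ *ℚ o +ℚ 5ℚ *ℚ o)))
    cancel = solve 3 (λ x y z → let o = con 0ℚ :* con 0ℚ :+ con 0ℚ :* con 0ℚ in
      (con 9ℚ :* y :+ con 4ℚ :* z) :- con 12ℚ :* x
        := (con 12ℚ :* o :+ (con 9ℚ :* y :+ (con 4ℚ :* z :+ con 5ℚ :* o))) :- (con 12ℚ :* x :+ (con 9ℚ :* o :+ (con 4ℚ :* o :+ con 5ℚ :* o)))) ≡.refl
    pointwise : ∀ u v → 12ℚ • (u ⊙ v) ≼ 9ℚ • (u ⊙ u) +ᴿ 4ℚ • (v ⊙ v)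
    -- For `false false` nothing survives the selections, and the inequality is plain AM-GM.
    pointwise u v = ≼-by (interference false false (λ ()) u v)
      λ i → cancel (seq (u ⊙ v) i) (seq (u ⊙ u) i) (seq (v ⊙ v) i)

  separation : ∀ {v v′ q Q} → v ≢ v′ → Outputs A S v → UsesAtMost A S q → q ℕ.≤ Q → Outputs A T v′ →
               fromℚ (ℤ.+ 1 ℚ./ 24) ≼ progress Q
  separation {v} {v′} {q} {Q} v≢v′ outS halted q≤Q outT = ≼-by
    (•-mono-≼ (ℚ.nonNegative⁻¹ (ℤ.+ 1 ℚ./ 12)) (+-mono-≼ (+-mono-≼ (invariant v Q) (inner≤live Q))
      (•-mono-≼ (ℚ.nonNegative⁻¹ 5ℚ) (+-mono-≼ (S.output-lower {v} {q} {Q} outS halted q≤Q 0<δ) (T.output-upper v≢v′ outT 0<δ Q)))))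
    λ i → arithmetic (seq ⟪ S.φ Q , T.φ Q ⟫ i) (seq (S.live Q) i) (seq (T.live Q) i)
      (seq (outputProb A S v Q) i) (seq (outputProb A T v Q) i) (seq (progress Q) i)
    where
    -- Here 12 · progress ≥ 12 - 13 + 5 (s - (1 - s)), where s - (1 - s) = 1/3 - 2δ = 3/10. The
    -- right side is 1/2, and a twelfth of it is 1/24.
    δ s : ℚ
    δ = ℤ.+ 1 ℚ./ 60
    s = ℤ.+ 2 ℚ./ 3 -ℚ δ
    0<δ : 0ℚ < δ
    0<δ = ℚ.positive⁻¹ δ
    arithmetic : ∀ x a b P R g →
      g -ℚ (ℤ.+ 1 ℚ./ 24)
        ≡ (ℤ.+ 1 ℚ./ 12) *ℚ (((12ℚ *ℚ x +ℚ (13ℚ +ℚ (5ℚ *ℚ R +ℚ 12ℚ *ℚ g))) +ℚ (9ℚ *ℚ a +ℚ 4ℚ *ℚ b)) +ℚ 5ℚ *ℚ (P +ℚ (1ℚ -ℚ s)))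
          -ℚ (ℤ.+ 1 ℚ./ 12) *ℚ (((12ℚ +ℚ (9ℚ *ℚ a +ℚ (4ℚ *ℚ b +ℚ 5ℚ *ℚ P))) +ℚ 12ℚ *ℚ x) +ℚ 5ℚ *ℚ (s +ℚ R))
    arithmetic = solve 6 (λ x a b P R g →
      g :- con (ℤ.+ 1 ℚ./ 24)
        := con (ℤ.+ 1 ℚ./ 12) :* (((con 12ℚ :* x :+ (con 13ℚ :+ (con 5ℚ :* R :+ con 12ℚ :* g))) :+ (con 9ℚ :* a :+ con 4ℚ :* b)) :+ con 5ℚ :* (P :+ (con 1ℚ :- con s)))
          :- con (ℤ.+ 1 ℚ./ 12) :* (((con 12ℚ :+ (con 9ℚ :* a :+ (con 4ℚ :* b :+ con 5ℚ :* P))) :+ con 12ℚ :* x) :+ con 5ℚ :* (con s :+ R))) ≡.refl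

-- Averaging over the covering pairs of subsets

∑ˢ : ∀ {M} → (Subset M → ℝ) → ℝ
∑ˢ {zero}  f = f []
∑ˢ {suc M} f = ∑ˢ (f ∘ (true ∷_)) +ᴿ ∑ˢ (f ∘ (false ∷_))

∑ˢ-cong : ∀ {M} {f g : Subset M → ℝ} → (∀ v → f v ≃ g v) → ∑ˢ f ≃ ∑ˢ g
∑ˢ-cong {zero}  f≃g = f≃g []
∑ˢ-cong {suc M} f≃g = +-cong (∑ˢ-cong (f≃g ∘ (true ∷_))) (∑ˢ-cong (f≃g ∘ (false ∷_)))

∑ˢ-mono : ∀ {M} {f g : Subset M → ℝ} → (∀ v → f v ≼ g v) → ∑ˢ f ≼ ∑ˢ g
∑ˢ-mono {zero}  f≼g = f≼g []
∑ˢ-mono {suc M} f≼g = +-mono-≼ (∑ˢ-mono (f≼g ∘ (true ∷_))) (∑ˢ-mono (f≼g ∘ (false ∷_)))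

interchange : ∀ a b c e → (a +ᴿ b) +ᴿ (c +ᴿ e) ≃ (a +ᴿ c) +ᴿ (b +ᴿ e)
interchange a b c e = ≃-pointwise λ k → solve 4 (λ a b c e → (a :+ b) :+ (c :+ e) := (a :+ c) :+ (b :+ e)) ≡.refl
  (seq a k) (seq b k) (seq c k) (seq e k)
  where open +-*-Solver

∑ˢ-+ : ∀ {M} (f g : Subset M → ℝ) → ∑ˢ (λ v → f v +ᴿ g v) ≃ ∑ˢ f +ᴿ ∑ˢ g
∑ˢ-+ {zero}  f g = ≃-refl
∑ˢ-+ {suc M} f g = ≃-trans (+-cong (∑ˢ-+ (f ∘ (true ∷_)) (g ∘ (true ∷_))) (∑ˢ-+ (f ∘ (false ∷_)) (g ∘ (false ∷_))))
  (interchange (∑ˢ (f ∘ (true ∷_))) (∑ˢ (g ∘ (true ∷_))) (∑ˢ (f ∘ (false ∷_))) (∑ˢ (g ∘ (false ∷_))))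

∑ˢ-• : ∀ {M} c (f : Subset M → ℝ) → ∑ˢ (λ v → c • f v) ≃ c • ∑ˢ f
∑ˢ-• {zero}  c f = ≃-refl
∑ˢ-• {suc M} c f = ≃-trans (+-cong (∑ˢ-• c (f ∘ (true ∷_))) (∑ˢ-• c (f ∘ (false ∷_)))) (≃-sym (R.distribˡ (fromℚ c) (∑ˢ (f ∘ (true ∷_))) (∑ˢ (f ∘ (false ∷_)))))

∑ˢ-nonNeg : ∀ {M} {f : Subset M → ℝ} → (∀ v → 0ᴿ ≼ f v) → 0ᴿ ≼ ∑ˢ f
∑ˢ-nonNeg {zero}  0≼f = 0≼f []
∑ˢ-nonNeg {suc M} 0≼f = ≼-trans (≃⇒≽ (R.+-identityˡ 0ᴿ))
  (+-mono-≼ (∑ˢ-nonNeg (0≼f ∘ (true ∷_))) (∑ˢ-nonNeg (0≼f ∘ (false ∷_))))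

term≼∑ˢ : ∀ {M} {f : Subset M → ℝ} → (∀ v → 0ᴿ ≼ f v) → ∀ v → f v ≼ ∑ˢ f
term≼∑ˢ {zero}  0≼f [] = ≼-refl
term≼∑ˢ {suc M} 0≼f (true ∷ v) = ≼-trans (≃⇒≽ (R.+-identityʳ _))
  (+-mono-≼ (term≼∑ˢ (0≼f ∘ (true ∷_)) v) (∑ˢ-nonNeg (0≼f ∘ (false ∷_))))
term≼∑ˢ {suc M} 0≼f (false ∷ v) = ≼-trans (≃⇒≽ (R.+-identityˡ _))
  (+-mono-≼ (∑ˢ-nonNeg (0≼f ∘ (true ∷_))) (term≼∑ˢ (0≼f ∘ (false ∷_)) v))

when : Bool → ℝ → ℝ
when b x = if b then x else 0ᴿ

when-cong : ∀ b {x y} → (b ≡ true → x ≃ y) → when b x ≃ when b y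
when-cong true  x≃y = x≃y ≡.refl
when-cong false _   = ≃-refl

when-mono : ∀ b {x y} → (b ≡ true → x ≼ y) → when b x ≼ when b y
when-mono true  x≼y = x≼y ≡.refl
when-mono false _   = ≼-refl

when-+ : ∀ b x y → when b (x +ᴿ y) ≃ when b x +ᴿ when b y
when-+ true  x y = ≃-refl
when-+ false x y = ≃-sym (R.+-identityˡ 0ᴿ)

_is_ : Bool → Bool → Bool
b is c = does (b Bool.≟ c)

is⇒≡ : ∀ b c → b is c ≡ true → b ≡ c
is⇒≡ true  true  _ = ≡.refl
is⇒≡ false false _ = ≡.refl

over : ∀ {M} → Bool → Subset M → (Fin M → ℝ) → ℝ
over c v f = sumᴿ λ i → when (lookup v i is c) (f i)

over-cong : ∀ {M} c (v : Subset M) {f g} → (∀ i → lookup v i ≡ c → f i ≃ g i) → over c v f ≃ over c v g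
over-cong c v f≃g = Rs.sum-cong-≋ λ i → when-cong (lookup v i is c) λ eq → f≃g i (is⇒≡ _ c eq)

over-mono : ∀ {M} c (v : Subset M) {f g} → (∀ i → lookup v i ≡ c → f i ≼ g i) → over c v f ≼ over c v g
over-mono c v f≼g = sum-mono λ i → when-mono (lookup v i is c) λ eq → f≼g i (is⇒≡ _ c eq)

over-+ : ∀ {M} c (v : Subset M) f g → over c v (λ i → f i +ᴿ g i) ≃ over c v f +ᴿ over c v g
over-+ c v f g = ≃-trans (Rs.sum-cong-≋ λ i → when-+ (lookup v i is c) (f i) (g i))
  (Rs.∑-distrib-+ (λ i → when (lookup v i is c) (f i)) (λ i → when (lookup v i is c) (g i)))

over≼sum : ∀ {M} c (v : Subset M) {f} → (∀ i → 0ᴿ ≼ f i) → over c v f ≼ sumᴿ f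
over≼sum c v 0≼f = sum-mono λ i → when≼ (lookup v i is c) (0≼f i)
  where
  when≼ : ∀ b {x} → 0ᴿ ≼ x → when b x ≼ x
  when≼ true  _   = ≼-refl
  when≼ false 0≼x = 0≼x

over-when : ∀ {M} c (v : Subset M) b f → over c v (λ i → when b (f i)) ≃ when b (over c v f)
over-when c v true  f = ≃-refl
over-when c v false f = Rs.sum-zero _ λ i → zero-when (lookup v i is c)
  where
  zero-when : ∀ b → when b 0ᴿ ≃ 0ᴿ
  zero-when true  = ≃-refl
  zero-when false = ≃-refl

suc-• : ∀ k x → fromℕ (suc k) • x ≃ x +ᴿ fromℕ k • x
suc-• k x = ≃-pointwise λ i → ≡.trans (≡.cong (_*ℚ seq x i) (fromℕ-suc k))
  (≡.trans (ℚ.*-distribʳ-+ (seq x i) 1ℚ (fromℕ k)) (≡.cong (_+ℚ fromℕ k *ℚ seq x i) (ℚ.*-identityˡ (seq x i))))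

zero-• : ∀ x → 0ᴿ ≃ fromℕ 0 • x
zero-• x = ≃-pointwise λ i → ≡.sym (ℚ.*-zeroˡ (seq x i))

over-true-const : ∀ {M} (v : Subset M) x → over true v (const x) ≃ fromℕ (card v) • x
over-true-const []          x = zero-• x
over-true-const (true ∷ v)  x = ≃-trans (+-cong ≃-refl (over-true-const v x)) (≃-sym (suc-• (card v) x))
over-true-const (false ∷ v) x = ≃-trans (R.+-identityˡ _) (over-true-const v x)

over-false-const : ∀ {M} (v : Subset M) x → over false v (const x) ≃ fromℕ (card (∁ v)) • x
over-false-const []          x = zero-• x
over-false-const (true ∷ v)  x = ≃-trans (R.+-identityˡ _) (over-false-const v x)
over-false-const (false ∷ v) x = ≃-trans (+-cong ≃-refl (over-false-const v x)) (≃-sym (suc-• (card (∁ v)) x))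

-- Both sides sum over the covering pairs v ⊂ v ∪ {i}.
double-counting : ∀ {M} (H : Subset M → Subset M → Fin M → ℝ) →
  ∑ˢ (λ v → over false v λ i → H v (v [ i ]≔ true) i) ≃ ∑ˢ (λ v → over true v λ i → H (v [ i ]≔ false) v i)
double-counting {zero}  H = ≃-refl
double-counting {suc M} H =
  ≃-trans (+-cong (∑ˢ-+ (const 0ᴿ) out₁) (∑ˢ-+ top out₀))
  (≃-trans (interchange Z (∑ˢ out₁) (∑ˢ top) (∑ˢ out₀))
  (≃-trans (+-cong (R.+-comm Z (∑ˢ top))
                   (+-cong (double-counting λ v w i → H (true ∷ v) (true ∷ w) (suc i))
                           (double-counting λ v w i → H (false ∷ v) (false ∷ w) (suc i))))
  (≃-trans (interchange (∑ˢ top) Z (∑ˢ in₁) (∑ˢ in₀))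
  (≃-sym (+-cong (∑ˢ-+ top in₁) (∑ˢ-+ (const 0ᴿ) in₀))))))
  where
  Z : ℝ
  Z = ∑ˢ {M} (const 0ᴿ)
  top out₁ out₀ in₁ in₀ : Subset M → ℝ
  top  v = H (false ∷ v) (true ∷ v) zero
  out₁ v = over false v λ i → H (true ∷ v) (true ∷ (v [ i ]≔ true)) (suc i)
  out₀ v = over false v λ i → H (false ∷ v) (false ∷ (v [ i ]≔ true)) (suc i)
  in₁  v = over true v λ i → H (true ∷ (v [ i ]≔ false)) (true ∷ v) (suc i)
  in₀  v = over true v λ i → H (false ∷ (v [ i ]≔ false)) (false ∷ v) (suc i)

card-insert : ∀ {M} (v : Subset M) i → lookup v i ≡ true → suc (card (v [ i ]≔ false)) ≡ card v
card-insert (true ∷ v)  zero    _  = ≡.refl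
card-insert (true ∷ v)  (suc i) eq = ≡.cong suc (card-insert v i eq)
card-insert (false ∷ v) (suc i) eq = card-insert v i eq

-- Layers of the subset lattice

restrict : ∀ {M} → ℕ → (Subset M → ℝ) → Subset M → ℝ
restrict k f v = when (does (card v ℕ.≟ k)) (f v)

∑ˢ[_] : ∀ {M} → ℕ → (Subset M → ℝ) → ℝ
∑ˢ[ k ] f = ∑ˢ (restrict k f)

module _ {M : ℕ} (k : ℕ) where
  private
    ≟⇒≡ : ∀ m → does (m ℕ.≟ k) ≡ true → m ≡ k
    ≟⇒≡ m eq = ℕ.≡ᵇ⇒≡ m k (≡.subst Bool.T (≡.sym eq) _)

  slice-cong : ∀ {f g : Subset M → ℝ} → (∀ v → card v ≡ k → f v ≃ g v) → ∑ˢ[ k ] f ≃ ∑ˢ[ k ] g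
  slice-cong f≃g = ∑ˢ-cong λ v → when-cong (does (card v ℕ.≟ k)) λ eq → f≃g v (≟⇒≡ (card v) eq)

  slice-mono : ∀ {f g : Subset M → ℝ} → (∀ v → card v ≡ k → f v ≼ g v) → ∑ˢ[ k ] f ≼ ∑ˢ[ k ] g
  slice-mono f≼g = ∑ˢ-mono λ v → when-mono (does (card v ℕ.≟ k)) λ eq → f≼g v (≟⇒≡ (card v) eq)

  slice-• : ∀ c (f : Subset M → ℝ) → ∑ˢ[ k ] (λ v → c • f v) ≃ c • ∑ˢ[ k ] f
  slice-• c f = ≃-trans (∑ˢ-cong λ v → when-• (does (card v ℕ.≟ k)) (f v)) (∑ˢ-• c (restrict k f))
    where
    when-• : ∀ b x → when b (c • x) ≃ c • when b x
    when-• true  x = ≃-refl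
    when-• false x = ≃-sym (R.zeroʳ (fromℚ c))

  slice-+ : ∀ (f g : Subset M → ℝ) → ∑ˢ[ k ] (λ v → f v +ᴿ g v) ≃ ∑ˢ[ k ] f +ᴿ ∑ˢ[ k ] g
  slice-+ f g = ≃-trans (∑ˢ-cong λ v → when-+ (does (card v ℕ.≟ k)) (f v) (g v)) (∑ˢ-+ (restrict k f) (restrict k g))

  -- `double-counting` with the indicator that the lower set has size `k`. Removing an element
  -- lowers the size by one, so on the right this becomes the indicator of size k + 1.
  slice-covering : ∀ (G : Subset M → Fin M → ℝ) →
    ∑ˢ[ k ] (λ v → over false v λ i → G (v [ i ]≔ true) i) ≃ ∑ˢ[ suc k ] (λ v → over true v (G v))
  slice-covering G =
    ≃-trans (∑ˢ-cong λ v → ≃-sym (over-when false v (does (card v ℕ.≟ k)) λ i → G (v [ i ]≔ true) i))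
    (≃-trans (double-counting λ v w i → when (does (card v ℕ.≟ k)) (G w i))
    (∑ˢ-cong λ v → ≃-trans
      (over-cong true v λ i i∈v → R.reflexive (≡.cong (λ m → when (does (m ℕ.≟ suc k)) (G v i)) (card-insert v i i∈v)))
      (over-when true v (does (card v ℕ.≟ suc k)) (G v))))

  slice-const : ∀ r → ∑ˢ[_] {M} k (const (fromℚ r)) ≃ r • ∑ˢ[_] {M} k (const 1ᴿ)
  slice-const r = ≃-trans (slice-cong λ _ _ → ≃-sym (R.*-identityʳ (fromℚ r))) (slice-• r (const 1ᴿ))

subset-of-card : ∀ {M k} → k ℕ.≤ M → Σ[ v ∈ Subset M ] card v ≡ k
subset-of-card {zero} {zero} _ = [] , ≡.refl
subset-of-card {suc M} {zero} _ with v , eq ← subset-of-card {M} ℕ.z≤n = false ∷ v , eq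
subset-of-card {suc M} {suc k} k<M with v , eq ← subset-of-card (ℕ.s≤s⁻¹ k<M) = true ∷ v , ≡.cong suc eq

-- The averaging has to cancel the number of `k`-subsets; this bound suffices for that, without
-- evaluating a binomial coefficient.
1≼slice : ∀ {M k} → k ℕ.≤ M → 1ᴿ ≼ ∑ˢ[_] {M} k (const 1ᴿ)
1≼slice {M} {k} k≤M with v , ≡.refl ← subset-of-card k≤M =
  ≡.subst (_≼ ∑ˢ[_] {M} (card v) (const 1ᴿ)) (≡.cong (λ b → when b 1ᴿ) (card-≟ (card v)))
    (term≼∑ˢ {f = λ w → when (does (card w ℕ.≟ card v)) 1ᴿ} (λ w → nonNeg (does (card w ℕ.≟ card v))) v)
  where
  card-≟ : ∀ m → does (m ℕ.≟ m) ≡ true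
  card-≟ zero    = ≡.refl
  card-≟ (suc m) = card-≟ m
  nonNeg : ∀ b → 0ᴿ ≼ when b 1ᴿ
  nonNeg true  = fromℚ-mono-≼ (ℚ.<⇒≤ 0<1)
  nonNeg false = ≼-refl

-- Sum the hypothesis over all covering pairs: a set of size k is the lower end of M ∸ k of them, and
-- a set of size k + 1 is the upper end of k + 1 of them.
averaging : ∀ {M k q e l m} → k ℕ.≤ M → 0ℚ ≤ℚ l → 0ℚ ≤ℚ m → (W : Subset M → Fin M → ℝ) →
  (∀ v i → 0ᴿ ≼ W v i) → (∀ v → sumᴿ (W v) ≼ fromℚ q) →
  (∀ v i → card v ≡ k → lookup v i ≡ false → fromℚ e ≼ l • W v i +ᴿ m • W (v [ i ]≔ true) i) →
  let a = fromℕ (M ℕ.∸ k) ; b = fromℕ (suc k) in b *ℚ (a *ℚ e) ≤ℚ b *ℚ (l *ℚ q) +ℚ (m *ℚ q) *ℚ a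
averaging {M} {k} {q} {e} {l} {m} k≤M 0≤l 0≤m W 0≤W W≤q pair = conclude (ℚ.≤-total r s)
  where
  open +-*-Solver
  a b r s : ℚ
  a = fromℕ (M ℕ.∸ k)
  b = fromℕ (suc k)
  r = b *ℚ (a *ℚ e)
  s = b *ℚ (l *ℚ q) +ℚ (m *ℚ q) *ℚ a

  N N⁺ : ℝ
  N  = ∑ˢ[_] {M} k (const 1ᴿ)
  N⁺ = ∑ˢ[_] {M} (suc k) (const 1ᴿ)

  over-false : ∀ v → card v ≡ k → ∀ x → over false v (const x) ≃ a • x
  over-false v eq x = ≡.subst (λ c → over false v (const x) ≃ fromℕ c • x)
    (≡.trans (Subset.∣∁p∣≡n∸∣p∣ v) (≡.cong (M ℕ.∸_) eq)) (over-false-const v x)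

  -- The covering pairs counted from both ends: (k + 1) C(M, k + 1) = (M - k) C(M, k).
  counting : b • N⁺ ≃ a • N
  counting =
    ≃-trans (≃-sym (slice-• {M} (suc k) b (const 1ᴿ)))
    (≃-trans (slice-cong {M} (suc k) λ v eq → ≃-sym (≡.subst (λ c → over true v (const 1ᴿ) ≃ fromℕ c • 1ᴿ) eq (over-true-const v 1ᴿ)))
    (≃-trans (≃-sym (slice-covering {M} k (λ v i → 1ᴿ)))
    (≃-trans (slice-cong {M} k λ v eq → over-false v eq 1ᴿ) (slice-• {M} k a (const 1ᴿ)))))

  scaled : ∀ {p} c (v : Subset M) → 0ℚ ≤ℚ p → over c v (λ i → p • W v i) ≼ fromℚ (p *ℚ q)
  scaled {p} c v 0≤p = ≼-trans (over≼sum c v λ i → ≼-trans (≃⇒≽ (R.zeroʳ (fromℚ p))) (•-mono-≼ 0≤p (0≤W v i)))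
    (≼-trans (≃⇒≽ (Rs.*-distribˡ-sum (fromℚ p) (W v)))
    (≼-trans (•-mono-≼ 0≤p (W≤q v)) (≃⇒≼ (≃-pointwise λ _ → ≡.refl))))

  local : ∀ v → card v ≡ k → fromℚ (a *ℚ e) ≼ fromℚ (l *ℚ q) +ᴿ over false v (λ i → m • W (v [ i ]≔ true) i)
  local v eq =
    ≼-trans (≃⇒≼ (≃-trans (≃-pointwise λ _ → ≡.refl) (≃-sym (over-false v eq (fromℚ e)))))
    (≼-trans (over-mono false v λ i i∉v → pair v i eq i∉v)
    (≼-trans (≃⇒≼ (over-+ false v (λ i → l • W v i) (λ i → m • W (v [ i ]≔ true) i)))
    (+-mono-≼ (scaled false v 0≤l) ≼-refl)))

  summed : (a *ℚ e) • N ≼ (l *ℚ q) • N +ᴿ (m *ℚ q) • N⁺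
  summed =
    ≼-trans (≃⇒≽ (slice-const {M} k (a *ℚ e)))
    (≼-trans (slice-mono {M} k local)
    (≼-trans (≃⇒≼ (slice-+ {M} k (const (fromℚ (l *ℚ q))) λ v → over false v λ i → m • W (v [ i ]≔ true) i))
    (+-mono-≼ (≃⇒≼ (slice-const {M} k (l *ℚ q)))
      (≼-trans (≃⇒≼ (slice-covering {M} k λ v i → m • W v i))
      (≼-trans (slice-mono {M} (suc k) λ v _ → scaled true v 0≤m)
      (≃⇒≼ (slice-const {M} (suc k) (m *ℚ q))))))))

  0≤b : 0ℚ ≤ℚ b
  0≤b = ℚ.nonNegative⁻¹ b {{ℚ.normalize-nonNeg (suc k) 1}}

  0≤mq : 0ℚ ≤ℚ m *ℚ q
  0≤mq = 0≤p*q 0≤m (fromℚ-reflects-≼ (≼-trans (sum-nonNeg (0≤W v₀)) (W≤q v₀)))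
    where
    v₀ : Subset M
    v₀ = proj₁ (subset-of-card k≤M)

  -- Multiplying `summed` by b = k + 1 lets `counting` trade `N⁺` for `N`.
  total : r • N ≼ s • N
  total = ≼-by (+-mono-≼ (•-mono-≼ 0≤b summed) (•-mono-≼ 0≤mq (≃⇒≼ counting)))
    λ i → cancel a b e (l *ℚ q) (m *ℚ q) (seq N i) (seq N⁺ i)
    where
    cancel : ∀ a b e x y n n⁺ →
      (b *ℚ x +ℚ y *ℚ a) *ℚ n -ℚ (b *ℚ (a *ℚ e)) *ℚ n
        ≡ (b *ℚ (x *ℚ n +ℚ y *ℚ n⁺) +ℚ y *ℚ (a *ℚ n)) -ℚ (b *ℚ ((a *ℚ e) *ℚ n) +ℚ y *ℚ (b *ℚ n⁺))
    cancel = solve 7 (λ a b e x y n n⁺ →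
      (b :* x :+ y :* a) :* n :- (b :* (a :* e)) :* n
        := (b :* (x :* n :+ y :* n⁺) :+ y :* (a :* n)) :- (b :* ((a :* e) :* n) :+ y :* (b :* n⁺))) ≡.refl

  conclude : r ≤ℚ s ⊎ s ≤ℚ r → r ≤ℚ s
  conclude (inj₁ r≤s) = r≤s
  -- Here 0 ≤ r - s ≤ (r - s) N ≤ 0, as N ≥ 1.
  conclude (inj₂ s≤r) = fromℚ-reflects-≼ (≼-by
    (+-mono-≼ total (•-mono-≼ (≡.subst (_≤ℚ r -ℚ s) (ℚ.+-inverseʳ s) (ℚ.+-monoˡ-≤ (-ℚ s) s≤r)) (1≼slice k≤M)))
    λ i → cancel r s (seq N i))
    where
    cancel : ∀ r s n → s -ℚ r ≡ (s *ℚ n +ℚ (r -ℚ s) *ℚ n) -ℚ (r *ℚ n +ℚ (r -ℚ s) *ℚ 1ℚ)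
    cancel = solve 3 (λ r s n → s :- r := (s :* n :+ (r :- s) :* n) :- (r :* n :+ (r :- s) :* con 1ℚ)) ≡.refl

-- LZ77 factorizations of marked texts

-- Positions past the end count as unmarked, so that equations between a list and its suffixes hold
-- at all indices.
nth : List Bool → ℕ → Bool
nth []       _       = false
nth (b ∷ _)  zero    = b
nth (_ ∷ bs) (suc i) = nth bs i

-- The number of factors produced from a position at which a factor starts, respectively from
-- within a maximal run of unmarked positions, when the remaining marks are as given.
factors run : List Bool → ℕ
factors []           = 0
factors (true ∷ bs)  = suc (factors bs)
factors (false ∷ bs) = suc (run bs)
run []           = 0
run (true ∷ bs)  = suc (factors bs)
run (false ∷ bs) = run bs

-- A marked position holds a letter of its own, and the others share one letter.
module MarkedText {n σ : ℕ} (0<n : 0 ℕ.< n) (n≤σ : n ℕ.≤ σ) (bs : List Bool) (unmarked₀ : nth bs 0 ≡ false) where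

  text : Text n σ
  text i = if nth bs (toℕ i) then Fin.inject≤ i n≤σ else fromℕ< (ℕ.<-≤-trans 0<n n≤σ)

  unmarked-≡ : ∀ x y → nth bs (toℕ x) ≡ false → nth bs (toℕ y) ≡ false → text x ≡ text y
  unmarked-≡ x y px py rewrite px | py = ≡.refl

  -- The common letter is letter 0. It could clash only with the own letter of position 0, and that
  -- position is unmarked.
  marked-≢ : ∀ x y → nth bs (toℕ x) ≡ true → y ≢ x → text y ≢ text x
  marked-≢ x y px y≢x eq with nth bs (toℕ y)
  marked-≢ x y px y≢x eq | true rewrite px = y≢x (Fin.inject≤-injective n≤σ n≤σ y x eq)
  marked-≢ x y px y≢x eq | false rewrite px = contradiction (≡.trans (≡.sym px) (≡.trans (≡.cong (nth bs) x≡0) unmarked₀)) λ ()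
    where
    x≡0 : toℕ x ≡ 0
    x≡0 = ≡.trans (≡.sym (Fin.toℕ-inject≤ x n≤σ))
      (≡.trans (≡.cong toℕ (≡.sym eq)) (Fin.toℕ-fromℕ< (ℕ.<-≤-trans 0<n n≤σ)))

  private
    T : Text n σ
    T = text

    at : ∀ {p} → p ℕ.< n → Fin n
    at p<n = fromℕ< p<n

    toℕ-at : ∀ {p} (p<n : p ℕ.< n) → toℕ (at p<n) ≡ p
    toℕ-at p<n = Fin.toℕ-fromℕ< p<n

  new-marked : ∀ {p k} → p ℕ.< n → nth bs p ≡ true → Factors T (suc p) k → Factors T p (suc k)
  new-marked {p} {k} p<n marked rest =
    ≡.subst (λ q → Factors T q (suc k)) (toℕ-at p<n)
      (new (at p<n) (λ y y<x → marked-≢ (at p<n) y (≡.trans (≡.cong (nth bs) (toℕ-at p<n)) marked) (Fin.<⇒≢ y<x))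
        (≡.subst (λ q → Factors T (suc q) k) (≡.sym (toℕ-at p<n)) rest))

  -- The factor is copied from position 0, overlapping itself if need be. It cannot be longer: the
  -- next position is past the end or carries a letter that has not occurred before.
  copy-run : ∀ {p j k} → 0 ℕ.< p → p ℕ.≤ j → j ℕ.< n →
    (∀ y → p ℕ.≤ y → y ℕ.≤ j → nth bs y ≡ false) → (∀ y → y ℕ.+ p ℕ.≤ j → nth bs y ≡ false) →
    suc j ≡ n ⊎ nth bs (suc j) ≡ true → Factors T (suc j) k → Factors T p (suc k)
  copy-run {p} {j} {k} 0<p p≤j j<n unmarked source ends rest =
    ≡.subst (λ q → Factors T q (suc k)) (toℕ-at p<n)
      (copy (at p<n) (at j<n) (≡.subst₂ ℕ._≤_ (≡.sym (toℕ-at p<n)) (≡.sym (toℕ-at j<n)) p≤j) occurs maximal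
        (≡.subst (λ q → Factors T (suc q) k) (≡.sym (toℕ-at j<n)) rest))
    where
    p<n : p ℕ.< n
    p<n = ℕ.≤-<-trans p≤j j<n
    occurs : OccursEarlier T (at p<n) (at j<n)
    occurs = at 0<n , ≡.subst₂ ℕ._<_ (≡.sym (toℕ-at 0<n)) (≡.sym (toℕ-at p<n)) 0<p , λ x y p≤x x≤j eq →
      let x≡y+p = ≡.trans (≡.sym (≡.trans (≡.cong (toℕ x ℕ.+_) (toℕ-at 0<n)) (ℕ.+-identityʳ (toℕ x))))
                          (≡.trans eq (≡.cong (toℕ y ℕ.+_) (toℕ-at p<n)))
          x≤j′ = ≡.subst (toℕ x ℕ.≤_) (toℕ-at j<n) x≤j
      in unmarked-≡ x y (unmarked (toℕ x) (≡.subst (ℕ._≤ toℕ x) (toℕ-at p<n) p≤x) x≤j′)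
                        (source (toℕ y) (≡.subst (ℕ._≤ j) x≡y+p x≤j′))
    maximal : ∀ j′ → at p<n Fin.≤ j′ → OccursEarlier T (at p<n) j′ → j′ Fin.≤ at j<n
    maximal j′ p≤j′ (i′ , i′<p , same) = ℕ.≮⇒≥ λ j<j′ →
      let j<j′ = ≡.subst (ℕ._< toℕ j′) (toℕ-at j<n) j<j′ in longer j<j′ ends
      where
      longer : j ℕ.< toℕ j′ → ¬ (suc j ≡ n ⊎ nth bs (suc j) ≡ true)
      longer j<j′ (inj₁ j+1≡n) = ℕ.<-irrefl j+1≡n (ℕ.≤-<-trans j<j′ (Fin.toℕ<n j′))
      -- A longer factor with source i′ would copy the mark at `suc j` from position suc j + i′ - p,
      -- which lies before it.
      longer j<j′ (inj₂ marked) = marked-≢ x y (≡.trans (≡.cong (nth bs) (toℕ-at x<n)) marked)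
          (λ y≡x → ℕ.<⇒≢ y<x (≡.trans (≡.sym (toℕ-at y<n)) (≡.trans (≡.cong toℕ y≡x) (toℕ-at x<n))))
          (≡.sym (same x y (≡.subst₂ ℕ._≤_ (≡.sym (toℕ-at p<n)) (≡.sym (toℕ-at x<n)) (ℕ.m≤n⇒m≤1+n p≤j))
                         (≡.subst (ℕ._≤ toℕ j′) (≡.sym (toℕ-at x<n)) j<j′)
                         (≡.trans (≡.cong (ℕ._+ toℕ i′) (toℕ-at x<n))
                           (≡.sym (≡.trans (≡.cong₂ ℕ._+_ (toℕ-at y<n) (toℕ-at p<n)) (ℕ.m∸n+n≡m p≤x+i′))))))
        where
        x<n : suc j ℕ.< n
        x<n = ℕ.≤-<-trans j<j′ (Fin.toℕ<n j′)
        i′<p′ : toℕ i′ ℕ.< p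
        i′<p′ = ≡.subst (toℕ i′ ℕ.<_) (toℕ-at p<n) i′<p
        p≤x+i′ : p ℕ.≤ suc j ℕ.+ toℕ i′
        p≤x+i′ = ℕ.≤-trans (ℕ.m≤n⇒m≤1+n p≤j) (ℕ.m≤m+n (suc j) (toℕ i′))
        y<x : suc j ℕ.+ toℕ i′ ℕ.∸ p ℕ.< suc j
        y<x = ℕ.+-cancelʳ-< p _ _ (≡.subst (ℕ._< suc j ℕ.+ p) (≡.sym (ℕ.m∸n+n≡m p≤x+i′)) (ℕ.+-monoʳ-< (suc j) i′<p′))
        y<n : suc j ℕ.+ toℕ i′ ℕ.∸ p ℕ.< n
        y<n = ℕ.<-trans y<x x<n
        x y : Fin n
        x = at x<n
        y = at y<n

  -- The leading run of h unmarked positions is long enough to be the source of every later run.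
  module _ {h : ℕ} (0<h : 0 ℕ.< h) (leading : ∀ y → y ℕ.< h → nth bs y ≡ false) (n≤h+h : n ℕ.≤ h ℕ.+ h) where
    private
      Suffix : List Bool → ℕ → Set
      Suffix r j = (∀ i → nth bs (j ℕ.+ i) ≡ nth r i) × j ℕ.+ length r ≡ n

      head-at : ∀ {b r j} → Suffix (b ∷ r) j → nth bs j ≡ b
      head-at {j = j} (same , _) = ≡.trans (≡.cong (nth bs) (≡.sym (ℕ.+-identityʳ j))) (same 0)

      tail-at : ∀ {b r j} → Suffix (b ∷ r) j → Suffix r (suc j)
      tail-at {r = r} {j} (same , len) = (λ i → ≡.trans (≡.cong (nth bs) (≡.sym (ℕ.+-suc j i))) (same (suc i)))
                                 , ≡.trans (≡.sym (ℕ.+-suc j (length r))) len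

      bound : ∀ {b r j} → Suffix (b ∷ r) j → j ℕ.< n
      bound {r = r} {j} (_ , len) = ≡.subst (suc j ℕ.≤_) len (≡.subst (suc j ℕ.≤_) (≡.sym (ℕ.+-suc j (length r))) (ℕ.s≤s (ℕ.m≤m+n j (length r))))

      end : ∀ {j} → Suffix [] j → j ≡ n
      end {j} (_ , len) = ≡.trans (≡.sym (ℕ.+-identityʳ j)) len

      marked⇒h≤ : ∀ {j} → nth bs j ≡ true → h ℕ.≤ j
      marked⇒h≤ {j} marked = ℕ.≮⇒≥ λ j<h → contradiction (≡.trans (≡.sym marked) (leading j j<h)) λ ()

      step : ∀ {p j} → (∀ y → p ℕ.≤ y → y ℕ.< j → nth bs y ≡ false) → nth bs j ≡ false →
             ∀ y → p ℕ.≤ y → y ℕ.< suc j → nth bs y ≡ false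
      step {j = j} before now y p≤y y≤j with ℕ.m≤n⇒m<n∨m≡n (ℕ.s≤s⁻¹ y≤j)
      ... | inj₁ y<j    = before y p≤y y<j
      ... | inj₂ ≡.refl = now

      -- A run either starts beyond the first `h` positions or is the leading one. The latter starts
      -- at 1, position 0 being a factor of its own, and copies itself with shift 1.
      copy-to : ∀ {p j k} → p ℕ.< j → j ℕ.≤ n → h ℕ.≤ p ⊎ p ≡ 1 → (∀ y → p ℕ.≤ y → y ℕ.< j → nth bs y ≡ false) →
                j ≡ n ⊎ nth bs j ≡ true → Factors T j k → Factors T p (suc k)
      copy-to {p} {suc j} p<j j≤n start before ends rest = copy-run (0<p start) (ℕ.s≤s⁻¹ p<j) j≤n
        (λ y p≤y y≤j → before y p≤y (ℕ.s≤s y≤j)) (source start) ends rest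
        where
        0<p : h ℕ.≤ p ⊎ p ≡ 1 → 0 ℕ.< p
        0<p (inj₁ h≤p)    = ℕ.<-≤-trans 0<h h≤p
        0<p (inj₂ ≡.refl) = ℕ.s≤s ℕ.z≤n
        source : h ℕ.≤ p ⊎ p ≡ 1 → ∀ y → y ℕ.+ p ℕ.≤ j → nth bs y ≡ false
        -- As n ≤ 2h, a run that starts at `h` or later has length at most `h`, so its source lies
        -- within the leading run.
        source (inj₁ h≤p) y y+p≤j = leading y (ℕ.+-cancelʳ-< h y h
          (ℕ.<-≤-trans (ℕ.≤-<-trans (ℕ.+-monoʳ-≤ y h≤p) (ℕ.≤-<-trans y+p≤j j≤n)) n≤h+h))
        source (inj₂ ≡.refl) zero y+p≤j = leading 0 0<h
        source (inj₂ ≡.refl) (suc y) y+p≤j = before (suc y) (ℕ.s≤s ℕ.z≤n)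
          (ℕ.s≤s (≡.subst (ℕ._≤ j) (ℕ.+-comm y 1) (ℕ.≤-trans (ℕ.n≤1+n _) y+p≤j)))

    from-start : ∀ r j → Suffix r j → h ℕ.≤ j → Factors T j (factors r)
    -- `p` is where the pending copy factor starts and `j` how far it has been scanned; the `suc` is
    -- this factor, emitted when a mark or the end stops the run.
    from-run   : ∀ r j p → Suffix r j → p ℕ.< j → h ℕ.≤ p ⊎ p ≡ 1 →
                 (∀ y → p ℕ.≤ y → y ℕ.< j → nth bs y ≡ false) → Factors T p (suc (run r))

    from-start [] j s h≤j rewrite end s = done
    from-start (true ∷ r) j s h≤j =
      new-marked (bound s) (head-at s) (from-start r (suc j) (tail-at s) (ℕ.m≤n⇒m≤1+n h≤j))
    from-start (false ∷ r) j s h≤j =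
      from-run r (suc j) j (tail-at s) ℕ.≤-refl (inj₁ h≤j) (step (λ y j≤y y<j → contradiction j≤y (ℕ.<⇒≱ y<j)) (head-at s))

    from-run [] j p s p<j start before =
      copy-to p<j (ℕ.≤-reflexive (end s)) start before (inj₁ (end s)) (≡.subst (λ q → Factors T q 0) (≡.sym (end s)) done)
    from-run (true ∷ r) j p s p<j start before =
      copy-to p<j (ℕ.<⇒≤ (bound s)) start before (inj₂ (head-at s))
        (from-start (true ∷ r) j s (marked⇒h≤ (head-at s)))
    from-run (false ∷ r) j p s p<j start before =
      from-run r (suc j) p (tail-at s) (ℕ.m≤n⇒m≤1+n p<j) start (step before (head-at s))

-- The family of texts with optional marks

blocks : ∀ {M} → Subset M → List Bool
blocks []      = []
blocks (b ∷ v) = b ∷ false ∷ blocks v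

-- The unmarked second half of each block makes every mark cost exactly two factors, its own letter
-- and the run after it, however the marks are placed.
run-blocks : ∀ {M} (v : Subset M) bs → run (blocks v ++ bs) ≡ 2 ℕ.* card v ℕ.+ run bs
run-blocks []          bs = ≡.refl
run-blocks (true ∷ v)  bs = ≡.trans (≡.cong (2 ℕ.+_) (run-blocks v bs)) (≡.cong (ℕ._+ run bs) (≡.sym (ℕ.*-suc 2 (card v))))
run-blocks (false ∷ v) bs = run-blocks v bs

run-replicate : ∀ h bs → run (replicate h false ++ bs) ≡ run bs
run-replicate zero    bs = ≡.refl
run-replicate (suc h) bs = run-replicate h bs

length-blocks : ∀ {M} (v : Subset M) → length (blocks v) ≡ 2 ℕ.* M
length-blocks []      = ≡.refl
length-blocks {suc M} (b ∷ v) = ≡.trans (≡.cong (2 ℕ.+_) (length-blocks v)) (≡.sym (ℕ.*-suc 2 M))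

layout : ∀ {M} → ℕ → Subset M → List Bool → List Bool
layout h v tl = replicate h false ++ blocks v ++ tl

nth-replicate : ∀ h bs y → y ℕ.< h → nth (replicate h false ++ bs) y ≡ false
nth-replicate (suc h) bs zero    _   = ≡.refl
nth-replicate (suc h) bs (suc y) y<h = nth-replicate h bs y (ℕ.s≤s⁻¹ y<h)

nth-++-≡ : ∀ h bs bs′ p → (∀ q → p ≡ h ℕ.+ q → nth bs q ≡ nth bs′ q) →
           nth (replicate h false ++ bs) p ≡ nth (replicate h false ++ bs′) p
nth-++-≡ zero    bs bs′ p       same = same p ≡.refl
nth-++-≡ (suc h) bs bs′ zero    same = ≡.refl
nth-++-≡ (suc h) bs bs′ (suc p) same = nth-++-≡ h bs bs′ p λ q eq → same q (≡.cong suc eq)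

nth-blocks-≡ : ∀ {M} (v : Subset M) i b tl p → p ≢ 2 ℕ.* toℕ i → nth (blocks v ++ tl) p ≡ nth (blocks (v [ i ]≔ b) ++ tl) p
nth-blocks-≡ (c ∷ v) zero    b tl zero          p≢ = contradiction ≡.refl p≢
nth-blocks-≡ (c ∷ v) zero    b tl (suc p)       p≢ = ≡.refl
nth-blocks-≡ (c ∷ v) (suc i) b tl zero          p≢ = ≡.refl
nth-blocks-≡ (c ∷ v) (suc i) b tl (suc zero)    p≢ = ≡.refl
nth-blocks-≡ (c ∷ v) (suc i) b tl (suc (suc p)) p≢ =
  nth-blocks-≡ v i b tl p λ eq → p≢ (≡.trans (≡.cong (2 ℕ.+_) eq) (≡.sym (ℕ.*-suc 2 (toℕ i))))

-- The common tail `tl` adjusts the parity of the size. Writing the leading length as 2 + h makes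
-- positions 0 and 1 unmarked by computation.
module Family {n σ M h : ℕ} (n≤σ : n ℕ.≤ σ) (tl : List Bool)
              (len : 2 ℕ.+ h ℕ.+ (2 ℕ.* M ℕ.+ length tl) ≡ n) (n≤ : n ℕ.≤ (2 ℕ.+ h) ℕ.+ (2 ℕ.+ h)) where
  private
    0<n : 0 ℕ.< n
    0<n = ≡.subst (0 ℕ.<_) len (ℕ.s≤s ℕ.z≤n)

  module Member (v : Subset M) = MarkedText 0<n n≤σ (layout (2 ℕ.+ h) v tl) ≡.refl

  member : Subset M → Text n σ
  member v = Member.text v

  -- The 2 stands for the first letter and for the rest of the leading run.
  size : Subset M → ℕ
  size v = 2 ℕ.+ (2 ℕ.* card v ℕ.+ run tl)

  member-size : ∀ v → LZ77-size (member v) (size v)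
  member-size v = ≡.subst (λ q → Factors (member v) q (size v)) (Fin.toℕ-fromℕ< 0<n)
    (new (fromℕ< 0<n) (λ y y<0 → contradiction (≡.subst (toℕ y ℕ.<_) (Fin.toℕ-fromℕ< 0<n) y<0) λ ())
      (≡.subst₂ (Factors (member v)) (≡.cong suc (≡.sym (Fin.toℕ-fromℕ< 0<n))) (≡.cong suc (≡.trans (run-replicate h _) (run-blocks v tl)))
        (Member.from-run v (ℕ.s≤s ℕ.z≤n) (nth-replicate (2 ℕ.+ h) (blocks v ++ tl)) n≤
          (replicate h false ++ blocks v ++ tl) 2 1 ((λ i → ≡.refl) , length-eq) (ℕ.s≤s (ℕ.s≤s ℕ.z≤n)) (inj₂ ≡.refl)
          λ y 1≤y y<2 → nth-replicate (2 ℕ.+ h) (blocks v ++ tl) y (ℕ.<-≤-trans y<2 (ℕ.m≤m+n 2 h)))))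
    where
    length-eq : 2 ℕ.+ length (replicate h false ++ blocks v ++ tl) ≡ n
    length-eq = ≡.trans (≡.cong (2 ℕ.+_) (≡.trans (List.length-++ (replicate h false))
      (≡.cong₂ ℕ._+_ (List.length-replicate h) (≡.trans (List.length-++ (blocks v)) (≡.cong (ℕ._+ length tl) (length-blocks v)))))) len

  private
    pos<n : ∀ (i : Fin M) → 2 ℕ.+ h ℕ.+ 2 ℕ.* toℕ i ℕ.< n
    pos<n i = ≡.subst (2 ℕ.+ h ℕ.+ 2 ℕ.* toℕ i ℕ.<_) len (ℕ.+-monoʳ-< (2 ℕ.+ h)
      (ℕ.<-≤-trans (ℕ.*-monoʳ-< 2 (Fin.toℕ<n i)) (ℕ.m≤m+n (2 ℕ.* M) (length tl))))

  pos : Fin M → Fin n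
  pos i = fromℕ< (pos<n i)

  pos-injective : ∀ {i j} → pos i ≡ pos j → i ≡ j
  pos-injective {i} {j} eq = Fin.toℕ-injective (ℕ.*-cancelˡ-≡ (toℕ i) (toℕ j) 2 (ℕ.+-cancelˡ-≡ (2 ℕ.+ h) _ _
    (≡.trans (≡.sym (Fin.toℕ-fromℕ< (pos<n i))) (≡.trans (≡.cong toℕ eq) (Fin.toℕ-fromℕ< (pos<n j))))))

  member-agree : ∀ v i b p → p ≢ pos i → member v p ≡ member (v [ i ]≔ b) p
  member-agree v i b p p≢ = ≡.cong (λ c → if c then Fin.inject≤ p n≤σ else fromℕ< (ℕ.<-≤-trans 0<n n≤σ))
    (nth-++-≡ (2 ℕ.+ h) (blocks v ++ tl) (blocks (v [ i ]≔ b) ++ tl) (toℕ p) λ q p≡h+q →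
      nth-blocks-≡ v i b tl q λ q≡2i → p≢ (Fin.toℕ-injective
        (≡.trans p≡h+q (≡.trans (≡.cong (2 ℕ.+ h ℕ.+_) q≡2i) (≡.sym (Fin.toℕ-fromℕ< (pos<n i)))))))

-- The adversary bound

card-add : ∀ {M} (v : Subset M) i → lookup v i ≡ false → card (v [ i ]≔ true) ≡ suc (card v)
card-add (false ∷ v) zero    _  = ≡.refl
card-add (true ∷ v)  (suc i) eq = ≡.cong suc (card-add v i eq)
card-add (false ∷ v) (suc i) eq = card-add v i eq

-- Q is the integer part of √D / C. The number of queries promised by the cheapness hypothesis may
-- depend on the text; this yields one bound for a whole family.
floor-sqrt : ∀ C .{{_ : NonZero C}} D → Σ[ Q ∈ ℕ ] (C ℕ.* Q) ℕ.* (C ℕ.* Q) ℕ.≤ D × D ℕ.< (C ℕ.* suc Q) ℕ.* (C ℕ.* suc Q)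
floor-sqrt C zero = 0 , ℕ.≤-reflexive (≡.cong (λ x → x ℕ.* x) (ℕ.*-zeroʳ C)) , ℕ.*-mono-< C*1>0 C*1>0
  where
  C*1>0 : 0 ℕ.< C ℕ.* 1
  C*1>0 = ≡.subst (0 ℕ.<_) (≡.sym (ℕ.*-identityʳ C)) (ℕ.>-nonZero⁻¹ C)
floor-sqrt C (suc D) with Q , lo , hi ← floor-sqrt C D with (C ℕ.* suc Q) ℕ.* (C ℕ.* suc Q) ℕ.≤? suc D
... | no  ¬le = Q , ℕ.m≤n⇒m≤1+n lo , ℕ.≰⇒> ¬le
... | yes le  = suc Q , le , ℕ.≤-<-trans hi (ℕ.*-mono-< C<C′ C<C′)
  where
  C<C′ : C ℕ.* suc Q ℕ.< C ℕ.* suc (suc Q)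
  C<C′ = ℕ.*-monoʳ-< C (ℕ.n<1+n (suc Q))

-- With x = a b the inequalities give 3x ≤ E (Q + 1) Q ≤ 2 E Q² ≤ x. The weights use Q + 1 to stay
-- positive, but the factor Q from the query count remains, so Q ≤ Q² also covers Q = 0.
no-small-Q : ∀ a b Q E → 0 ℕ.< a ℕ.* b → (2 ℕ.* E) ℕ.* (Q ℕ.* Q) ℕ.≤ a ℕ.* b →
  ¬ (4 ℕ.* suc Q ℕ.* (a ℕ.* b) ℕ.≤ E ℕ.* suc Q ℕ.* suc Q ℕ.* Q ℕ.+ (a ℕ.* b) ℕ.* Q)
no-small-Q a b Q E 0<x small le = ℕ.<⇒≱ (ℕ.m<m+n x (ℕ.<-≤-trans 0<x (ℕ.m≤m+n x (x ℕ.+ 0)))) 3x≤x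
  where
  open ℕ.≤-Reasoning
  open ℕ-Solver
  x S : ℕ
  x = a ℕ.* b
  S = suc Q
  Q≤Q² : ∀ q → q ℕ.≤ q ℕ.* q
  Q≤Q² zero    = ℕ.z≤n
  Q≤Q² (suc q) = ℕ.m≤m*n (suc q) (suc q)
  scaled : S ℕ.* (3 ℕ.* x) ℕ.≤ S ℕ.* (E ℕ.* S ℕ.* Q)
  scaled = ℕ.+-cancelʳ-≤ (x ℕ.* S) _ _ (begin
    S ℕ.* (3 ℕ.* x) ℕ.+ x ℕ.* S           ≡⟨ solve 2 (λ S x → S :* (con 3 :* x) :+ x :* S := con 4 :* S :* x) ≡.refl S x ⟩
    4 ℕ.* S ℕ.* x                         ≤⟨ le ⟩
    E ℕ.* S ℕ.* S ℕ.* Q ℕ.+ x ℕ.* Q       ≤⟨ ℕ.+-monoʳ-≤ _ (ℕ.*-monoʳ-≤ x (ℕ.n≤1+n Q)) ⟩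
    E ℕ.* S ℕ.* S ℕ.* Q ℕ.+ x ℕ.* S       ≡⟨ ≡.cong (ℕ._+ x ℕ.* S) (solve 3 (λ E S Q → E :* S :* S :* Q := S :* (E :* S :* Q)) ≡.refl E S Q) ⟩
    S ℕ.* (E ℕ.* S ℕ.* Q) ℕ.+ x ℕ.* S     ∎)
  3x≤x : x ℕ.+ (x ℕ.+ (x ℕ.+ 0)) ℕ.≤ x
  3x≤x = begin
    3 ℕ.* x                               ≤⟨ ℕ.*-cancelˡ-≤ S scaled ⟩
    E ℕ.* S ℕ.* Q                         ≡⟨ solve 2 (λ E Q → E :* (con 1 :+ Q) :* Q := E :* (Q :* Q) :+ E :* Q) ≡.refl E Q ⟩
    E ℕ.* (Q ℕ.* Q) ℕ.+ E ℕ.* Q           ≤⟨ ℕ.+-monoʳ-≤ (E ℕ.* (Q ℕ.* Q)) (ℕ.*-monoʳ-≤ E (Q≤Q² Q)) ⟩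
    E ℕ.* (Q ℕ.* Q) ℕ.+ E ℕ.* (Q ℕ.* Q)   ≡⟨ solve 2 (λ E y → E :* y :+ E :* y := con 2 :* E :* y) ≡.refl E (Q ℕ.* Q) ⟩
    2 ℕ.* E ℕ.* (Q ℕ.* Q)                 ≤⟨ small ⟩
    x                                     ∎

-- The optimal l is √((M - k) / (k + 1)).  Here b stands for k, and 96 (Q + 1) / (b + 1) serves
-- equally well: it is rational, and of the same order when Q² is of order (M - k)(k + 1).
module Weights (Q b : ℕ) where
  private
    S B : ℚ
    S = fromℕ 96 *ℚ fromℕ (suc Q)
    B = fromℕ (suc b)

    fromℕ-pos : ∀ m → ℚ.Positive (fromℕ (suc m))
    fromℕ-pos m = ℚ.normalize-pos (suc m) 1

    instance
      B-pos : ℚ.Positive B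
      B-pos = fromℕ-pos b
      S-pos : ℚ.Positive S
      S-pos = ℚ.pos*pos⇒pos (fromℕ 96) (fromℕ (suc Q)) {{fromℕ-pos Q}}
      B≢0 : ℚ.NonZero B
      B≢0 = ℚ.pos⇒nonZero B
      S≢0 : ℚ.NonZero S
      S≢0 = ℚ.pos⇒nonZero S

  l m : ℚ
  l = S *ℚ ℚ.1/ B
  m = B *ℚ ℚ.1/ S

  open +-*-Solver

  lm≡1 : l *ℚ m ≡ 1ℚ
  lm≡1 = ≡.trans (solve 4 (λ s t b r → (s :* t) :* (b :* r) := (s :* r) :* (b :* t)) ≡.refl S (ℚ.1/ B) B (ℚ.1/ S))
    (≡.cong₂ _*ℚ_ (ℚ.*-inverseʳ S) (ℚ.*-inverseʳ B))

  0≤l : 0ℚ ≤ℚ l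
  0≤l = 0≤p*q (ℚ.<⇒≤ (ℚ.positive⁻¹ S)) (ℚ.<⇒≤ (ℚ.positive⁻¹ (ℚ.1/ B) {{ℚ.1/pos⇒pos B}}))

  0≤m : 0ℚ ≤ℚ m
  0≤m = 0≤p*q (ℚ.<⇒≤ (ℚ.positive⁻¹ B)) (ℚ.<⇒≤ (ℚ.positive⁻¹ (ℚ.1/ S) {{ℚ.1/pos⇒pos S}}))

  -- Multiplication by S = 96 (Q + 1) removes the inverses, since l B = S and S m = B. The constant
  -- 96 makes the left coefficient 96/24 = 4, a surplus of 3 over the last term.
  clear-denominators : ∀ a → let q = fromℕ Q in
    B *ℚ (fromℕ a *ℚ (ℤ.+ 1 ℚ./ 24)) ≤ℚ B *ℚ (l *ℚ q) +ℚ (m *ℚ q) *ℚ fromℕ a →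
    4 ℕ.* suc Q ℕ.* (a ℕ.* suc b) ℕ.≤ (96 ℕ.* 96) ℕ.* suc Q ℕ.* suc Q ℕ.* Q ℕ.+ (a ℕ.* suc b) ℕ.* Q
  clear-denominators a le = fromℕ-cancel-≤ (≡.subst₂ _≤ℚ_ left right (ℚ.*-monoˡ-≤-nonNeg S {{ℚ.pos⇒nonNeg S}} le))
    where
    open ≡.≡-Reasoning
    q α s : ℚ
    q = fromℕ Q
    α = fromℕ a
    s = fromℕ (suc Q)
    left : S *ℚ (B *ℚ (α *ℚ (ℤ.+ 1 ℚ./ 24))) ≡ fromℕ (4 ℕ.* suc Q ℕ.* (a ℕ.* suc b))
    left = begin
      S *ℚ (B *ℚ (α *ℚ (ℤ.+ 1 ℚ./ 24)))
        ≡⟨ solve 3 (λ s b a → (con (fromℕ 96) :* s) :* (b :* (a :* con (ℤ.+ 1 ℚ./ 24))) := con (fromℕ 4) :* s :* (a :* b)) ≡.refl s B α ⟩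
      fromℕ 4 *ℚ s *ℚ (α *ℚ B)
        ≡⟨ ≡.cong₂ _*ℚ_ (≡.sym (fromℕ-* 4 (suc Q))) (≡.sym (fromℕ-* a (suc b))) ⟩
      fromℕ (4 ℕ.* suc Q) *ℚ fromℕ (a ℕ.* suc b)
        ≡⟨ fromℕ-* (4 ℕ.* suc Q) (a ℕ.* suc b) ⟨
      fromℕ (4 ℕ.* suc Q ℕ.* (a ℕ.* suc b)) ∎
    right : S *ℚ (B *ℚ (l *ℚ q) +ℚ (m *ℚ q) *ℚ α) ≡ fromℕ ((96 ℕ.* 96) ℕ.* suc Q ℕ.* suc Q ℕ.* Q ℕ.+ (a ℕ.* suc b) ℕ.* Q)
    right = begin
      S *ℚ (B *ℚ (l *ℚ q) +ℚ (m *ℚ q) *ℚ α)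
        ≡⟨ solve 6 (λ S B t r q a → S :* (B :* ((S :* t) :* q) :+ ((B :* r) :* q) :* a)
             := (S :* S :* q) :* (B :* t) :+ (a :* B :* q) :* (S :* r)) ≡.refl S B (ℚ.1/ B) (ℚ.1/ S) q α ⟩
      (S *ℚ S *ℚ q) *ℚ (B *ℚ ℚ.1/ B) +ℚ (α *ℚ B *ℚ q) *ℚ (S *ℚ ℚ.1/ S)
        ≡⟨ ≡.cong₂ (λ x y → (S *ℚ S *ℚ q) *ℚ x +ℚ (α *ℚ B *ℚ q) *ℚ y) (ℚ.*-inverseʳ B) (ℚ.*-inverseʳ S) ⟩
      (S *ℚ S *ℚ q) *ℚ 1ℚ +ℚ (α *ℚ B *ℚ q) *ℚ 1ℚ
        ≡⟨ solve 4 (λ s B q a → ((con (fromℕ 96) :* s) :* (con (fromℕ 96) :* s) :* q) :* con 1ℚ :+ (a :* B :* q) :* con 1ℚ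
             := con (fromℕ (96 ℕ.* 96)) :* s :* s :* q :+ (a :* B) :* q) ≡.refl s B q α ⟩
      fromℕ (96 ℕ.* 96) *ℚ s *ℚ s *ℚ q +ℚ (α *ℚ B) *ℚ q
        ≡⟨ ≡.cong₂ _+ℚ_
             (≡.trans (≡.cong (λ x → x *ℚ s *ℚ q) (≡.sym (fromℕ-* (96 ℕ.* 96) (suc Q))))
             (≡.trans (≡.cong (_*ℚ q) (≡.sym (fromℕ-* ((96 ℕ.* 96) ℕ.* suc Q) (suc Q))))
                      (≡.sym (fromℕ-* ((96 ℕ.* 96) ℕ.* suc Q ℕ.* suc Q) Q))))
             (≡.trans (≡.cong (_*ℚ q) (≡.sym (fromℕ-* a (suc b)))) (≡.sym (fromℕ-* (a ℕ.* suc b) Q))) ⟩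
      fromℕ ((96 ℕ.* 96) ℕ.* suc Q ℕ.* suc Q ℕ.* Q) +ℚ fromℕ ((a ℕ.* suc b) ℕ.* Q)
        ≡⟨ fromℕ-+ ((96 ℕ.* 96) ℕ.* suc Q ℕ.* suc Q ℕ.* Q) ((a ℕ.* suc b) ℕ.* Q) ⟨
      fromℕ ((96 ℕ.* 96) ℕ.* suc Q ℕ.* suc Q ℕ.* Q ℕ.+ (a ℕ.* suc b) ℕ.* Q) ∎

module _ {n σ M h : ℕ} (n≤σ : n ℕ.≤ σ) (tl : List Bool)
         (len : 2 ℕ.+ h ℕ.+ (2 ℕ.* M ℕ.+ length tl) ≡ n) (n≤ : n ℕ.≤ (2 ℕ.+ h) ℕ.+ (2 ℕ.+ h)) where
  open Family {n} {σ} {M} {h} n≤σ tl len n≤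

  adversary-bound : (A : Algorithm n σ) → ComputesLZ77-size A → ∀ {k Q} → k ℕ.< M →
    (∀ v → card v ≡ k → Σ[ q ∈ ℕ ] UsesAtMost A (member v) q × q ℕ.≤ Q) →
    ¬ ((2 ℕ.* (96 ℕ.* 96)) ℕ.* (Q ℕ.* Q) ℕ.≤ (M ℕ.∸ k) ℕ.* suc k)
  adversary-bound A computes {k} {Q} k<M cheap small =
    no-small-Q (M ℕ.∸ k) (suc k) Q (96 ℕ.* 96) (ℕ.*-mono-< (ℕ.m<n⇒0<n∸m k<M) (ℕ.s≤s (ℕ.z≤n {k}))) small
      (clear-denominators (M ℕ.∸ k)
        (averaging {M} {k} {fromℕ Q} {ℤ.+ 1 ℚ./ 24} {l} {m} (ℕ.<⇒≤ k<M) 0≤l 0≤m W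
          (λ v i → P.queryWeight-nonNeg (member v) (pos i) Q)
          (λ v → ≼-trans (sum-injective pos pos-injective (λ p → P.queryWeight (member v) p Q)
                           (λ p → P.queryWeight-nonNeg (member v) p Q))
                         (P.queryWeight-total (member v) Q))
          pair))
    where
    open Weights Q k
    module P (T : Text n σ) = Run.Probabilities A T
    W : Subset M → Fin M → ℝ
    W v i = P.queryWeight (member v) (pos i) Q
    pair : ∀ v i → card v ≡ k → lookup v i ≡ false → fromℚ (ℤ.+ 1 ℚ./ 24) ≼ l • W v i +ᴿ m • W (v [ i ]≔ true) i
    pair v i eq i∉v =
      Comparison.separation A {l} {m} 0≤m lm≡1 {member v} {member v⁺} (pos i) (member-agree v i true)
        {size v} {size v⁺} {proj₁ (cheap v eq)} {Q} sizes-differ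
        (computes (member v) (size v) (member-size v)) (proj₁ (proj₂ (cheap v eq))) (proj₂ (proj₂ (cheap v eq)))
        (computes (member v⁺) (size v⁺) (member-size v⁺))
      where
      v⁺ : Subset M
      v⁺ = v [ i ]≔ true
      sizes-differ : size v ≢ size v⁺
      sizes-differ = ℕ.<⇒≢ (ℕ.+-monoʳ-< 2 (ℕ.+-monoˡ-< (run tl) (ℕ.*-monoʳ-< 2
        (≡.subst (card v ℕ.<_) (≡.sym (card-add v i i∉v)) (ℕ.n<1+n (card v))))))

-- Choice of the parameters

run-replicate-true : ∀ e → run (replicate e true) ≡ e
run-replicate-true zero    = ≡.refl
run-replicate-true (suc e) = ≡.cong suc (factors-replicate e)
  where
  factors-replicate : ∀ e → factors (replicate e true) ≡ e
  factors-replicate zero    = ≡.refl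
  factors-replicate (suc e) = ≡.cong suc (factors-replicate e)

-- The last two fields give z n ≤ 96 (M - k)(k + 1). The `e` marks at the very end adjust the parity
-- of the size.
record Parameters (n z : ℕ) : Set where
  field
    M h k e : ℕ
    size-≡  : 2 ℕ.+ (2 ℕ.* k ℕ.+ e) ≡ z
    n-≡     : 2 ℕ.+ h ℕ.+ (2 ℕ.* M ℕ.+ e) ≡ n
    n≤2h    : n ℕ.≤ (2 ℕ.+ h) ℕ.+ (2 ℕ.+ h)
    k<M     : k ℕ.< M
    z≤3b    : z ℕ.≤ 3 ℕ.* suc k
    n≤32a   : n ℕ.≤ 32 ℕ.* (M ℕ.∸ k)

parameters : ∀ {n z} → 2 ℕ.≤ z → 16 ℕ.* z ℕ.≤ n → Parameters n z
parameters {n} {z} 2≤z 16z≤n = record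
  { M = M ; h = h ; k = k ; e = e ; size-≡ = size-≡ ; n-≡ = n-≡ ; n≤2h = n≤2h ; k<M = k<M ; z≤3b = z≤3b ; n≤32a = n≤32a }
  where
  open ℕ.≤-Reasoning
  open ℕ-Solver
  M h k e r w : ℕ
  -- The blocks take 2M ≤ n/4 positions, which leaves at least half of the text for the leading run.
  M = n ℕ./ 8
  r = n ℕ.% 8
  w = z ℕ.∸ 2
  k = w ℕ./ 2
  e = w ℕ.% 2
  h = n ℕ.∸ (2 ℕ.+ (2 ℕ.* M ℕ.+ e))
  e≤1 : e ℕ.≤ 1
  e≤1 = ℕ.s≤s⁻¹ (ℕ.m%n<n w 2)
  r≤7 : r ℕ.≤ 7
  r≤7 = ℕ.s≤s⁻¹ (ℕ.m%n<n n 8)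
  n≡ : n ≡ r ℕ.+ M ℕ.* 8
  n≡ = ℕ.m≡m%n+[m/n]*n n 8
  size-≡ : 2 ℕ.+ (2 ℕ.* k ℕ.+ e) ≡ z
  size-≡ = ≡.trans (≡.cong (2 ℕ.+_) (≡.trans (solve 2 (λ k e → con 2 :* k :+ e := e :+ k :* con 2) ≡.refl k e)
    (≡.sym (ℕ.m≡m%n+[m/n]*n w 2)))) (ℕ.m+[n∸m]≡n 2≤z)
  -- This is where 16 z ≤ n enters: k + 1 is at most about a quarter of M, so M - k is a fixed
  -- fraction of n.
  32b≤n : 32 ℕ.* suc k ℕ.≤ n
  32b≤n = begin
    32 ℕ.* suc k                      ≤⟨ ℕ.m≤m+n (32 ℕ.* suc k) (16 ℕ.* e) ⟩
    32 ℕ.* suc k ℕ.+ 16 ℕ.* e         ≡⟨ solve 2 (λ k e → con 32 :* (con 1 :+ k) :+ con 16 :* e := con 16 :* (con 2 :+ (con 2 :* k :+ e))) ≡.refl k e ⟩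
    16 ℕ.* (2 ℕ.+ (2 ℕ.* k ℕ.+ e))    ≡⟨ ≡.cong (16 ℕ.*_) size-≡ ⟩
    16 ℕ.* z                          ≤⟨ 16z≤n ⟩
    n                                 ∎
  k<M : k ℕ.< M
  k<M = ℕ.≮⇒≥ λ M<b → ℕ.<⇒≱ (begin-strict
    n                   ≡⟨ n≡ ⟩
    r ℕ.+ M ℕ.* 8       ≤⟨ ℕ.+-monoˡ-≤ (M ℕ.* 8) r≤7 ⟩
    7 ℕ.+ M ℕ.* 8       <⟨ ℕ.n<1+n _ ⟩
    suc M ℕ.* 8         ≤⟨ ℕ.*-mono-≤ M<b (ℕ.m≤m+n 8 24) ⟩
    suc k ℕ.* 32        ≡⟨ ℕ.*-comm (suc k) 32 ⟩
    32 ℕ.* suc k        ∎) 32b≤n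
  half : 2 ℕ.* (2 ℕ.* M ℕ.+ e) ℕ.≤ n
  half = begin
    2 ℕ.* (2 ℕ.* M ℕ.+ e)     ≤⟨ ℕ.*-monoʳ-≤ 2 (ℕ.+-monoʳ-≤ (2 ℕ.* M) (ℕ.≤-trans e≤1 (ℕ.≤-trans (ℕ.s≤s ℕ.z≤n) k<M))) ⟩
    2 ℕ.* (2 ℕ.* M ℕ.+ M)     ≡⟨ solve 1 (λ M → con 2 :* (con 2 :* M :+ M) := con 6 :* M) ≡.refl M ⟩
    6 ℕ.* M                   ≤⟨ ℕ.*-monoˡ-≤ M (ℕ.m≤m+n 6 2) ⟩
    8 ℕ.* M                   ≡⟨ ℕ.*-comm 8 M ⟩
    M ℕ.* 8                   ≤⟨ ℕ.m≤n+m (M ℕ.* 8) r ⟩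
    r ℕ.+ M ℕ.* 8             ≡⟨ n≡ ⟨
    n                         ∎
  n-≡ : 2 ℕ.+ h ℕ.+ (2 ℕ.* M ℕ.+ e) ≡ n
  n-≡ = ≡.trans (solve 2 (λ h X → con 2 :+ h :+ X := h :+ (con 2 :+ X)) ≡.refl h (2 ℕ.* M ℕ.+ e))
    (ℕ.m∸n+n≡m {n} {2 ℕ.+ (2 ℕ.* M ℕ.+ e)} (ℕ.*-cancelˡ-≤ 2 (begin
      2 ℕ.* (2 ℕ.+ (2 ℕ.* M ℕ.+ e))    ≡⟨ ℕ.*-distribˡ-+ 2 2 (2 ℕ.* M ℕ.+ e) ⟩
      4 ℕ.+ 2 ℕ.* (2 ℕ.* M ℕ.+ e)      ≤⟨ ℕ.+-mono-≤ (ℕ.≤-trans (ℕ.m≤m+n 4 28) (ℕ.≤-trans (ℕ.m≤m*n 32 (suc k)) 32b≤n)) half ⟩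
      n ℕ.+ n                          ≡⟨ solve 1 (λ n → n :+ n := con 2 :* n) ≡.refl n ⟩
      2 ℕ.* n                          ∎)))
  n≤2h : n ℕ.≤ (2 ℕ.+ h) ℕ.+ (2 ℕ.+ h)
  n≤2h = ℕ.+-cancelʳ-≤ (2 ℕ.* X) _ _ (begin
    n ℕ.+ 2 ℕ.* X                            ≤⟨ ℕ.+-monoʳ-≤ n half ⟩
    n ℕ.+ n                                  ≡⟨ ≡.cong₂ ℕ._+_ n-≡ n-≡ ⟨
    (2 ℕ.+ h ℕ.+ X) ℕ.+ (2 ℕ.+ h ℕ.+ X)      ≡⟨ solve 2 (λ h X → (h :+ X) :+ (h :+ X) := (h :+ h) :+ con 2 :* X) ≡.refl (2 ℕ.+ h) X ⟩
    (2 ℕ.+ h) ℕ.+ (2 ℕ.+ h) ℕ.+ 2 ℕ.* X      ∎)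
    where
    X : ℕ
    X = 2 ℕ.* M ℕ.+ e
  z≤3b : z ℕ.≤ 3 ℕ.* suc k
  z≤3b = begin
    z                            ≡⟨ size-≡ ⟨
    2 ℕ.+ (2 ℕ.* k ℕ.+ e)        ≤⟨ ℕ.+-monoʳ-≤ 2 (ℕ.+-mono-≤ (ℕ.*-monoˡ-≤ k (ℕ.n≤1+n 2)) e≤1) ⟩
    2 ℕ.+ (3 ℕ.* k ℕ.+ 1)        ≡⟨ solve 1 (λ k → con 2 :+ (con 3 :* k :+ con 1) := con 3 :* (con 1 :+ k)) ≡.refl k ⟩
    3 ℕ.* suc k                  ∎
  n≤32a : n ℕ.≤ 32 ℕ.* (M ℕ.∸ k)
  n≤32a = ℕ.+-cancelˡ-≤ n _ _ (begin
    n ℕ.+ n                              ≤⟨ ℕ.m≤m+n (n ℕ.+ n) (n ℕ.+ n) ⟩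
    (n ℕ.+ n) ℕ.+ (n ℕ.+ n)              ≡⟨ solve 1 (λ n → (n :+ n) :+ (n :+ n) := con 4 :* n) ≡.refl n ⟩
    4 ℕ.* n                              ≡⟨ ≡.cong (4 ℕ.*_) n≡ ⟩
    4 ℕ.* (r ℕ.+ M ℕ.* 8)                ≤⟨ ℕ.*-monoʳ-≤ 4 (ℕ.+-monoˡ-≤ (M ℕ.* 8) r≤7) ⟩
    4 ℕ.* (7 ℕ.+ M ℕ.* 8)                ≡⟨ ≡.cong (λ m → 4 ℕ.* (7 ℕ.+ m ℕ.* 8)) (ℕ.m+[n∸m]≡n (ℕ.<⇒≤ k<M)) ⟨
    4 ℕ.* (7 ℕ.+ (k ℕ.+ a) ℕ.* 8)        ≡⟨ solve 2 (λ k a → con 4 :* (con 7 :+ (k :+ a) :* con 8) := con 28 :+ con 32 :* k :+ con 32 :* a) ≡.refl k a ⟩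
    28 ℕ.+ 32 ℕ.* k ℕ.+ 32 ℕ.* a         ≤⟨ ℕ.+-monoˡ-≤ (32 ℕ.* a) (ℕ.≤-trans (ℕ.+-monoˡ-≤ (32 ℕ.* k) (ℕ.m≤m+n 28 4)) (ℕ.≤-trans (ℕ.≤-reflexive (≡.sym (ℕ.*-suc 32 k))) 32b≤n)) ⟩
    n ℕ.+ 32 ℕ.* a                       ∎)
    where
    a : ℕ
    a = M ℕ.∸ k

-- Sizes in the interval [t^(1-ε), t]

*-^ : ∀ m n q → (m ℕ.* n) ℕ.^ q ≡ m ℕ.^ q ℕ.* n ℕ.^ q
*-^ m n zero    = ≡.refl
*-^ m n (suc q) = ≡.trans (≡.cong (m ℕ.* n ℕ.*_) (*-^ m n q))
  (solve 4 (λ m n x y → m :* n :* (x :* y) := m :* x :* (n :* y)) ≡.refl m n (m ℕ.^ q) (n ℕ.^ q))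
  where open ℕ-Solver

-- From 32^D ≤ n and q ≤ p D follows 32 ≤ n^(p/q). Hence, for p ≤ q, t^(1-p/q) ≤ n^(1-p/q) ≤ n/32 ≤
-- z.
power-bound : ∀ D p q {t n z} → 1 ℕ.≤ z → q ℕ.≤ p ℕ.* D → 32 ℕ.^ D ℕ.≤ n → t ℕ.≤ n → n ℕ.≤ 32 ℕ.* z → t ℕ.^ (q ℕ.∸ p) ℕ.≤ z ℕ.^ q
power-bound D p q {t} {n} {z} 1≤z q≤pD 32^D≤n t≤n n≤32z with ℕ.≤-total q p
... | inj₁ q≤p rewrite ℕ.m≤n⇒m∸n≡0 q≤p = ≡.subst (ℕ._≤ z ℕ.^ q) (ℕ.^-zeroˡ q) (ℕ.^-monoˡ-≤ q 1≤z)
... | inj₂ p≤q = ℕ.*-cancelˡ-≤ (32 ℕ.^ q) {{ℕ.m^n≢0 32 q}} (begin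
  32 ℕ.^ q ℕ.* t ℕ.^ (q ℕ.∸ p)        ≤⟨ ℕ.*-mono-≤ (ℕ.^-monoʳ-≤ 32 q≤pD) (ℕ.^-monoˡ-≤ (q ℕ.∸ p) t≤n) ⟩
  32 ℕ.^ (p ℕ.* D) ℕ.* n ℕ.^ (q ℕ.∸ p) ≡⟨ ≡.cong (λ x → 32 ℕ.^ x ℕ.* n ℕ.^ (q ℕ.∸ p)) (ℕ.*-comm p D) ⟩
  32 ℕ.^ (D ℕ.* p) ℕ.* n ℕ.^ (q ℕ.∸ p) ≡⟨ ≡.cong (ℕ._* n ℕ.^ (q ℕ.∸ p)) (ℕ.^-*-assoc 32 D p) ⟨
  (32 ℕ.^ D) ℕ.^ p ℕ.* n ℕ.^ (q ℕ.∸ p) ≤⟨ ℕ.*-monoˡ-≤ (n ℕ.^ (q ℕ.∸ p)) (ℕ.^-monoˡ-≤ p 32^D≤n) ⟩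
  n ℕ.^ p ℕ.* n ℕ.^ (q ℕ.∸ p)         ≡⟨ ℕ.^-distribˡ-+-* n p (q ℕ.∸ p) ⟨
  n ℕ.^ (p ℕ.+ (q ℕ.∸ p))             ≡⟨ ≡.cong (n ℕ.^_) (ℕ.m+[n∸m]≡n p≤q) ⟩
  n ℕ.^ q                             ≤⟨ ℕ.^-monoˡ-≤ q n≤32z ⟩
  (32 ℕ.* z) ℕ.^ q                    ≡⟨ *-^ 32 z q ⟩
  32 ℕ.^ q ℕ.* z ℕ.^ q                ∎)
  where open ℕ.≤-Reasoning

-- D is the denominator of a positive rational δ below ε. Its numerator is at least 1, so 1/D ≤ δ ≤
-- ε ≤ p/q.
scale : ∀ {ε} → Positiveᴿ ε → Σ[ D ∈ ℕ ] 1 ℕ.≤ D × (∀ p q .{{_ : NonZero q}} → ε ≤ᴿ fromℚ (ℤ.+ p ℚ./ q) → q ℕ.≤ p ℕ.* D)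
scale {ε} (δ , 0<δ , N , δ≤) = ℚ.↧ₙ δ , ℕ.>-nonZero⁻¹ (ℚ.↧ₙ δ) , bound
  where
  δ≼ε : fromℚ δ ≼ ε
  δ≼ε = mk≼ λ η 0<η → N , λ m N≤m → ℚ.≤-trans (δ≤ m N≤m)
    (≡.subst (_≤ℚ seq ε m +ℚ η) (ℚ.+-identityʳ (seq ε m)) (ℚ.+-monoʳ-≤ (seq ε m) (ℚ.<⇒≤ 0<η)))
  denominator : ∀ {δ} → 0ℚ < δ → ∀ p q → δ ≤ℚ ℤ.+ p ℚ./ suc q → suc q ℕ.≤ p ℕ.* ℚ.↧ₙ δ
  denominator {ℚ.mkℚ (ℤ.+ zero) d c} (ℚ.*<* (ℤ.+<+ ())) p q le
  denominator {ℚ.mkℚ (ℤ.+ suc k) d c} 0<δ p q le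
    with ℚᵘ.*≤* le′ ← ℚᵘ.≤-trans (ℚ.toℚᵘ-mono-≤ le) (ℚᵘ.≤-reflexive (ℚ.toℚᵘ-fromℚᵘ (ℚᵘ.mkℚᵘ (ℤ.+ p) q)))
    = ℕ.≤-trans (ℕ.m≤m+n (suc q) (k ℕ.* suc q))
        (ℤ.drop‿+≤+ (≡.subst₂ ℤ._≤_ (≡.sym (ℤ.pos-* (suc k) (suc q))) (≡.sym (ℤ.pos-* p (suc d))) le′))
  bound : ∀ p q .{{_ : NonZero q}} → ε ≤ᴿ fromℚ (ℤ.+ p ℚ./ q) → q ℕ.≤ p ℕ.* ℚ.↧ₙ δ
  bound p zero    _  = ℕ.z≤n
  bound p (suc q) le = denominator 0<δ p q (fromℚ-reflects-≼ (≼-trans δ≼ε (mk≼ le)))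

sqrt-bound : ∀ q D → fromℕ q *ℚ fromℕ q ≤ℚ (ℤ.+ 1 ℚ./ 2000) *ℚ (ℤ.+ 1 ℚ./ 2000) *ℚ fromℕ D →
             (2000 ℕ.* q) ℕ.* (2000 ℕ.* q) ℕ.≤ D
sqrt-bound q D le = fromℕ-cancel-≤ (≡.subst₂ _≤ℚ_ left right
  (ℚ.*-monoˡ-≤-nonNeg (fromℕ 2000) (ℚ.*-monoˡ-≤-nonNeg (fromℕ 2000) le)))
  where
  open +-*-Solver
  left : fromℕ 2000 *ℚ (fromℕ 2000 *ℚ (fromℕ q *ℚ fromℕ q)) ≡ fromℕ ((2000 ℕ.* q) ℕ.* (2000 ℕ.* q))
  left = ≡.trans (solve 2 (λ c q → c :* (c :* (q :* q)) := (c :* q) :* (c :* q)) ≡.refl (fromℕ 2000) (fromℕ q))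
    (≡.trans (≡.cong (λ x → x *ℚ x) (≡.sym (fromℕ-* 2000 q))) (≡.sym (fromℕ-* (2000 ℕ.* q) (2000 ℕ.* q))))
  right : fromℕ 2000 *ℚ (fromℕ 2000 *ℚ ((ℤ.+ 1 ℚ./ 2000) *ℚ (ℤ.+ 1 ℚ./ 2000) *ℚ fromℕ D)) ≡ fromℕ D
  right = solve 1 (λ d → con (fromℕ 2000) :* (con (fromℕ 2000) :* (con (ℤ.+ 1 ℚ./ 2000) :* con (ℤ.+ 1 ℚ./ 2000) :* d)) := d) ≡.refl (fromℕ D)

small-Q : ∀ {a b n z} C K u w .{{_ : NonZero (u ℕ.* w)}} Q → u ℕ.* w ℕ.* K ℕ.≤ C ℕ.* C →
  (C ℕ.* Q) ℕ.* (C ℕ.* Q) ℕ.≤ z ℕ.* n → z ℕ.≤ u ℕ.* b → n ℕ.≤ w ℕ.* a → K ℕ.* (Q ℕ.* Q) ℕ.≤ a ℕ.* b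
small-Q {a} {b} {n} {z} C K u w Q K≤C² le z≤ n≤ = ℕ.*-cancelˡ-≤ (u ℕ.* w) (begin
  u ℕ.* w ℕ.* (K ℕ.* (Q ℕ.* Q))      ≡⟨ ℕ.*-assoc (u ℕ.* w) K (Q ℕ.* Q) ⟨
  u ℕ.* w ℕ.* K ℕ.* (Q ℕ.* Q)        ≤⟨ ℕ.*-monoˡ-≤ (Q ℕ.* Q) K≤C² ⟩
  C ℕ.* C ℕ.* (Q ℕ.* Q)              ≡⟨ solve 2 (λ C Q → C :* C :* (Q :* Q) := (C :* Q) :* (C :* Q)) ≡.refl C Q ⟩
  (C ℕ.* Q) ℕ.* (C ℕ.* Q)            ≤⟨ le ⟩
  z ℕ.* n                            ≤⟨ ℕ.*-mono-≤ z≤ n≤ ⟩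
  (u ℕ.* b) ℕ.* (w ℕ.* a)            ≡⟨ solve 4 (λ u b w a → (u :* b) :* (w :* a) := u :* w :* (a :* b)) ≡.refl u b w a ⟩
  u ℕ.* w ℕ.* (a ℕ.* b)              ∎)
  where
  open ℕ.≤-Reasoning
  open ℕ-Solver

not-cheap : ∀ {n σ t z ε} → n ℕ.≤ σ → 2 ℕ.≤ z → 16 ℕ.* z ℕ.≤ n → SizeInRange t ε z →
            (A : Algorithm n σ) → ComputesLZ77-size A → ¬ CheapOnRange A (ℤ.+ 1 ℚ./ 2000) t ε
not-cheap {n} {σ} {t} {z} {ε} n≤σ 2≤z 16z≤n in-range A computes cheap =
  adversary-bound n≤σ tl len n≤2h A computes {k} {Q} k<M cheap-member
    -- The evaluated inequality 3 · 32 · 2 · 96² = 1769472 ≤ 2000² is what the constant 1/2000 is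
    -- chosen for.
    (small-Q {M ℕ.∸ k} {suc k} {n} {z} 2000 (2 ℕ.* (96 ℕ.* 96)) 3 32 Q (ℕ.≤ᵇ⇒≤ _ _ _) Q-lower z≤3b n≤32a)
  where
  open Parameters (parameters 2≤z 16z≤n)
  tl : List Bool
  tl = replicate e true
  len : 2 ℕ.+ h ℕ.+ (2 ℕ.* M ℕ.+ length tl) ≡ n
  len = ≡.trans (≡.cong (λ x → 2 ℕ.+ h ℕ.+ (2 ℕ.* M ℕ.+ x)) (List.length-replicate e)) n-≡
  open Family {n} {σ} {M} {h} n≤σ tl len n≤2h
  root : Σ[ Q ∈ ℕ ] (2000 ℕ.* Q) ℕ.* (2000 ℕ.* Q) ℕ.≤ z ℕ.* n × z ℕ.* n ℕ.< (2000 ℕ.* suc Q) ℕ.* (2000 ℕ.* suc Q)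
  root = floor-sqrt 2000 (z ℕ.* n)
  Q : ℕ
  Q = proj₁ root
  Q-lower : (2000 ℕ.* Q) ℕ.* (2000 ℕ.* Q) ℕ.≤ z ℕ.* n
  Q-lower = proj₁ (proj₂ root)
  size≡z : ∀ v → card v ≡ k → size v ≡ z
  size≡z v eq = ≡.trans (≡.cong₂ (λ c r → 2 ℕ.+ (2 ℕ.* c ℕ.+ r)) eq (run-replicate-true e)) size-≡
  cheap-member : ∀ v → card v ≡ k → Σ[ q ∈ ℕ ] UsesAtMost A (member v) q × q ℕ.≤ Q
  cheap-member v eq =
    let q , halted , bound = cheap (member v) z (≡.subst (LZ77-size (member v)) (size≡z v eq) (member-size v)) in-range
    in q , halted , ℕ.≮⇒≥ λ Q<q → ℕ.<⇒≱ (proj₂ (proj₂ root))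
         (ℕ.≤-trans (ℕ.*-mono-≤ (ℕ.*-monoʳ-≤ 2000 Q<q) (ℕ.*-monoʳ-≤ 2000 Q<q)) (sqrt-bound q (z ℕ.* n) bound))

uniform-bound : ∀ (ε : ℝ) → Positiveᴿ ε → Σ[ N ∈ ℕ ]
  (∀ (n σ t : ℕ) → N ≤ n → n ≤ σ → 2 ≤ t → t ≤ n →
   ∀ (A : Algorithm n σ) → ComputesLZ77-size A → ¬ CheapOnRange A (ℤ.+ 1 ℚ./ 2000) t ε)
-- As 1/D ≤ ε, such n satisfy n^ε ≥ 32, and losing a factor 32 in z does not leave the interval.
uniform-bound ε 0<ε = 32 ℕ.^ D , bound
  where
  D : ℕ
  D = proj₁ (scale {ε} 0<ε)
  1≤D : 1 ℕ.≤ D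
  1≤D = proj₁ (proj₂ (scale {ε} 0<ε))
  scaled : ∀ p q .{{_ : NonZero q}} → ε ≤ᴿ fromℚ (ℤ.+ p ℚ./ q) → q ℕ.≤ p ℕ.* D
  scaled = proj₂ (proj₂ (scale {ε} 0<ε))

  -- The family has room for z factors if 16 z ≤ n. If t is too large for that, n/16 is taken
  -- instead, which is at least n/32 and hence at least t/32.
  choose : ∀ {n t} → 32 ℕ.^ D ℕ.≤ n → 2 ℕ.≤ t → t ℕ.≤ n → 16 ℕ.* t ℕ.≤ n ⊎ n ℕ.≤ 16 ℕ.* t →
           Σ[ z ∈ ℕ ] 2 ℕ.≤ z × 16 ℕ.* z ℕ.≤ n × SizeInRange t ε z
  choose {n} {t} N≤n 2≤t t≤n (inj₁ 16t≤n) =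
    t , 2≤t , 16t≤n , (1≤t , λ p q _ → ℕ.^-monoʳ-≤ t {{ℕ.>-nonZero 1≤t}} (ℕ.m∸n≤m q p)) , ℕ.≤-refl
    where
    1≤t : 1 ℕ.≤ t
    1≤t = ℕ.<⇒≤ 2≤t
  choose {n} {t} N≤n 2≤t t≤n (inj₂ n≤16t) =
    z , 2≤z , 16z≤n , (1≤z , λ p q ε≤p/q → power-bound D p q 1≤z (scaled p q ε≤p/q) N≤n t≤n n≤32z) , z≤t
    where
    open ℕ.≤-Reasoning
    z : ℕ
    z = n ℕ./ 16
    16z≤n : 16 ℕ.* z ℕ.≤ n
    16z≤n = ≡.subst (ℕ._≤ n) (ℕ.*-comm z 16) (ℕ.m/n*n≤m n 16)
    -- D ≥ 1 gives n ≥ 32.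
    2≤z : 2 ℕ.≤ z
    2≤z = ℕ./-monoˡ-≤ 16 (ℕ.≤-trans (ℕ.^-monoʳ-≤ 32 1≤D) N≤n)
    1≤z : 1 ℕ.≤ z
    1≤z = ℕ.<⇒≤ 2≤z
    z≤t : z ℕ.≤ t
    z≤t = ℕ.*-cancelˡ-≤ 16 (ℕ.≤-trans 16z≤n n≤16t)
    n≤32z : n ℕ.≤ 32 ℕ.* z
    n≤32z = begin
      n                         ≡⟨ ℕ.m≡m%n+[m/n]*n n 16 ⟩
      n ℕ.% 16 ℕ.+ z ℕ.* 16     ≤⟨ ℕ.+-monoˡ-≤ (z ℕ.* 16) (ℕ.≤-trans (ℕ.<⇒≤ (ℕ.m%n<n n 16)) (ℕ.m≤n*m 16 z {{ℕ.>-nonZero 1≤z}})) ⟩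
      z ℕ.* 16 ℕ.+ z ℕ.* 16     ≡⟨ ℕ.*-distribˡ-+ z 16 16 ⟨
      z ℕ.* 32                  ≡⟨ ℕ.*-comm z 32 ⟩
      32 ℕ.* z                  ∎

  bound : ∀ (n σ t : ℕ) → 32 ℕ.^ D ≤ n → n ≤ σ → 2 ≤ t → t ≤ n →
          ∀ (A : Algorithm n σ) → ComputesLZ77-size A → ¬ CheapOnRange A (ℤ.+ 1 ℚ./ 2000) t ε
  bound n σ t N≤n n≤σ 2≤t t≤n =
    let z , 2≤z , 16z≤n , in-range = choose N≤n 2≤t t≤n (ℕ.≤-total (16 ℕ.* t) n)
    in not-cheap {ε = ε} n≤σ 2≤z 16z≤n in-range

theorem7 : (Σ[ c ∈ ℚ ] 0ℚ < c × (∀ (ε : ℝ) → Positiveᴿ ε → Σ[ N ∈ ℕ ]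
    (∀ (n σ t : ℕ) → N ≤ n → n ≤ σ → 2 ≤ t → t ≤ n →
    ∀ (A : Algorithm n σ) → ComputesLZ77-size A → ¬ CheapOnRange A c t ε)))
    ×
    (∀ (σ t : ℕ → ℕ) → (∀ n → n ≤ σ n) → (∀ n → 2 ≤ n → (2 ≤ t n) × (t n ≤ n)) →
    ∀ (ε : ℝ) → Positiveᴿ ε →
    ¬ (Σ[ A ∈ (∀ n → .{{_ : NonZero n}} → Algorithm n (σ n)) ]
    (∀ n → .{{_ : NonZero n}} → ComputesLZ77-size (A n)) ×
    (∀ (c : ℚ) → 0ℚ < c → Σ[ N ∈ ℕ ]
    (∀ n → .{{_ : NonZero n}} → N ≤ n → CheapOnRange (A n) c (t n) ε))))
theorem7 = (c , 0<c , uniform-bound) , λ σ t n≤σ t-range ε 0<ε (A , computes , cheap) →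
  let N₁ , bound = uniform-bound ε 0<ε
      N₂ , cheap-from = cheap c 0<c
      -- A single length beyond both thresholds refutes the algorithm; the 2 makes it nonzero by
      -- computation and admits `t-range`.
      n = 2 ℕ.+ (N₁ ℕ.+ N₂)
      2≤n = ℕ.m≤m+n 2 (N₁ ℕ.+ N₂)
      2≤t , t≤n = t-range n 2≤n
  in bound n (σ n) (t n) (ℕ.≤-trans (ℕ.m≤m+n N₁ N₂) (ℕ.m≤n+m (N₁ ℕ.+ N₂) 2)) (n≤σ n) 2≤t t≤n (A n) (computes n)
       (cheap-from n (ℕ.≤-trans (ℕ.m≤n+m N₂ N₁) (ℕ.m≤n+m (N₁ ℕ.+ N₂) 2)))
  where
  c : ℚ
  c = ℤ.+ 1 ℚ./ 2000
  0<c : 0ℚ < c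
  0<c = ℚ.positive⁻¹ c
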